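{- Let $k\ge 1$ and let $G,H$ be simple undirected graphs with vertex set $V=\{1,\dots,n\}$. Then: (i) $\mathcal{T}^k_G=\{\mathcal I_n\}$ (where $\mathcal I_n$ is the $n\times n$ identity matrix) if and only if the $k$-dimensional C-V-C algorithm determines that $G$ is asymmetric; (ii) $\mathcal{T}^k_{G,H}=\emptyset$ if and only if the $k$-dimensional C-V-C algorithm determines that $G$ and $H$ are not isomorphic.
   Context: **Graphs and polytopes.** For a graph $G$ on $V$, $E_G$ is its edge set, $A_G$ its adjacency matrix, $\delta_G(a)=\{b:\{a,b\}\in E_G\}$. Let $e$ be the all-ones vector and $$\mathcal T_{G,H}=\{X\in[0,1]^{n\times n}: A_GX=XA_H,\ Xe=X^Te=e\},\qquad \mathcal T_G=\mathcal T_{G,G}.$$ The equation $A_GX=XA_H$ reads $\sum_{w\in\delta_H(v)}X_{uw}-\sum_{w\in\delta_G(u)}X_{wv}=0$ for all $u,v\in V$. **Sherali-Adams relaxations.** For $P=\{x\in[0,1]^N: f_j(x)=0\ (1\le j\le s),\ g_j(x)\ge 0\ (1\le j\le t)\}$ with polynomials $f_j,g_j$, the $k$th Sherali-Adams relaxation $P^k$ is obtained as follows. Form the constraints $\prod_{i\in I}x_i\, f_j(x)=0$ for all $I\subseteq\{1,\dots,N\}$, $|I|\le k-1$ and all $j$; $\prod_{i\in I}x_i\prod_{i\in J\setminus I}(1-x_i)\,g_j(x)\ge0$ for all $I\subseteq J$, $|J|\le k-1$ and all $j$; and $\prod_{i\in I}x_i\prod_{i\in J\setminus I}(1-x_i)\ge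 0$ for all $I\subseteq J$, $|J|\le k$. Expand, replace every $x_i^2$ by $x_i$ repeatedly until all monomials are square-free, and replace each monomial $\prod_{i\in I}x_i$ with $|I|\ge 1$ by a new variable $y_I$ (and the empty monomial by $1$). This gives a polyhedron $\hat P^k$ in $y$-space, and $P^k=\{x: x_i=y_{\{i\}}\ \forall i,\ y\in\hat P^k\}$. $\mathcal T^k_{G,H}$ and $\mathcal T^k_G$ are the $k$th relaxations of $\mathcal T_{G,H}$ and $\mathcal T_G$, where the $f_j$ are the row-sum equations, the column-sum equations and the entries of $A_GX-XA_H$, and there are no $g_j$. **Tuples.** For $u\in V^k$, $w\in V$, $1\le i\le k$, $\phi_i(u,w)$ is $u$ with its $i$th entry replaced by $w$. Put $\delta_G^i(u)=\{\phi_i(u,w):w\in\delta_G(u_i)\}$ and $\bar\delta_G^i(u)=\{\phi_i(u,w):w\in V\setminus\delta_G(u_i)\}$. For a permutation $\sigma\in S_k$, $\sigma(u)_i=u_{\sigma(i)}$; fix two permutations $\sigma_1,\sigma_2$ generating the symmetric group $S_k$. Let $\vec{\mathcal C}_G(u)$ be the $k\times k$ matrix with $(i,j)$ entry $0$ if $u_i=u_j$, $1$ if $\{u_i,u_j\}\in E_G$, and $-1$ otherwise. **$k$-dim C-V-C algorithm, automorphism version.** For a partition $\pi$ of $V^k$ let $\delta_G(\pi)$ be the partition of $V^k$ in which $u,v$ are equivalent iff: $u\equiv_\pi v$; $\sigma_l(u)\equiv_\pi\sigma_l(v)$ for $l=1,2$; $\vec{\mathcal C}_G(u)=\vec{\mathcal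 C}_G(v)$; and $|\delta_G^i(u)\cap C|=|\delta_G^i(v)\cap C|$, $|\bar\delta_G^i(u)\cap C|=|\bar\delta_G^i(v)\cap C|$ for all cells $C$ of $\pi$ and $1\le i\le k$. Starting from the trivial partition $\{V^k\}$, iterate $\pi\mapsto\delta_G(\pi)$ until it stabilises. The algorithm determines that $G$ is asymmetric iff the resulting stable partition is complete, i.e. all its cells are singletons. **Isomorphism version.** For an ordered partition $\vec\pi=(\vec\pi_1,\dots,\vec\pi_m)$ of $V^k$ write $[u]_{\vec\pi}=i$ if $u\in\vec\pi_i$, and let $D_{G,\vec\pi}(u)=\big([u]_{\vec\pi},\ [\sigma_1(u)]_{\vec\pi},[\sigma_2(u)]_{\vec\pi},\ \vec{\mathcal C}_G(u),\ (|\delta^i_G(u)\cap\vec\pi_1|,\dots,|\delta^i_G(u)\cap\vec\pi_m|,|\bar\delta^i_G(u)\cap\vec\pi_1|,\dots,|\bar\delta^i_G(u)\cap\vec\pi_m|)_{i=1,\dots,k}\big).$ Let $\vec\delta_G(\vec\pi)$ be the ordered partition of $V^k$ whose cells are the level sets of $D_{G,\vec\pi}$, ordered lexicographically by the value of $D_{G,\vec\pi}$. Let $\vec\delta^k_G$ be the ordered partition reached by iterating $\vec\delta_G$ from $(V^k)$ until it stabilises; similarly $\vec\delta^k_H$. The algorithm determines that $G$ and $H$ are not isomorphic iff there is no bijection $\gamma:V^k\to V^k$ with $D_{G,\vec\delta^k_G}(u)=D_{H,\vec\delta^k_H}(\gamma(u))$ for all $u\in V^k$. -}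

module Defs where

open import Data.Bool.Base using (Bool; true; false; if_then_else_)
import Data.Bool.Properties as Bool
open import Data.Fin.Base
  using (Fin; zero; suc; toℕ; fromℕ<; combine; quotient; remainder)
open import Data.Fin.Permutation as Perm using (Permutation′; _⟨$⟩ʳ_; _∘ₚ_; flip)
import Data.Fin.Properties as Fin
open import Data.Fin.Subset as Subset using (Subset; ∣_∣; ⁅_⁆; _⊆_; _─_)
open import Data.Fin.Subset.Properties using (nonempty?)
open import Data.Integer.Base as ℤ using (ℤ; +_; -[1+_])
import Data.Integer.Properties as ℤ
open import Data.List.Base as List
  using (List; []; _∷_; _++_; [_]; length; filter; foldr; concatMap; allFin
        ; cartesianProductWith; deduplicate)
import Data.List.Properties as List
open import Data.List.Membership.Propositional using (_∈_; lose)
open import Data.List.Membership.Propositional.Properties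
  using (∈-allFin; ∈-cartesianProductWith⁺; ∈-deduplicate⁺; ∈-map⁺)
open import Data.List.Relation.Binary.Lex.Strict using (Lex-<)
import Data.List.Relation.Binary.Lex.Strict as Lex
import Data.List.Relation.Binary.Pointwise as Pointwise
open import Data.List.Relation.Unary.Any using (here)
import Data.Unit.Base as Unit
open import Data.Nat.Base as ℕ using (ℕ; zero; suc)
import Data.Nat.Properties as ℕ
open import Data.Product.Base using (Σ; ∃; ∃-syntax; _×_; _,_; proj₁; proj₂)
open import Data.Rational.Base as ℚ using (ℚ; 0ℚ; 1ℚ; ½)
import Data.Rational.Properties as ℚ
open import Data.Vec.Base as Vec using (Vec; []; _∷_; lookup; tabulate; _[_]≔_)
import Data.Vec.Properties as Vec
open import Function.Bundles using (_⇔_; _⤖_; Bijection)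
open import Relation.Binary.Core using (Rel)
open import Relation.Binary.Definitions using (Decidable)
open import Relation.Binary.PropositionalEquality
  using (_≡_; refl; sym; trans; cong; subst; subst₂)
open import Relation.Binary.Structures using (IsDecEquivalence)
open import Relation.Nullary using (¬_; Dec; yes; no)
open import Relation.Nullary.Decidable using (does; _×-dec_)
open import Relation.Nullary.Decidable.Core using (dec⇒maybe)
open import Tactic.RingSolver using (solve-∀)
open import Tactic.RingSolver.Core.AlmostCommutativeRing
  using (AlmostCommutativeRing; fromCommutativeRing)
import Level

-- The reals are Cauchy sequences of rationals, with the equality _≈ℝ_.
Cauchy : (ℕ → ℚ) → Set
Cauchy s = ∀ ε → 0ℚ ℚ.< ε →
  ∃[ N ] ∀ m n → N ℕ.≤ m → N ℕ.≤ n → ℚ.∣ s m ℚ.- s n ∣ ℚ.< ε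

record ℝ : Set where
  constructor mkℝ
  field
    seq    : ℕ → ℚ
    cauchy : Cauchy seq

open ℝ public

infix 4 _≈ℝ_ _≤ℝ_

_≈ℝ_ : ℝ → ℝ → Set
x ≈ℝ y = ∀ ε → 0ℚ ℚ.< ε →
  ∃[ N ] ∀ n → N ℕ.≤ n → ℚ.∣ seq x n ℚ.- seq y n ∣ ℚ.< ε

_≤ℝ_ : ℝ → ℝ → Set
x ≤ℝ y = ∀ ε → 0ℚ ℚ.< ε →
  ∃[ N ] ∀ n → N ℕ.≤ n → seq x n ℚ.< seq y n ℚ.+ ε

private
  ℚ-ring : AlmostCommutativeRing Level.0ℓ Level.0ℓ
  ℚ-ring = fromCommutativeRing ℚ.+-*-commutativeRing (λ q → dec⇒maybe (0ℚ ℚ.≟ q))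

  abstract
    half-pos : ∀ {ε} → 0ℚ ℚ.< ε → 0ℚ ℚ.< ½ ℚ.* ε
    half-pos {ε} 0<ε =
      subst (ℚ._< ½ ℚ.* ε) (ℚ.*-zeroʳ ½) (ℚ.*-monoʳ-<-pos ½ 0<ε)

    half+half : ∀ ε → ½ ℚ.* ε ℚ.+ ½ ℚ.* ε ≡ ε
    half+half ε = trans (sym (ℚ.*-distribʳ-+ ε ½ ½)) (ℚ.*-identityˡ ε)

    const-cauchy : ∀ q → Cauchy (λ _ → q)
    const-cauchy q ε 0<ε =
      0 , λ _ _ _ _ → subst (ℚ._< ε) (sym (cong ℚ.∣_∣ (ℚ.+-inverseʳ q))) 0<ε

    +-cauchy : ∀ s t → Cauchy s → Cauchy t → Cauchy (λ n → s n ℚ.+ t n)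
    +-cauchy s t cs ct ε 0<ε =
      let N₁ , p = cs (½ ℚ.* ε) (half-pos 0<ε)
          N₂ , q = ct (½ ℚ.* ε) (half-pos 0<ε)
      in N₁ ℕ.⊔ N₂ , λ m n N≤m N≤n → bound (s m) (t m) (s n) (t n)
           (p m n (ℕ.m⊔n≤o⇒m≤o N₁ N₂ N≤m) (ℕ.m⊔n≤o⇒m≤o N₁ N₂ N≤n))
           (q m n (ℕ.m⊔n≤o⇒n≤o N₁ N₂ N≤m) (ℕ.m⊔n≤o⇒n≤o N₁ N₂ N≤n))
      where
      rearrange : ∀ a b c d → (a ℚ.+ b) ℚ.- (c ℚ.+ d) ≡ (a ℚ.- c) ℚ.+ (b ℚ.- d)
      rearrange = solve-∀ ℚ-ring
      bound : ∀ a b c d → ℚ.∣ a ℚ.- c ∣ ℚ.< ½ ℚ.* ε →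
              ℚ.∣ b ℚ.- d ∣ ℚ.< ½ ℚ.* ε →
              ℚ.∣ (a ℚ.+ b) ℚ.- (c ℚ.+ d) ∣ ℚ.< ε
      bound a b c d p q = begin-strict
        ℚ.∣ (a ℚ.+ b) ℚ.- (c ℚ.+ d) ∣        ≡⟨ cong ℚ.∣_∣ (rearrange a b c d) ⟩
        ℚ.∣ (a ℚ.- c) ℚ.+ (b ℚ.- d) ∣        ≤⟨ ℚ.∣p+q∣≤∣p∣+∣q∣ (a ℚ.- c) (b ℚ.- d) ⟩
        ℚ.∣ a ℚ.- c ∣ ℚ.+ ℚ.∣ b ℚ.- d ∣      <⟨ ℚ.+-mono-< p q ⟩
        ½ ℚ.* ε ℚ.+ ½ ℚ.* ε                  ≡⟨ half+half ε ⟩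
        ε                                    ∎
        where open ℚ.≤-Reasoning

    neg-cauchy : ∀ s → Cauchy s → Cauchy (λ n → ℚ.- s n)
    neg-cauchy s cs ε 0<ε =
      let N , p = cs ε 0<ε in
      N , λ m n N≤m N≤n → subst (ℚ._< ε) (sym (eq (s m) (s n))) (p m n N≤m N≤n)
      where
      neg-sub : ∀ a b → (ℚ.- a) ℚ.- (ℚ.- b) ≡ ℚ.- (a ℚ.- b)
      neg-sub = solve-∀ ℚ-ring
      eq : ∀ a b → ℚ.∣ (ℚ.- a) ℚ.- (ℚ.- b) ∣ ≡ ℚ.∣ a ℚ.- b ∣
      eq a b = trans (cong ℚ.∣_∣ (neg-sub a b)) (ℚ.∣-p∣≡∣p∣ (a ℚ.- b))

    eventuallyBounded : ∀ s → Cauchy s → ∃[ N ] ∃[ B ] 0ℚ ℚ.< B ×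
                        (∀ n → N ℕ.≤ n → ℚ.∣ s n ∣ ℚ.< B)
    eventuallyBounded s cs = N , b ℚ.+ 1ℚ , 0<B , bounded
      where
      N : ℕ
      N = proj₁ (cs 1ℚ (ℚ.positive⁻¹ 1ℚ))
      b : ℚ
      b = ℚ.∣ s N ∣
      0<B : 0ℚ ℚ.< b ℚ.+ 1ℚ
      0<B = ℚ.+-mono-≤-< (ℚ.0≤∣p∣ (s N)) (ℚ.positive⁻¹ 1ℚ)
      split : ∀ a c → a ≡ c ℚ.+ (a ℚ.- c)
      split = solve-∀ ℚ-ring
      bounded : ∀ n → N ℕ.≤ n → ℚ.∣ s n ∣ ℚ.< b ℚ.+ 1ℚ
      bounded n N≤n = begin-strict
        ℚ.∣ s n ∣                    ≡⟨ cong ℚ.∣_∣ (split (s n) (s N)) ⟩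
        ℚ.∣ s N ℚ.+ (s n ℚ.- s N) ∣  ≤⟨ ℚ.∣p+q∣≤∣p∣+∣q∣ (s N) _ ⟩
        b ℚ.+ ℚ.∣ s n ℚ.- s N ∣      <⟨ ℚ.+-monoʳ-< b (proj₂ (cs 1ℚ (ℚ.positive⁻¹ 1ℚ)) n N N≤n ℕ.≤-refl) ⟩
        b ℚ.+ 1ℚ                     ∎
        where open ℚ.≤-Reasoning

    divide : ∀ B ε → 0ℚ ℚ.< B → 0ℚ ℚ.< ε → ∃[ η ] 0ℚ ℚ.< η × B ℚ.* η ≡ ε
    divide B ε 0<B 0<ε = (ℚ.1/ B) ℚ.* ε , 0<η , eq
      where
      instance
        posB : ℚ.Positive B
        posB = ℚ.positive 0<B
        nzB : ℚ.NonZero B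
        nzB = ℚ.pos⇒nonZero B
        pos1/B : ℚ.Positive (ℚ.1/ B)
        pos1/B = ℚ.1/pos⇒pos B
      0<η : 0ℚ ℚ.< (ℚ.1/ B) ℚ.* ε
      0<η = subst (ℚ._< (ℚ.1/ B) ℚ.* ε) (ℚ.*-zeroʳ (ℚ.1/ B))
              (ℚ.*-monoʳ-<-pos (ℚ.1/ B) 0<ε)
      eq : B ℚ.* ((ℚ.1/ B) ℚ.* ε) ≡ ε
      eq = trans (sym (ℚ.*-assoc B (ℚ.1/ B) ε))
                 (trans (cong (ℚ._* ε) (ℚ.*-inverseʳ B)) (ℚ.*-identityˡ ε))

    product-bound : ∀ a b B η → 0ℚ ℚ.< B → ℚ.∣ a ∣ ℚ.< B → ℚ.∣ b ∣ ℚ.< η →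
                    ℚ.∣ a ℚ.* b ∣ ℚ.≤ B ℚ.* η
    product-bound a b B η 0<B p q = begin
      ℚ.∣ a ℚ.* b ∣         ≡⟨ ℚ.∣p*q∣≡∣p∣*∣q∣ a b ⟩
      ℚ.∣ a ∣ ℚ.* ℚ.∣ b ∣   ≤⟨ ℚ.*-monoʳ-≤-nonNeg ℚ.∣ b ∣ {{ℚ.∣-∣-nonNeg b}} (ℚ.<⇒≤ p) ⟩
      B ℚ.* ℚ.∣ b ∣         ≤⟨ ℚ.*-monoˡ-≤-nonNeg B {{ℚ.nonNegative (ℚ.<⇒≤ 0<B)}} (ℚ.<⇒≤ q) ⟩
      B ℚ.* η               ∎
      where open ℚ.≤-Reasoning

    *-cauchy : ∀ s t → Cauchy s → Cauchy t → Cauchy (λ n → s n ℚ.* t n)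
    *-cauchy s t cs ct ε 0<ε =
      let Nx , Bx , 0<Bx , bx = eventuallyBounded s cs
          Ny , By , 0<By , by = eventuallyBounded t ct
          η , 0<η , eη = divide Bx (½ ℚ.* (½ ℚ.* ε)) 0<Bx (half-pos (half-pos 0<ε))
          θ , 0<θ , eθ = divide By (½ ℚ.* ε) 0<By (half-pos 0<ε)
          N₁ , p = ct η 0<η
          N₂ , q = cs θ 0<θ
          L = Nx ℕ.⊔ Ny
          R = N₁ ℕ.⊔ N₂
      in L ℕ.⊔ R , λ m n N≤m N≤n →
        let L≤m = ℕ.m⊔n≤o⇒m≤o L R N≤m
            L≤n = ℕ.m⊔n≤o⇒m≤o L R N≤n
            R≤m = ℕ.m⊔n≤o⇒n≤o L R N≤m
            R≤n = ℕ.m⊔n≤o⇒n≤o L R N≤n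
        in bound (s m) (t m) (s n) (t n)
          (subst (ℚ.∣ s m ℚ.* (t m ℚ.- t n) ∣ ℚ.≤_) eη
            (product-bound (s m) (t m ℚ.- t n) Bx η 0<Bx
            (bx m (ℕ.m⊔n≤o⇒m≤o Nx Ny L≤m))
            (p m n (ℕ.m⊔n≤o⇒m≤o N₁ N₂ R≤m) (ℕ.m⊔n≤o⇒m≤o N₁ N₂ R≤n))))
          (subst (ℚ.∣ t n ℚ.* (s m ℚ.- s n) ∣ ℚ.≤_) eθ
            (product-bound (t n) (s m ℚ.- s n) By θ 0<By
            (by n (ℕ.m⊔n≤o⇒n≤o Nx Ny L≤n))
            (q m n (ℕ.m⊔n≤o⇒n≤o N₁ N₂ R≤m) (ℕ.m⊔n≤o⇒n≤o N₁ N₂ R≤n))))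
      where
      rearrange : ∀ a b c d → (a ℚ.* b) ℚ.- (c ℚ.* d) ≡
                              a ℚ.* (b ℚ.- d) ℚ.+ d ℚ.* (a ℚ.- c)
      rearrange = solve-∀ ℚ-ring
      quarter<half : ½ ℚ.* (½ ℚ.* ε) ℚ.< ½ ℚ.* ε
      quarter<half = subst₂ ℚ._<_ (ℚ.+-identityʳ _) (half+half (½ ℚ.* ε))
        (ℚ.+-monoʳ-< (½ ℚ.* (½ ℚ.* ε)) (half-pos (half-pos 0<ε)))
      open ℚ.≤-Reasoning
      bound : ∀ a b c d →
              ℚ.∣ a ℚ.* (b ℚ.- d) ∣ ℚ.≤ ½ ℚ.* (½ ℚ.* ε) →
              ℚ.∣ d ℚ.* (a ℚ.- c) ∣ ℚ.≤ ½ ℚ.* ε →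
              ℚ.∣ (a ℚ.* b) ℚ.- (c ℚ.* d) ∣ ℚ.< ε
      bound a b c d h₁ h₂ = begin-strict
        ℚ.∣ (a ℚ.* b) ℚ.- (c ℚ.* d) ∣
          ≡⟨ cong ℚ.∣_∣ (rearrange a b c d) ⟩
        ℚ.∣ a ℚ.* (b ℚ.- d) ℚ.+ d ℚ.* (a ℚ.- c) ∣
          ≤⟨ ℚ.∣p+q∣≤∣p∣+∣q∣ (a ℚ.* (b ℚ.- d)) (d ℚ.* (a ℚ.- c)) ⟩
        ℚ.∣ a ℚ.* (b ℚ.- d) ∣ ℚ.+ ℚ.∣ d ℚ.* (a ℚ.- c) ∣
          ≤⟨ ℚ.+-mono-≤ h₁ h₂ ⟩
        ½ ℚ.* (½ ℚ.* ε) ℚ.+ ½ ℚ.* ε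
          <⟨ ℚ.+-monoˡ-< (½ ℚ.* ε) quarter<half ⟩
        ½ ℚ.* ε ℚ.+ ½ ℚ.* ε
          ≡⟨ half+half ε ⟩
        ε ∎

fromℚ : ℚ → ℝ
fromℚ q = mkℝ (λ _ → q) (const-cauchy q)

0ℝ 1ℝ : ℝ
0ℝ = fromℚ 0ℚ
1ℝ = fromℚ 1ℚ

infixl 6 _+ℝ_
infixl 7 _*ℝ_
infix  8 -ℝ_

_+ℝ_ : ℝ → ℝ → ℝ
x +ℝ y = mkℝ (λ n → seq x n ℚ.+ seq y n) (+-cauchy (seq x) (seq y) (cauchy x) (cauchy y))

-ℝ_ : ℝ → ℝ
-ℝ x = mkℝ (λ n → ℚ.- seq x n) (neg-cauchy (seq x) (cauchy x))

_*ℝ_ : ℝ → ℝ → ℝ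
x *ℝ y = mkℝ (λ n → seq x n ℚ.* seq y n) (*-cauchy (seq x) (seq y) (cauchy x) (cauchy y))

-- Formal sums of terms, each a coefficient with its exponent vector;
-- like terms are not collected.
Poly : ℕ → Set
Poly N = List (ℝ × Vec ℕ N)

infixl 6 _+ᴾ_ _-ᴾ_
infixl 7 _*ᴾ_

const : ∀ {N} → ℝ → Poly N
const {N} c = [ c , Vec.replicate N 0 ]

var : ∀ {N} → Fin N → Poly N
var {N} i = [ 1ℝ , Vec.replicate N 0 [ i ]≔ 1 ]

_+ᴾ_ : ∀ {N} → Poly N → Poly N → Poly N
_+ᴾ_ = _++_

_-ᴾ_ : ∀ {N} → Poly N → Poly N → Poly N
p -ᴾ q = p ++ List.map (λ (c , e) → -ℝ c , e) q

_*ᴾ_ : ∀ {N} → Poly N → Poly N → Poly N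
_*ᴾ_ = cartesianProductWith
  (λ (c , e) (c′ , e′) → c *ℝ c′ , Vec.zipWith ℕ._+_ e e′)

∑ : ∀ {m N} → (Fin m → Poly N) → Poly N
∑ {m} f = foldr (λ i p → f i +ᴾ p) [] (allFin m)

∏[_] : ∀ {N} → Subset N → (Fin N → Poly N) → Poly N
∏[_] {N} S f =
  foldr (λ i p → if lookup S i then f i *ᴾ p else p) (const 1ℝ) (allFin N)

-- The index set of the square-free monomial to which a monomial reduces
-- under xᵢ² ↦ xᵢ.
support : ∀ {N} → Vec ℕ N → Subset N
support = Vec.map (0 ℕ.<ᵇ_)

-- Reduces every monomial to a square-free one and replaces it by y, or
-- by 1 when it is empty; the value of y at the empty set is never used.
linearise : ∀ {N} → (Subset N → ℝ) → Poly N → ℝ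
linearise {N} y = foldr (λ (c , e) s → c *ℝ value (support e) +ℝ s) 0ℝ
  where
  value : Subset N → ℝ
  value S = if does (nonempty? S) then y S else 1ℝ

-- ∏_{i∈I} xᵢ ∏_{i∈J∖I} (1 - xᵢ)
boxTerm : ∀ {N} → Subset N → Subset N → Poly N
boxTerm I J = ∏[ I ] var *ᴾ ∏[ J ─ I ] (λ i → const 1ℝ -ᴾ var i)

record LiftedPolyhedron {N} (k : ℕ) (fs gs : List (Poly N))
                        (y : Subset N → ℝ) : Set where
  field
    equality : ∀ I → ∣ I ∣ ℕ.≤ k ℕ.∸ 1 → ∀ f → f ∈ fs →
               linearise y (∏[ I ] var *ᴾ f) ≈ℝ 0ℝ
    inequality : ∀ I J → I ⊆ J → ∣ J ∣ ℕ.≤ k ℕ.∸ 1 → ∀ g → g ∈ gs →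
                 0ℝ ≤ℝ linearise y (boxTerm I J *ᴾ g)
    box : ∀ I J → I ⊆ J → ∣ J ∣ ℕ.≤ k → 0ℝ ≤ℝ linearise y (boxTerm I J)

-- The k-th relaxation (for k ≥ 1) of
-- { x ∈ [0,1]^N : f x = 0 for f in fs, g x ≥ 0 for g in gs }.
SheraliAdams : ∀ {N} → ℕ → (fs gs : List (Poly N)) → (Fin N → ℝ) → Set
SheraliAdams k fs gs x =
  ∃[ y ] LiftedPolyhedron k fs gs y × (∀ i → x i ≈ℝ y ⁅ i ⁆)

record Graph (n : ℕ) : Set where
  field
    adj        : Fin n → Fin n → Bool
    symmetric  : ∀ a b → adj a b ≡ adj b a
    irreflexive : ∀ a → adj a a ≡ false

open Graph public

Matrix : ℕ → Set
Matrix n = Fin n → Fin n → ℝ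

adjacencyMatrix : ∀ {n} → Graph n → Matrix n
adjacencyMatrix G a b = if adj G a b then 1ℝ else 0ℝ

identityMatrix : ∀ {n} → Matrix n
identityMatrix a b = if does (a Fin.≟ b) then 1ℝ else 0ℝ

infix 4 _≈ᴹ_

_≈ᴹ_ : ∀ {n} → Matrix n → Matrix n → Set
X ≈ᴹ Y = ∀ a b → X a b ≈ℝ Y a b

-- The entry X_{uv} is the variable with index combine u v.
entry : ∀ {n} → Fin n → Fin n → Poly (n ℕ.* n)
entry u v = var (combine u v)

rowEq columnEq : ∀ {n} → Fin n → Poly (n ℕ.* n)
rowEq    u = ∑ (λ w → entry u w) -ᴾ const 1ℝ
columnEq v = ∑ (λ w → entry w v) -ᴾ const 1ℝ

commutationEq : ∀ {n} → Graph n → Graph n → Fin n → Fin n → Poly (n ℕ.* n)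
commutationEq G H u v =
  ∑ (λ w → const (adjacencyMatrix G u w) *ᴾ entry w v) -ᴾ
  ∑ (λ w → entry u w *ᴾ const (adjacencyMatrix H w v))

polytopeEqs : ∀ {n} → Graph n → Graph n → List (Poly (n ℕ.* n))
polytopeEqs {n} G H =
  List.map rowEq (allFin n) ++ List.map columnEq (allFin n) ++
  cartesianProductWith (commutationEq G H) (allFin n) (allFin n)

𝒯 : ∀ {n} → ℕ → Graph n → Graph n → Matrix n → Set
𝒯 {n} k G H X =
  SheraliAdams k (polytopeEqs G H) [] (λ i → X (quotient n i) (remainder {n} n i))

Tuple : ℕ → ℕ → Set
Tuple n k = Vec (Fin n) k

tuples : ∀ n k → List (Tuple n k)
tuples n zero    = [ [] ]
tuples n (suc k) = cartesianProductWith _∷_ (allFin n) (tuples n k)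

∈-tuples : ∀ {n k} (u : Tuple n k) → u ∈ tuples n k
∈-tuples []      = here refl
∈-tuples (a ∷ u) = ∈-cartesianProductWith⁺ _∷_ (∈-allFin a) (∈-tuples u)

all-tuples? : ∀ {n k} {P : Tuple n k → Set} → (∀ u → Dec (P u)) → Dec (∀ u → P u)
all-tuples? {k = zero} P? with P? []
... | yes p = yes λ { [] → p }
... | no ¬p = no λ f → ¬p (f [])
all-tuples? {k = suc k} P? with Fin.all? (λ a → all-tuples? (λ u → P? (a ∷ u)))
... | yes p = yes λ { (a ∷ u) → p a u }
... | no ¬p = no λ f → ¬p (λ a u → f (a ∷ u))

permute : ∀ {n k} → Permutation′ k → Tuple n k → Tuple n k
permute σ u = tabulate (λ i → lookup u (σ ⟨$⟩ʳ i))

data Generated {k} (σ₁ σ₂ : Permutation′ k) : Permutation′ k → Set where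
  gen₁     : Generated σ₁ σ₂ σ₁
  gen₂     : Generated σ₁ σ₂ σ₂
  identity : Generated σ₁ σ₂ Perm.id
  inverse  : ∀ {τ} → Generated σ₁ σ₂ τ → Generated σ₁ σ₂ (flip τ)
  compose  : ∀ {τ ρ} → Generated σ₁ σ₂ τ → Generated σ₁ σ₂ ρ →
             Generated σ₁ σ₂ (τ ∘ₚ ρ)
  respects : ∀ {τ ρ} → τ Perm.≈ ρ → Generated σ₁ σ₂ τ → Generated σ₁ σ₂ ρ

GeneratesSymmetricGroup : ∀ {k} → Permutation′ k → Permutation′ k → Set
GeneratesSymmetricGroup σ₁ σ₂ = ∀ τ → Generated σ₁ σ₂ τ

module _ {n : ℕ} (G : Graph n) where

  -- Both lists are free of repetitions, as w ↦ u [ i ]≔ w is injective;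
  -- those u [ i ]≔ w with w = u_i, that is u itself, belong to δ̄ⁱ i u.
  δⁱ δ̄ⁱ : ∀ {k} → Fin k → Tuple n k → List (Tuple n k)
  δⁱ i u = List.map (u [ i ]≔_)
    (filter (λ w → adj G (lookup u i) w Bool.≟ true) (allFin n))
  δ̄ⁱ i u = List.map (u [ i ]≔_)
    (filter (λ w → adj G (lookup u i) w Bool.≟ false) (allFin n))

  𝒞 : ∀ {k} → Tuple n k → Vec (Vec ℤ k) k
  𝒞 u = tabulate λ i → tabulate λ j →
    if does (lookup u i Fin.≟ lookup u j) then + 0
    else if adj G (lookup u i) (lookup u j) then + 1
    else -[1+ 0 ]

record Partition (A : Set) : Set₁ where
  field
    _∼_              : Rel A Level.0ℓ
    isDecEquivalence : IsDecEquivalence _∼_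

  open IsDecEquivalence isDecEquivalence public using (isEquivalence)
    renaming (_≟_ to _∼?_; refl to ∼-refl; sym to ∼-sym; trans to ∼-trans)

  countCell : List A → A → ℕ
  countCell xs w = length (filter (_∼? w) xs)

open Partition using (_∼_; countCell)

trivialPartition : ∀ {A} → Partition A
trivialPartition = record
  { _∼_ = λ _ _ → Unit.⊤
  ; isDecEquivalence = record
    { isEquivalence = record
      { refl = Unit.tt ; sym = λ _ → Unit.tt ; trans = λ _ _ → Unit.tt }
    ; _≟_ = λ _ _ → yes Unit.tt
    }
  }

Complete : ∀ {A} → Partition A → Set
Complete π = ∀ u v → _∼_ π u v → u ≡ v

infix 4 _≐_

_≐_ : ∀ {A} → Partition A → Partition A → Set
π ≐ ρ = ∀ u v → _∼_ π u v ⇔ _∼_ ρ u v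

module CVC {n k : ℕ} (σ₁ σ₂ : Permutation′ k) where

  module _ (G : Graph n) (π : Partition (Tuple n k)) where

    open Partition π using (_∼?_; ∼-refl; ∼-sym; ∼-trans)

    -- Cells are given by representatives: the cell C is that of w.
    RefinedEquiv : Rel (Tuple n k) Level.0ℓ
    RefinedEquiv u v =
      _∼_ π u v ×
      _∼_ π (permute σ₁ u) (permute σ₁ v) ×
      _∼_ π (permute σ₂ u) (permute σ₂ v) ×
      𝒞 G u ≡ 𝒞 G v ×
      (∀ i w → countCell π (δⁱ G i u) w ≡ countCell π (δⁱ G i v) w ×
               countCell π (δ̄ⁱ G i u) w ≡ countCell π (δ̄ⁱ G i v) w)

    refine : Partition (Tuple n k)
    refine = record
      { _∼_ = RefinedEquiv
      ; isDecEquivalence = record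
        { isEquivalence = record
          { refl  = ∼-refl , ∼-refl , ∼-refl , refl , λ _ _ → refl , refl
          ; sym   = λ (a , b , c , d , e) →
              ∼-sym a , ∼-sym b , ∼-sym c , sym d ,
              λ i w → let x , y = e i w in sym x , sym y
          ; trans = λ (a , b , c , d , e) (a′ , b′ , c′ , d′ , e′) →
              ∼-trans a a′ , ∼-trans b b′ , ∼-trans c c′ , trans d d′ ,
              λ i w → let x , y = e i w ; x′ , y′ = e′ i w in
                      trans x x′ , trans y y′
          }
        ; _≟_ = λ u v →
            (u ∼? v) ×-dec (permute σ₁ u ∼? permute σ₁ v) ×-dec
            (permute σ₂ u ∼? permute σ₂ v) ×-dec
            Vec.≡-dec (Vec.≡-dec ℤ._≟_) (𝒞 G u) (𝒞 G v) ×-dec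
            Fin.all? (λ i → all-tuples? (λ w →
              (countCell π (δⁱ G i u) w ℕ.≟ countCell π (δⁱ G i v) w) ×-dec
              (countCell π (δ̄ⁱ G i u) w ℕ.≟ countCell π (δ̄ⁱ G i v) w)))
        }
      }

  iterate : Graph n → ℕ → Partition (Tuple n k)
  iterate G zero    = trivialPartition
  iterate G (suc N) = refine G (iterate G N)

  StabilisesAt : Graph n → ℕ → Set
  StabilisesAt G N = iterate G (suc N) ≐ iterate G N

  -- The stable partition is the same for every N at which the iteration
  -- is stable.
  DeterminesAsymmetric : Graph n → Set
  DeterminesAsymmetric G =
    ∃[ N ] StabilisesAt G N × Complete (iterate G N)

-- The cells are numbered in order, starting from 0.  Emptiness of cells
-- is not excluded, because (V^k) has an empty cell when V is empty.
record OrderedPartition (A : Set) : Set where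
  field
    size  : ℕ
    index : A → Fin size

  countIndex : List A → Fin size → ℕ
  countIndex xs c = length (filter (λ u → index u Fin.≟ c) xs)

open OrderedPartition

infix 4 _≐ᵒ_

_≐ᵒ_ : ∀ {A} → OrderedPartition A → OrderedPartition A → Set
π ≐ᵒ ρ = size π ≡ size ρ × (∀ u → toℕ (index π u) ≡ toℕ (index ρ u))

trivialOrdered : ∀ {A} → OrderedPartition A
trivialOrdered = record { size = 1 ; index = λ _ → zero }

infix 4 _<ˡᵉˣ_ _<ˡᵉˣ?_

_<ˡᵉˣ_ : Rel (List ℤ) Level.0ℓ
_<ˡᵉˣ_ = Lex-< _≡_ ℤ._<_

_<ˡᵉˣ?_ : Decidable _<ˡᵉˣ_
_<ˡᵉˣ?_ = Lex.<-decidable ℤ._≟_ ℤ._<?_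

<ˡᵉˣ-irrefl : ∀ {xs} → ¬ (xs <ˡᵉˣ xs)
<ˡᵉˣ-irrefl = Lex.<-irreflexive ℤ.<-irrefl (Pointwise.refl refl)

-- The ordered partition of V^k into the level sets of f, ordered
-- lexicographically by the value of f: the cell of u is numbered by how
-- many of the distinct values of f are smaller than f u.
levelSets : ∀ {n k} → (Tuple n k → List ℤ) → OrderedPartition (Tuple n k)
levelSets {n} {k} f = record
  { size  = length values
  ; index = λ u → fromℕ<
      (List.filter-notAll (_<ˡᵉˣ? f u) values (lose (f∈values u) <ˡᵉˣ-irrefl))
  }
  where
  _≟ˡ_ = List.≡-dec ℤ._≟_
  values : List (List ℤ)
  values = deduplicate _≟ˡ_ (List.map f (tuples n k))
  f∈values : ∀ u → f u ∈ values
  f∈values u = ∈-deduplicate⁺ _≟ˡ_ (∈-map⁺ f (∈-tuples u))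

module OrderedCVC {n k : ℕ} (σ₁ σ₂ : Permutation′ k) where

  -- D_{G,π}(u) flattened to a list of integers, the matrix row by row.
  -- For k ≥ 1 its length determines the number of cells of π, so that
  -- equality of flattened tuples is equality of tuples even when they
  -- come from different partitions.
  D : Graph n → OrderedPartition (Tuple n k) → Tuple n k → List ℤ
  D G π u =
    label u ∷ label (permute σ₁ u) ∷ label (permute σ₂ u) ∷
    Vec.toList (Vec.concat (𝒞 G u)) ++
    concatMap (λ i → counts (δⁱ G i u) ++ counts (δ̄ⁱ G i u)) (allFin k)
    where
    label : Tuple n k → ℤ
    label v = + toℕ (index π v)
    counts : List (Tuple n k) → List ℤ
    counts xs = List.map (λ c → + countIndex π xs c) (allFin (size π))

  refine : Graph n → OrderedPartition (Tuple n k) → OrderedPartition (Tuple n k)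
  refine G π = levelSets (D G π)

  iterate : Graph n → ℕ → OrderedPartition (Tuple n k)
  iterate G zero    = trivialOrdered
  iterate G (suc N) = refine G (iterate G N)

  StabilisesAt : Graph n → ℕ → Set
  StabilisesAt G N = iterate G (suc N) ≐ᵒ iterate G N

  DeterminesNonIsomorphic : Graph n → Graph n → Set
  DeterminesNonIsomorphic G H =
    ∃[ M ] ∃[ N ] StabilisesAt G M × StabilisesAt H N ×
    ¬ (Σ (Tuple n k ⤖ Tuple n k) λ γ →
         ∀ u → D G (iterate G M) u ≡ D H (iterate H N) (Bijection.to γ u))

{-# OPTIONS --safe #-}

-- For a point of the relaxation let Y u v be the linearised value of X_{u₁v₁} ⋯ X_{u_kv_k}.
-- Freeing one slot of (u , v) gives a nonnegative n × n matrix with equal row and column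
-- sums that intertwines the adjacency matrices of G and H.  A doubly stochastic matrix with
-- this property relates only vertices having equally many neighbours in corresponding
-- cells, so by induction on the rounds Y u v ≠ 0 forces u and v to have the same colour;
-- as Y is itself doubly stochastic on V^k, the colour classes of G and H are equinumerous.
--
-- Conversely, for a stable colouring put Y u v = 1 / |cell of u| if u and v have the same
-- colour and Y u v = 0 otherwise.  Stability makes this compatible with every reindexing
-- f : Fin k → Fin k, so for fixed u the weights Y u v form a probability distribution on the
-- 0/1 points {(u₁,v₁), …, (u_k,v_k)} whose moments are the variables of the relaxation.
-- This yields the box inequalities and the row and column equations; the commutation
-- equations follow by double counting the edges between two cells.

module Submission where

open import Defs
open import Algebra.Bundles using (CommutativeRing)
import Algebra.Properties.Ring as RingProperties
open import Algebra.Structures using (IsCommutativeRing)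
open import Data.Bool.Base using (Bool; true; false; if_then_else_)
import Data.Bool.Properties as Bool
open import Data.Fin.Base
  using (Fin; zero; suc; toℕ; fromℕ<; punchIn; punchOut; combine; quotient; remainder)
open import Data.Fin.Permutation as Perm using (Permutation′; _⟨$⟩ʳ_; _⟨$⟩ˡ_; permutation; insert)
import Data.Fin.Properties as Fin
open import Data.Fin.Subset as Subset
  using (Subset; ∣_∣; ⁅_⁆; _⊆_; _∪_; _─_; ⊥; inside; outside; Nonempty)
open import Data.Fin.Subset.Properties
open import Data.Integer.Base as ℤ using (ℤ; +_; -[1+_])
import Data.Integer.Properties as ℤ
open import Data.List.Base as List
  using (List; []; _∷_; _++_; length; filter; foldr; allFin; concatMap; deduplicate
        ; cartesianProduct; cartesianProductWith)
import Data.List.Properties as List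
open import Data.List.Membership.Propositional using (_∈_)
open import Data.List.Membership.Propositional.Properties
import Data.List.Membership.Setoid.Properties as SetoidMembership
import Data.List.Relation.Binary.Lex.Strict as Lex
open import Data.List.Relation.Binary.Lex.Core using (this)
open import Data.List.Relation.Binary.Pointwise using (Pointwise; Pointwise-≡⇒≡)
open import Data.List.Relation.Unary.All as All using (All; []; _∷_)
open import Data.List.Relation.Unary.AllPairs using ([]; _∷_)
open import Data.List.Relation.Unary.Any as Any using (here; there)
import Data.List.Relation.Unary.Any.Properties as Any
open import Data.List.Relation.Unary.Unique.DecPropositional.Properties using (deduplicate-!)
open import Data.List.Relation.Unary.Unique.Propositional using (Unique)
open import Data.List.Relation.Unary.Unique.Propositional.Properties
  using (allFin⁺; filter⁺; cartesianProductWith⁺)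
open import Data.Nat.Base as ℕ using (ℕ; zero; suc; _≤_; _<_; z≤n; s≤s)
open import Data.Nat.ListAction using (sum)
import Data.Nat.Properties as ℕ
open import Data.Nat.Tactic.RingSolver using () renaming (solve-∀ to ℕ-solve-∀)
open import Data.Product.Base using (Σ; ∃-syntax; _×_; _,_; proj₁; proj₂)
open import Data.Rational.Base as ℚ using (ℚ; 0ℚ; 1ℚ; ½)
import Data.Rational.Properties as ℚ
open import Data.Sum.Base using (_⊎_; inj₁; inj₂)
open import Data.Vec.Base as Vec using (Vec; []; _∷_; lookup; tabulate; _[_]≔_)
import Data.Vec.Properties as Vec
open import Function.Base using (_∘_; id)
open import Function.Bundles using (_⇔_; mk⇔; Equivalence; _⤖_; mk↔ₛ′; Bijection)
open import Function.Definitions using (Injective)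
open import Function.Properties.Inverse using (↔⇒⤖)
open import Level using (0ℓ)
open import Relation.Binary.Definitions using (Trichotomous; tri<; tri≈; tri>)
open import Relation.Binary.PropositionalEquality as ≡
  using (_≡_; _≢_; _≗_; refl; sym; trans; cong; cong₂; subst; subst₂)
import Relation.Binary.Reasoning.Setoid as SetoidReasoning
open import Relation.Nullary using (¬_; Dec; yes; no; contradiction)
open import Relation.Nullary.Decidable using (does; decidable-stable; dec-true; dec-false; _×-dec_)
open import Relation.Nullary.Decidable.Core using (dec⇒maybe)
open import Tactic.RingSolver using (solve-∀)
open import Tactic.RingSolver.Core.AlmostCommutativeRing
  using (AlmostCommutativeRing; fromCommutativeRing)

-- Equality of Cauchy reals with zero is undecidable, so `Y u v ≠ 0` is a negated equality. The
-- arguments live in an ordered ring where being zero is stable under double negation, and the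
-- conclusions drawn from a point concern natural numbers, vertices or truth values, which are
-- decidable.
--
-- In the converse the obstacle is that one monomial is described by many pairs of tuples: its
-- variables may be listed in any order, and repeated when there are too few of them. Its value is
-- well defined only if the colouring respects copying one entry over another as well as permuting
-- entries. Copying is recovered from neighbour counts together with the equality pattern;
-- permutations and copyings compose to all self-maps of the slots.
--
-- The tuples of two graphs are coloured jointly, so that one construction serves both halves of the
-- theorem; in the asymmetry half the two graphs coincide.
--
-- The level is written `suc k`: equations are multiplied by at most `k` variables, which is exactly
-- what remains of a tuple of length `suc k` when one slot is freed.

private variable
  n m k N : ℕ
  A B C : Set

-- Sums in an ordered commutative ring

numeral : (R : CommutativeRing 0ℓ 0ℓ) → ℕ → CommutativeRing.Carrier R
numeral R zero    = CommutativeRing.0# R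
numeral R (suc m) = CommutativeRing._+_ R (CommutativeRing.1# R) (numeral R m)

-- Order enters only as a cone of nonnegative elements. `pointed` is what positivity arguments use:
-- a vanishing sum forces its terms to vanish. `≈0-stable` stands in for a zero test, and `recip`
-- supplies the reciprocals of cell sizes.
record OrderedRing : Set₁ where
  field
    commutativeRing : CommutativeRing 0ℓ 0ℓ
  open CommutativeRing commutativeRing public
  field
    NonNeg      : Carrier → Set
    nonNeg-resp : ∀ {x y} → x ≈ y → NonNeg x → NonNeg y
    nonNeg-0    : NonNeg 0#
    nonNeg-1    : NonNeg 1#
    nonNeg-+    : ∀ {x y} → NonNeg x → NonNeg y → NonNeg (x + y)
    pointed     : ∀ {x y} → NonNeg x → NonNeg y → x + y ≈ 0# → x ≈ 0#
    1≉0         : ¬ 1# ≈ 0#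
    ≈0-stable   : ∀ {x} → ¬ ¬ x ≈ 0# → x ≈ 0#
    recip       : ∀ m → ∃[ r ] NonNeg r × r * numeral commutativeRing (suc m) ≈ 1#

module Sums (R : OrderedRing) where

  open OrderedRing R hiding (zero) renaming (refl to ≈-refl; sym to ≈-sym; trans to ≈-trans) public
  open SetoidReasoning setoid public
  open RingProperties ring public using (+-cancelˡ; +-cancelʳ; -1*x≈-x)

  infix 8 _×1
  _×1 : ℕ → Carrier
  m ×1 = numeral commutativeRing m

  *-swapˡ : ∀ x y z → x * (y * z) ≈ y * (x * z)
  *-swapˡ x y z = begin
    x * (y * z)  ≈⟨ *-assoc x y z ⟨
    x * y * z    ≈⟨ *-congʳ (*-comm x y) ⟩
    y * x * z    ≈⟨ *-assoc y x z ⟩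
    y * (x * z)  ∎

  x-y+y≈x : ∀ x y → x + - y + y ≈ x
  x-y+y≈x x y = ≈-trans (+-assoc x (- y) y) (≈-trans (+-congˡ (-‿inverseˡ y)) (+-identityʳ x))

  +-interchange : ∀ a b c d → (a + b) + (c + d) ≈ (a + c) + (b + d)
  +-interchange a b c d = begin
    (a + b) + (c + d)  ≈⟨ +-assoc a b (c + d) ⟩
    a + (b + (c + d))  ≈⟨ +-congˡ (+-assoc b c d) ⟨
    a + (b + c + d)    ≈⟨ +-congˡ (+-congʳ (+-comm b c)) ⟩
    a + (c + b + d)    ≈⟨ +-congˡ (+-assoc c b d) ⟩
    a + (c + (b + d))  ≈⟨ +-assoc a c (b + d) ⟨
    (a + c) + (b + d)  ∎

  private variable
    P Q : Set

  𝟙 : Dec P → Carrier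
  𝟙 d = if does d then 1# else 0#

  𝟙-yes : (d : Dec P) → P → 𝟙 d ≈ 1#
  𝟙-yes (yes _) p = ≈-refl
  𝟙-yes (no ¬p) p = contradiction p ¬p

  𝟙-no : (d : Dec P) → ¬ P → 𝟙 d ≈ 0#
  𝟙-no (yes p) ¬p = contradiction p ¬p
  𝟙-no (no _)  ¬p = ≈-refl

  𝟙-⇔ : (d : Dec P) (e : Dec Q) → (P → Q) → (Q → P) → 𝟙 d ≈ 𝟙 e
  𝟙-⇔ (yes p) e f g = ≈-sym (𝟙-yes e (f p))
  𝟙-⇔ (no ¬p) e f g = ≈-sym (𝟙-no e (λ q → ¬p (g q)))

  𝟙*-cong : (d : Dec P) {x y : Carrier} → (P → x ≈ y) → 𝟙 d * x ≈ 𝟙 d * y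
  𝟙*-cong (yes p) h = *-congˡ (h p)
  𝟙*-cong (no _)  h = ≈-trans (zeroˡ _) (≈-sym (zeroˡ _))

  𝟙*-no : (d : Dec P) {x : Carrier} → ¬ P → 𝟙 d * x ≈ 0#
  𝟙*-no d ¬p = ≈-trans (*-congʳ (𝟙-no d ¬p)) (zeroˡ _)

  𝟙*-yes : (d : Dec P) {x : Carrier} → P → 𝟙 d * x ≈ x
  𝟙*-yes d p = ≈-trans (*-congʳ (𝟙-yes d p)) (*-identityˡ _)

  nonNeg-𝟙* : (d : Dec P) {x : Carrier} → NonNeg x → NonNeg (𝟙 d * x)
  nonNeg-𝟙* (yes _) h = nonNeg-resp (≈-sym (*-identityˡ _)) h
  nonNeg-𝟙* (no _)  h = nonNeg-resp (≈-sym (zeroˡ _)) nonNeg-0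

  nonNeg-𝟙 : (d : Dec P) → NonNeg (𝟙 d)
  nonNeg-𝟙 (yes _) = nonNeg-1
  nonNeg-𝟙 (no _)  = nonNeg-0

  𝟙-split : ∀ b x → 𝟙 (b Bool.≟ true) * x + 𝟙 (b Bool.≟ false) * x ≈ x
  𝟙-split true  x = ≈-trans (+-cong (*-identityˡ x) (zeroˡ x)) (+-identityʳ x)
  𝟙-split false x = ≈-trans (+-cong (zeroˡ x) (*-identityˡ x)) (+-identityˡ x)

  ∑ₗ : List A → (A → Carrier) → Carrier
  ∑ₗ []       f = 0#
  ∑ₗ (x ∷ xs) f = f x + ∑ₗ xs f

  ∑-cong : (xs : List A) {f g : A → Carrier} → (∀ x → f x ≈ g x) → ∑ₗ xs f ≈ ∑ₗ xs g
  ∑-cong []       h = ≈-refl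
  ∑-cong (x ∷ xs) h = +-cong (h x) (∑-cong xs h)

  ∑-zero : (xs : List A) {f : A → Carrier} → (∀ x → f x ≈ 0#) → ∑ₗ xs f ≈ 0#
  ∑-zero []       h = ≈-refl
  ∑-zero (x ∷ xs) h = ≈-trans (+-cong (h x) (∑-zero xs h)) (+-identityˡ 0#)

  ∑-+ : (xs : List A) (f g : A → Carrier) → ∑ₗ xs (λ x → f x + g x) ≈ ∑ₗ xs f + ∑ₗ xs g
  ∑-+ []       f g = ≈-sym (+-identityˡ 0#)
  ∑-+ (x ∷ xs) f g = ≈-trans (+-congˡ (∑-+ xs f g)) (+-interchange _ _ _ _)

  ∑-*ˡ : (xs : List A) (c : Carrier) (f : A → Carrier) → ∑ₗ xs (λ x → c * f x) ≈ c * ∑ₗ xs f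
  ∑-*ˡ []       c f = ≈-sym (zeroʳ c)
  ∑-*ˡ (x ∷ xs) c f = ≈-trans (+-congˡ (∑-*ˡ xs c f)) (≈-sym (distribˡ c _ _))

  ∑-*ʳ : (xs : List A) (c : Carrier) (f : A → Carrier) → ∑ₗ xs (λ x → f x * c) ≈ ∑ₗ xs f * c
  ∑-*ʳ xs c f = begin
    ∑ₗ xs (λ x → f x * c)  ≈⟨ ∑-cong xs (λ x → *-comm (f x) c) ⟩
    ∑ₗ xs (λ x → c * f x)  ≈⟨ ∑-*ˡ xs c f ⟩
    c * ∑ₗ xs f            ≈⟨ *-comm c _ ⟩
    ∑ₗ xs f * c            ∎

  ∑-swap : (xs : List A) (ys : List B) (f : A → B → Carrier) →
           ∑ₗ xs (λ x → ∑ₗ ys (f x)) ≈ ∑ₗ ys (λ y → ∑ₗ xs (λ x → f x y))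
  ∑-swap []       ys f = ≈-sym (∑-zero ys (λ _ → ≈-refl))
  ∑-swap (x ∷ xs) ys f = ≈-trans (+-congˡ (∑-swap xs ys f)) (≈-sym (∑-+ ys _ _))

  ∑-++ : (xs ys : List A) (f : A → Carrier) → ∑ₗ (xs ++ ys) f ≈ ∑ₗ xs f + ∑ₗ ys f
  ∑-++ []       ys f = ≈-sym (+-identityˡ _)
  ∑-++ (x ∷ xs) ys f = ≈-trans (+-congˡ (∑-++ xs ys f)) (≈-sym (+-assoc _ _ _))

  ∑-map : (g : A → B) (xs : List A) (f : B → Carrier) → ∑ₗ (List.map g xs) f ≈ ∑ₗ xs (f ∘ g)
  ∑-map g []       f = ≈-refl
  ∑-map g (x ∷ xs) f = +-congˡ (∑-map g xs f)

  ∑-product : (h : A → B → C) (xs : List A) (ys : List B) (f : C → Carrier) →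
              ∑ₗ (cartesianProductWith h xs ys) f ≈ ∑ₗ xs (λ x → ∑ₗ ys (λ y → f (h x y)))
  ∑-product h []       ys f = ≈-refl
  ∑-product h (x ∷ xs) ys f =
    ≈-trans (∑-++ (List.map (h x) ys) _ f)
            (+-cong (∑-map (h x) ys f) (∑-product h xs ys f))

  ∑-filter : {P : A → Set} (P? : ∀ x → Dec (P x)) (xs : List A) (f : A → Carrier) →
             ∑ₗ (filter P? xs) f ≈ ∑ₗ xs (λ x → 𝟙 (P? x) * f x)
  ∑-filter P? []       f = ≈-refl
  ∑-filter P? (x ∷ xs) f with P? x
  ... | yes p = +-cong (≈-sym (*-identityˡ _)) (∑-filter P? xs f)
  ... | no ¬p = ≈-trans (∑-filter P? xs f)
                  (≈-trans (≈-sym (+-identityˡ _)) (+-congʳ (≈-sym (zeroˡ _))))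

  ∑-zero-All : {xs : List A} {f : A → Carrier} → All (λ x → f x ≈ 0#) xs → ∑ₗ xs f ≈ 0#
  ∑-zero-All []       = ≈-refl
  ∑-zero-All (p ∷ ps) = ≈-trans (+-cong p (∑-zero-All ps)) (+-identityˡ 0#)

  ∑-single : {xs : List A} {f : A → Carrier} {a : A} → Unique xs → a ∈ xs →
             (∀ x → x ≢ a → f x ≈ 0#) → ∑ₗ xs f ≈ f a
  ∑-single (a∉ ∷ _) (here refl) h =
    ≈-trans (+-congˡ (∑-zero-All (All.map (λ a≢x → h _ (a≢x ∘ sym)) a∉))) (+-identityʳ _)
  ∑-single (x∉ ∷ u) (there a∈) h =
    ≈-trans (+-cong (h _ (All.lookup x∉ a∈)) (∑-single u a∈ h)) (+-identityˡ _)

  nonNeg-∑ : (xs : List A) {f : A → Carrier} → (∀ x → NonNeg (f x)) → NonNeg (∑ₗ xs f)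
  nonNeg-∑ []       h = nonNeg-0
  nonNeg-∑ (x ∷ xs) h = nonNeg-+ (h x) (nonNeg-∑ xs h)

  ∑≈0⇒≈0 : {xs : List A} {f : A → Carrier} {a : A} → (∀ x → NonNeg (f x)) →
           ∑ₗ xs f ≈ 0# → a ∈ xs → f a ≈ 0#
  ∑≈0⇒≈0 {xs = x ∷ xs} nn eq (here refl) = pointed (nn x) (nonNeg-∑ xs nn) eq
  ∑≈0⇒≈0 {xs = x ∷ xs} nn eq (there a∈) =
    ∑≈0⇒≈0 nn (pointed (nonNeg-∑ xs nn) (nn x) (≈-trans (+-comm _ _) eq)) a∈

  -- Removing the term at `a` leaves nonnegative terms with sum zero. Applied to a row through an
  -- already fixed pair, this says that a fixed vertex has no second image.
  ∑≈term⇒≈0 : ∀ {n} {f : Fin n → Carrier} {a b} → (∀ x → NonNeg (f x)) →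
              ∑ₗ (allFin n) f ≈ f a → b ≢ a → f b ≈ 0#
  ∑≈term⇒≈0 {n} {f} {a} {b} nn eq b≢a = begin
    f b                          ≈⟨ *-identityˡ (f b) ⟨
    1# * f b                     ≈⟨ *-congʳ (off-yes b≢a) ⟨
    off b * f b                  ≈⟨ ∑≈0⇒≈0 nn-off sum-off (∈-allFin b) ⟩
    0#                           ∎
    where
    off : Fin n → Carrier
    off x = if does (x Fin.≟ a) then 0# else 1#
    off-yes : ∀ {x} → x ≢ a → off x ≈ 1#
    off-yes {x} x≢a with x Fin.≟ a
    ... | yes x≡a = contradiction x≡a x≢a
    ... | no _    = ≈-refl
    split : ∀ x → f x ≈ 𝟙 (x Fin.≟ a) * f x + off x * f x
    split x with x Fin.≟ a
    ... | yes _ = ≈-sym (≈-trans (+-cong (*-identityˡ _) (zeroˡ _)) (+-identityʳ _))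
    ... | no _  = ≈-sym (≈-trans (+-cong (zeroˡ _) (*-identityˡ _)) (+-identityˡ _))
    nn-off : ∀ x → NonNeg (off x * f x)
    nn-off x with x Fin.≟ a
    ... | yes _ = nonNeg-resp (≈-sym (zeroˡ _)) nonNeg-0
    ... | no _  = nonNeg-resp (≈-sym (*-identityˡ _)) (nn x)
    at-a : ∑ₗ (allFin n) (λ x → 𝟙 (x Fin.≟ a) * f x) ≈ f a
    at-a = ≈-trans (∑-single (allFin⁺ n) (∈-allFin a) (λ x x≢a → 𝟙*-no (x Fin.≟ a) x≢a))
                   (𝟙*-yes (a Fin.≟ a) refl)
    sum-off : ∑ₗ (allFin n) (λ x → off x * f x) ≈ 0#
    sum-off = +-cancelˡ (f a) _ _ (begin
      f a + ∑ₗ (allFin n) (λ x → off x * f x)  ≈⟨ +-congʳ at-a ⟨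
      ∑ₗ (allFin n) (λ x → 𝟙 (x Fin.≟ a) * f x) + ∑ₗ (allFin n) (λ x → off x * f x)
        ≈⟨ ∑-+ (allFin n) _ _ ⟨
      ∑ₗ (allFin n) (λ x → 𝟙 (x Fin.≟ a) * f x + off x * f x)  ≈⟨ ∑-cong (allFin n) split ⟨
      ∑ₗ (allFin n) f                          ≈⟨ eq ⟩
      f a                                      ≈⟨ +-identityʳ (f a) ⟨
      f a + 0#                                 ∎)

  ×1-+ : ∀ m n → (m ℕ.+ n) ×1 ≈ m ×1 + n ×1
  ×1-+ zero    n = ≈-sym (+-identityˡ _)
  ×1-+ (suc m) n = ≈-trans (+-congˡ (×1-+ m n)) (≈-sym (+-assoc _ _ _))

  ×1-* : ∀ m n → (m ℕ.* n) ×1 ≈ m ×1 * n ×1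
  ×1-* zero    n = ≈-sym (zeroˡ _)
  ×1-* (suc m) n = begin
    (n ℕ.+ m ℕ.* n) ×1            ≈⟨ ×1-+ n (m ℕ.* n) ⟩
    n ×1 + (m ℕ.* n) ×1           ≈⟨ +-cong (≈-sym (*-identityˡ _)) (×1-* m n) ⟩
    1# * n ×1 + m ×1 * n ×1       ≈⟨ distribʳ _ _ _ ⟨
    (1# + m ×1) * n ×1            ∎

  nonNeg-*×1 : ∀ {x} m → NonNeg x → NonNeg (x * m ×1)
  nonNeg-*×1 zero    h = nonNeg-resp (≈-sym (zeroʳ _)) nonNeg-0
  nonNeg-*×1 (suc m) h =
    nonNeg-resp (≈-trans (+-congʳ (≈-sym (*-identityʳ _))) (≈-sym (distribˡ _ _ _)))
                (nonNeg-+ h (nonNeg-*×1 m h))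

  *suc×1≈0⇒≈0 : ∀ {x} m → NonNeg x → x * suc m ×1 ≈ 0# → x ≈ 0#
  *suc×1≈0⇒≈0 m h eq = pointed h (nonNeg-*×1 m h)
    (≈-trans (+-congʳ (≈-sym (*-identityʳ _))) (≈-trans (≈-sym (distribˡ _ _ _)) eq))

  -- Characteristic zero comes from the cone: a positive numeral that vanished would force its
  -- summand `1#` to vanish.
  suc×1≉0 : ∀ m → ¬ suc m ×1 ≈ 0#
  suc×1≉0 m eq = 1≉0 (*suc×1≈0⇒≈0 m nonNeg-1 (≈-trans (*-identityˡ _) eq))

  ×1-injective : ∀ m n → m ×1 ≈ n ×1 → m ≡ n
  ×1-injective zero    zero    eq = refl
  ×1-injective zero    (suc n) eq = contradiction (≈-sym eq) (suc×1≉0 n)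
  ×1-injective (suc m) zero    eq = contradiction eq (suc×1≉0 m)
  ×1-injective (suc m) (suc n) eq = cong suc (×1-injective m n (+-cancelˡ 1# _ _ eq))

  length×1 : (xs : List A) → length xs ×1 ≈ ∑ₗ xs (λ _ → 1#)
  length×1 []       = ≈-refl
  length×1 (x ∷ xs) = +-congˡ (length×1 xs)

  count×1 : {P : A → Set} (P? : ∀ x → Dec (P x)) (xs : List A) →
            length (filter P? xs) ×1 ≈ ∑ₗ xs (λ x → 𝟙 (P? x))
  count×1 P? xs = ≈-trans (length×1 (filter P? xs))
    (≈-trans (∑-filter P? xs _) (∑-cong xs (λ x → *-identityʳ _)))

  count-map-filter×1 : {P : B → Set} {Q : A → Set} (P? : ∀ x → Dec (P x)) (Q? : ∀ x → Dec (Q x))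
    (g : A → B) (xs : List A) →
    length (filter P? (List.map g (filter Q? xs))) ×1 ≈ ∑ₗ xs (λ x → 𝟙 (Q? x) * 𝟙 (P? (g x)))
  count-map-filter×1 P? Q? g xs = begin
    length (filter P? (List.map g (filter Q? xs))) ×1  ≈⟨ count×1 P? (List.map g (filter Q? xs)) ⟩
    ∑ₗ (List.map g (filter Q? xs)) (λ y → 𝟙 (P? y))     ≈⟨ ∑-map g (filter Q? xs) _ ⟩
    ∑ₗ (filter Q? xs) (λ x → 𝟙 (P? (g x)))              ≈⟨ ∑-filter Q? xs _ ⟩
    ∑ₗ xs (λ x → 𝟙 (Q? x) * 𝟙 (P? (g x)))               ∎

  private
    square-identity : ∀ a t → a ℕ.* a ℕ.+ (a ℕ.+ t) ℕ.* (a ℕ.+ t) ≡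
                              (a ℕ.* (a ℕ.+ t) ℕ.+ a ℕ.* (a ℕ.+ t)) ℕ.+ t ℕ.* t
    square-identity = ℕ-solve-∀

    ≤⇒squares : ∀ a b → a ℕ.≤ b →
      ∃[ m ] a ×1 * a ×1 + b ×1 * b ×1 ≈ (a ×1 * b ×1 + a ×1 * b ×1) + m ×1 × (m ≡ 0 → a ≡ b)
    ≤⇒squares a b a≤b with b ℕ.∸ a | ℕ.m+[n∸m]≡n a≤b
    -- Naming the difference `t` turns `b` into `a + t`, so that the square of the difference is the
    -- natural number `t * t`.
    ... | t | refl = t ℕ.* t , eq , λ t²≡0 → sym (trans (cong (a ℕ.+_) (t≡0 t t²≡0)) (ℕ.+-identityʳ a))
      where
      t≡0 : ∀ t → t ℕ.* t ≡ 0 → t ≡ 0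
      t≡0 zero _ = refl
      eq : a ×1 * a ×1 + (a ℕ.+ t) ×1 * (a ℕ.+ t) ×1 ≈
           (a ×1 * (a ℕ.+ t) ×1 + a ×1 * (a ℕ.+ t) ×1) + (t ℕ.* t) ×1
      eq = begin
        a ×1 * a ×1 + (a ℕ.+ t) ×1 * (a ℕ.+ t) ×1
          ≈⟨ +-cong (×1-* a a) (×1-* (a ℕ.+ t) (a ℕ.+ t)) ⟨
        (a ℕ.* a) ×1 + ((a ℕ.+ t) ℕ.* (a ℕ.+ t)) ×1
          ≈⟨ ×1-+ (a ℕ.* a) _ ⟨
        (a ℕ.* a ℕ.+ (a ℕ.+ t) ℕ.* (a ℕ.+ t)) ×1
          ≡⟨ cong _×1 (square-identity a t) ⟩
        ((a ℕ.* (a ℕ.+ t) ℕ.+ a ℕ.* (a ℕ.+ t)) ℕ.+ t ℕ.* t) ×1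
          ≈⟨ ×1-+ (a ℕ.* (a ℕ.+ t) ℕ.+ a ℕ.* (a ℕ.+ t)) (t ℕ.* t) ⟩
        (a ℕ.* (a ℕ.+ t) ℕ.+ a ℕ.* (a ℕ.+ t)) ×1 + (t ℕ.* t) ×1
          ≈⟨ +-congʳ (×1-+ (a ℕ.* (a ℕ.+ t)) _) ⟩
        ((a ℕ.* (a ℕ.+ t)) ×1 + (a ℕ.* (a ℕ.+ t)) ×1) + (t ℕ.* t) ×1
          ≈⟨ +-congʳ (+-cong (×1-* a _) (×1-* a _)) ⟩
        (a ×1 * (a ℕ.+ t) ×1 + a ×1 * (a ℕ.+ t) ×1) + (t ℕ.* t) ×1  ∎

  -- (a - b)² = m, without subtraction.
  squares : ∀ a b →
    ∃[ m ] a ×1 * a ×1 + b ×1 * b ×1 ≈ (a ×1 * b ×1 + a ×1 * b ×1) + m ×1 × (m ≡ 0 → a ≡ b)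
  squares a b with ℕ.≤-total a b
  ... | inj₁ a≤b = ≤⇒squares a b a≤b
  ... | inj₂ b≤a with m , eq , h ← ≤⇒squares b a b≤a =
    m , ≈-trans (+-comm _ _) (≈-trans eq (+-congʳ (+-cong (*-comm _ _) (*-comm _ _)))) , sym ∘ h

  module Fractional {A B : Set} (as : List A) (bs : List B)
    (Z : A → B → Carrier) (y : Carrier)
    (rows : ∀ a → ∑ₗ bs (λ b → Z a b) ≈ y)
    (M : A → A → Carrier) (N : B → B → Carrier)
    (comm : ∀ a b → ∑ₗ as (λ x → M a x * Z x b) ≈ ∑ₗ bs (λ x → Z a x * N x b))
    (p : A → Carrier) (q : B → Carrier) (pZ≈Zq : ∀ a b → p a * Z a b ≈ Z a b * q b) where

    -- In matrix notation, with `1` the all-ones vector: `Z N q = M Z q = M (diag p) Z 1 = y (M p)`.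
    -- The middle step holds because `p` and `q` agree on the support of `Z`.
    average : ∀ a → ∑ₗ bs (λ b → Z a b * ∑ₗ bs (λ x → N b x * q x)) ≈ ∑ₗ as (λ x → M a x * p x) * y
    average a = begin
      ∑ₗ bs (λ b → Z a b * ∑ₗ bs (λ x → N b x * q x))
        ≈⟨ ∑-cong bs (λ b → ∑-*ˡ bs (Z a b) _) ⟨
      ∑ₗ bs (λ b → ∑ₗ bs (λ x → Z a b * (N b x * q x)))
        ≈⟨ ∑-swap bs bs _ ⟩
      ∑ₗ bs (λ x → ∑ₗ bs (λ b → Z a b * (N b x * q x)))
        ≈⟨ ∑-cong bs (λ x → ≈-trans (∑-cong bs (λ b → ≈-sym (*-assoc _ _ _))) (∑-*ʳ bs (q x) _)) ⟩
      ∑ₗ bs (λ x → ∑ₗ bs (λ b → Z a b * N b x) * q x)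
        ≈⟨ ∑-cong bs (λ x → *-congʳ (comm a x)) ⟨
      ∑ₗ bs (λ x → ∑ₗ as (λ w → M a w * Z w x) * q x)
        ≈⟨ ∑-cong bs (λ x → ∑-*ʳ as (q x) _) ⟨
      ∑ₗ bs (λ x → ∑ₗ as (λ w → M a w * Z w x * q x))
        ≈⟨ ∑-swap bs as _ ⟩
      ∑ₗ as (λ w → ∑ₗ bs (λ x → M a w * Z w x * q x))
        ≈⟨ ∑-cong as (λ w → ∑-cong bs (λ x →
             ≈-trans (*-assoc _ _ _) (≈-trans (*-congˡ (≈-sym (pZ≈Zq w x))) (≈-sym (*-assoc _ _ _))))) ⟩
      ∑ₗ as (λ w → ∑ₗ bs (λ x → M a w * p w * Z w x))
        ≈⟨ ∑-cong as (λ w → ≈-trans (∑-*ˡ bs _ _) (*-congˡ (rows w))) ⟩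
      ∑ₗ as (λ w → M a w * p w * y)
        ≈⟨ ∑-*ʳ as y _ ⟩
      ∑ₗ as (λ w → M a w * p w) * y  ∎

  -- With d = M p and e = N q, double stochasticity of Z / y gives d = Z e / y and
  -- e = Zᵀ d / y, hence ∑ Z a b (d a - e b)² = 0.
  fractional : (as : List A) (bs : List B) (Z : A → B → Carrier) (y : Carrier) →
    (∀ a → ∑ₗ bs (λ b → Z a b) ≈ y) → (∀ b → ∑ₗ as (λ a → Z a b) ≈ y) →
    (M : A → A → Carrier) (N : B → B → Carrier) →
    (∀ a b → M a b ≈ M b a) → (∀ a b → N a b ≈ N b a) →
    (∀ a b → ∑ₗ as (λ x → M a x * Z x b) ≈ ∑ₗ bs (λ x → Z a x * N x b)) →
    (p : A → Carrier) (q : B → Carrier) → (∀ a b → p a * Z a b ≈ Z a b * q b) →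
    (d : A → ℕ) (e : B → ℕ) →
    (∀ a → d a ×1 ≈ ∑ₗ as (λ x → M a x * p x)) → (∀ b → e b ×1 ≈ ∑ₗ bs (λ x → N b x * q x)) →
    (∀ a b → NonNeg (Z a b)) →
    ∀ a b → a ∈ as → b ∈ bs → ¬ Z a b ≈ 0# → d a ≡ e b
  fractional {A = A′} {B = B′} as bs Z y rows cols M N symM symN comm p q pZ≈Zq d e deq eeq nn a₀ b₀ a₀∈ b₀∈ Z≉0 =
    conclude (gap a₀ b₀) refl
    where
    Ze : ∀ a → ∑ₗ bs (λ b → Z a b * e b ×1) ≈ d a ×1 * y
    Ze a = ≈-trans (∑-cong bs (λ b → *-congˡ (eeq b)))
      (≈-trans (Fractional.average as bs Z y rows M N comm p q pZ≈Zq a) (*-congʳ (≈-sym (deq a))))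
    -- The symmetry of `M` and `N` turns the intertwining relation into the one for the transpose of
    -- `Z`, so `average` applies with the two sides exchanged.
    comm′ : ∀ b a → ∑ₗ bs (λ x → N b x * Z a x) ≈ ∑ₗ as (λ x → Z x b * M x a)
    comm′ b a = begin
      ∑ₗ bs (λ x → N b x * Z a x)  ≈⟨ ∑-cong bs (λ x → ≈-trans (*-comm _ _) (*-congˡ (symN b x))) ⟩
      ∑ₗ bs (λ x → Z a x * N x b)  ≈⟨ comm a b ⟨
      ∑ₗ as (λ x → M a x * Z x b)  ≈⟨ ∑-cong as (λ x → ≈-trans (*-comm _ _) (*-congˡ (symM a x))) ⟩
      ∑ₗ as (λ x → Z x b * M x a)  ∎
    Zd : ∀ b → ∑ₗ as (λ a → Z a b * d a ×1) ≈ e b ×1 * y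
    Zd b = ≈-trans (∑-cong as (λ a → *-congˡ (deq a)))
      (≈-trans (Fractional.average bs as (λ b a → Z a b) y cols N M comm′ q p
                 (λ b a → ≈-trans (*-comm _ _) (≈-trans (≈-sym (pZ≈Zq a b)) (*-comm _ _))) b)
               (*-congʳ (≈-sym (eeq b))))
    gap : A′ → B′ → ℕ
    gap a b = proj₁ (squares (d a) (e b))
    -- The weighted sums of `d²`, `e²` and `d e`. The averages make all three equal, so the weighted
    -- sum of `(d - e)²` vanishes.
    dd ee de : Carrier
    dd = ∑ₗ as (λ a → d a ×1 * d a ×1 * y)
    ee = ∑ₗ bs (λ b → e b ×1 * e b ×1 * y)
    de = ∑ₗ as (λ a → ∑ₗ bs (λ b → Z a b * (d a ×1 * e b ×1)))
    Zdd : ∑ₗ as (λ a → ∑ₗ bs (λ b → Z a b * (d a ×1 * d a ×1))) ≈ dd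
    Zdd = ∑-cong as (λ a → ≈-trans (∑-*ʳ bs _ _) (≈-trans (*-congʳ (rows a)) (*-comm _ _)))
    Zee : ∑ₗ as (λ a → ∑ₗ bs (λ b → Z a b * (e b ×1 * e b ×1))) ≈ ee
    Zee = ≈-trans (∑-swap as bs _)
      (∑-cong bs (λ b → ≈-trans (∑-*ʳ as _ _) (≈-trans (*-congʳ (cols b)) (*-comm _ _))))
    de≈dd : de ≈ dd
    de≈dd = ∑-cong as (λ a → begin
      ∑ₗ bs (λ b → Z a b * (d a ×1 * e b ×1))  ≈⟨ ∑-cong bs (λ b → *-swapˡ _ _ _) ⟩
      ∑ₗ bs (λ b → d a ×1 * (Z a b * e b ×1))  ≈⟨ ∑-*ˡ bs _ _ ⟩
      d a ×1 * ∑ₗ bs (λ b → Z a b * e b ×1)    ≈⟨ *-congˡ (Ze a) ⟩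
      d a ×1 * (d a ×1 * y)                    ≈⟨ *-assoc _ _ _ ⟨
      d a ×1 * d a ×1 * y                      ∎)
    de≈ee : de ≈ ee
    de≈ee = ≈-trans (∑-swap as bs _) (∑-cong bs (λ b → begin
      ∑ₗ as (λ a → Z a b * (d a ×1 * e b ×1))
        ≈⟨ ∑-cong as (λ a → ≈-trans (*-congˡ (*-comm _ _)) (*-swapˡ _ _ _)) ⟩
      ∑ₗ as (λ a → e b ×1 * (Z a b * d a ×1))  ≈⟨ ∑-*ˡ as _ _ ⟩
      e b ×1 * ∑ₗ as (λ a → Z a b * d a ×1)    ≈⟨ *-congˡ (Zd b) ⟩
      e b ×1 * (e b ×1 * y)                    ≈⟨ *-assoc _ _ _ ⟨
      e b ×1 * e b ×1 * y                      ∎))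
    ∑∑-+ : (f g : A′ → B′ → Carrier) →
      ∑ₗ as (λ a → ∑ₗ bs (λ b → f a b + g a b)) ≈
      ∑ₗ as (λ a → ∑ₗ bs (f a)) + ∑ₗ as (λ a → ∑ₗ bs (g a))
    ∑∑-+ f g = ≈-trans (∑-cong as (λ a → ∑-+ bs _ _)) (∑-+ as _ _)
    gaps : Carrier
    gaps = ∑ₗ as (λ a → ∑ₗ bs (λ b → Z a b * gap a b ×1))
    gaps≈0 : gaps ≈ 0#
    -- The doubled mixed sum is added to both sides, which expands the square without subtracting.
    gaps≈0 = +-cancelˡ (de + de) _ _ (begin
      (de + de) + gaps
        ≈⟨ +-congʳ (∑∑-+ _ _) ⟨
      ∑ₗ as (λ a → ∑ₗ bs (λ b → Z a b * (d a ×1 * e b ×1) + Z a b * (d a ×1 * e b ×1))) + gaps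
        ≈⟨ ∑∑-+ _ _ ⟨
      ∑ₗ as (λ a → ∑ₗ bs (λ b →
        (Z a b * (d a ×1 * e b ×1) + Z a b * (d a ×1 * e b ×1)) + Z a b * gap a b ×1))
        ≈⟨ ∑-cong as (λ a → ∑-cong bs (λ b → begin
             (Z a b * (d a ×1 * e b ×1) + Z a b * (d a ×1 * e b ×1)) + Z a b * gap a b ×1
               ≈⟨ +-congʳ (distribˡ _ _ _) ⟨
             Z a b * (d a ×1 * e b ×1 + d a ×1 * e b ×1) + Z a b * gap a b ×1
               ≈⟨ distribˡ _ _ _ ⟨
             Z a b * ((d a ×1 * e b ×1 + d a ×1 * e b ×1) + gap a b ×1)
               ≈⟨ *-congˡ (proj₁ (proj₂ (squares (d a) (e b)))) ⟨
             Z a b * (d a ×1 * d a ×1 + e b ×1 * e b ×1)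
               ≈⟨ distribˡ _ _ _ ⟩
             Z a b * (d a ×1 * d a ×1) + Z a b * (e b ×1 * e b ×1) ∎)) ⟩
      ∑ₗ as (λ a → ∑ₗ bs (λ b → Z a b * (d a ×1 * d a ×1) + Z a b * (e b ×1 * e b ×1)))
        ≈⟨ ∑∑-+ _ _ ⟩
      ∑ₗ as (λ a → ∑ₗ bs (λ b → Z a b * (d a ×1 * d a ×1))) +
      ∑ₗ as (λ a → ∑ₗ bs (λ b → Z a b * (e b ×1 * e b ×1)))
        ≈⟨ +-cong (≈-trans Zdd (≈-sym de≈dd)) (≈-trans Zee (≈-sym de≈ee)) ⟩
      de + de
        ≈⟨ +-identityʳ _ ⟨
      (de + de) + 0#  ∎)
    nn-gap : ∀ a b → NonNeg (Z a b * gap a b ×1)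
    nn-gap a b = nonNeg-*×1 (gap a b) (nn a b)
    -- The case distinction is on the natural number `gap a₀ b₀`, not on a ring element: a positive
    -- gap with vanishing product would force `Z a₀ b₀` to vanish.
    conclude : ∀ m → gap a₀ b₀ ≡ m → d a₀ ≡ e b₀
    conclude zero    eq = proj₂ (proj₂ (squares (d a₀) (e b₀))) eq
    conclude (suc m) eq = contradiction (*suc×1≈0⇒≈0 m (nn a₀ b₀)
      (≈-trans (*-congˡ (reflexive (cong _×1 (sym eq))))
        (∑≈0⇒≈0 (nn-gap a₀) (∑≈0⇒≈0 (λ a → nonNeg-∑ bs (nn-gap a)) gaps≈0 a₀∈) b₀∈))) Z≉0

-- From points of the relaxation to colours

infix 4 _∈ₛ_
_∈ₛ_ : Fin n → Subset n → Set
_∈ₛ_ = Subset._∈_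

at : Fin n → Fin n → Fin (n ℕ.* n)
at = combine

pair : Fin n → Fin n → Subset (n ℕ.* n)
pair a b = ⁅ at a b ⁆

-- The index set {(u₁,v₁), …, (u_m,v_m)} of the monomial X_{u₁v₁} ⋯ X_{u_mv_m}.
img : Vec (Fin n) m → Vec (Fin n) m → Subset (n ℕ.* n)
img []      []      = ⊥
img (a ∷ u) (b ∷ v) = pair a b ∪ img u v

∈-img⁺ : (u v : Vec (Fin n) m) (i : Fin m) → at (lookup u i) (lookup v i) ∈ₛ img u v
∈-img⁺ (a ∷ u) (b ∷ v) zero    = x∈p∪q⁺ (inj₁ (x∈⁅x⁆ _))
∈-img⁺ (a ∷ u) (b ∷ v) (suc i) = x∈p∪q⁺ (inj₂ (∈-img⁺ u v i))

∈-img⁻ : (u v : Vec (Fin n) m) {x : Fin (n ℕ.* n)} → x ∈ₛ img u v →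
         ∃[ i ] x ≡ at (lookup u i) (lookup v i)
∈-img⁻ []      []      x∈ = contradiction x∈ ∉⊥
∈-img⁻ (a ∷ u) (b ∷ v) x∈ with x∈p∪q⁻ (pair a b) (img u v) x∈
... | inj₁ x∈₁ = zero , x∈⁅y⁆⇒x≡y _ x∈₁
... | inj₂ x∈₂ with i , eq ← ∈-img⁻ u v x∈₂ = suc i , eq

∈-img-lookup : (u v : Vec (Fin n) m) {a b : Fin n} → at a b ∈ₛ img u v →
               ∃[ i ] a ≡ lookup u i × b ≡ lookup v i
∈-img-lookup u v x∈ with i , eq ← ∈-img⁻ u v x∈ = i , Fin.combine-injective _ _ _ _ eq

img-permute : (σ : Permutation′ m) (u v : Vec (Fin n) m) → img (permute σ u) (permute σ v) ≡ img u v
img-permute {n = n} σ u v = ⊆-antisym to from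
  where
  to : img (permute σ u) (permute σ v) ⊆ img u v
  to x∈ with i , refl ← ∈-img⁻ (permute σ u) (permute σ v) x∈ =
    subst₂ (λ (a b : Fin n) → at a b ∈ₛ img u v)
      (sym (Vec.lookup∘tabulate _ i)) (sym (Vec.lookup∘tabulate _ i)) (∈-img⁺ u v (σ ⟨$⟩ʳ i))
  from : img u v ⊆ img (permute σ u) (permute σ v)
  from x∈ with i , refl ← ∈-img⁻ u v x∈ =
    subst₂ (λ (a b : Fin n) → at a b ∈ₛ img (permute σ u) (permute σ v)) (eq u) (eq v)
      (∈-img⁺ (permute σ u) (permute σ v) (σ ⟨$⟩ˡ i))
    where
    eq : ∀ w → lookup (permute σ w) (σ ⟨$⟩ˡ i) ≡ lookup w i
    eq w = trans (Vec.lookup∘tabulate _ (σ ⟨$⟩ˡ i)) (cong (lookup w) (Perm.inverseʳ σ))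

∣p∪q∣≤∣p∣+∣q∣ : (p q : Subset n) → ∣ p ∪ q ∣ ≤ ∣ p ∣ ℕ.+ ∣ q ∣
∣p∪q∣≤∣p∣+∣q∣ []            []            = z≤n
∣p∪q∣≤∣p∣+∣q∣ (inside  ∷ p) (inside  ∷ q) =
  s≤s (ℕ.≤-trans (∣p∪q∣≤∣p∣+∣q∣ p q) (ℕ.+-monoʳ-≤ ∣ p ∣ (ℕ.n≤1+n _)))
∣p∪q∣≤∣p∣+∣q∣ (inside  ∷ p) (outside ∷ q) = s≤s (∣p∪q∣≤∣p∣+∣q∣ p q)
∣p∪q∣≤∣p∣+∣q∣ (outside ∷ p) (inside  ∷ q) =
  subst (suc ∣ p ∪ q ∣ ≤_) (sym (ℕ.+-suc ∣ p ∣ ∣ q ∣)) (s≤s (∣p∪q∣≤∣p∣+∣q∣ p q))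
∣p∪q∣≤∣p∣+∣q∣ (outside ∷ p) (outside ∷ q) = ∣p∪q∣≤∣p∣+∣q∣ p q

∣p∪⁅x⁆∣≤ : (p : Subset n) (x : Fin n) → ∣ p ∣ ≤ m → ∣ p ∪ ⁅ x ⁆ ∣ ≤ suc m
∣p∪⁅x⁆∣≤ p x p≤m = ℕ.≤-trans (∣p∪q∣≤∣p∣+∣q∣ p ⁅ x ⁆)
  (ℕ.≤-trans (ℕ.≤-reflexive (trans (cong (∣ p ∣ ℕ.+_) (∣⁅x⁆∣≡1 x)) (ℕ.+-comm ∣ p ∣ 1))) (s≤s p≤m))

∣⁅x⁆∪p∣≤ : (x : Fin n) (p : Subset n) → ∣ p ∣ ≤ m → ∣ ⁅ x ⁆ ∪ p ∣ ≤ suc m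
∣⁅x⁆∪p∣≤ x p p≤m = subst (λ q → ∣ q ∣ ≤ _) (∪-comm p ⁅ x ⁆) (∣p∪⁅x⁆∣≤ p x p≤m)

∣img∣≤ : (u v : Vec (Fin n) m) → ∣ img u v ∣ ≤ m
∣img∣≤ {n} []      []      = ℕ.≤-reflexive (∣⊥∣≡0 (n ℕ.* n))
∣img∣≤     (a ∷ u) (b ∷ v) = ∣⁅x⁆∪p∣≤ (at a b) (img u v) (∣img∣≤ u v)

∪-absorb : {p : Subset n} {x : Fin n} → x ∈ₛ p → p ∪ ⁅ x ⁆ ≡ p
∪-absorb {p = p} {x} x∈p = ⊆-antisym to (x∈p∪q⁺ ∘ inj₁)
  where
  to : p ∪ ⁅ x ⁆ ⊆ p
  to y∈ with x∈p∪q⁻ p ⁅ x ⁆ y∈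
  ... | inj₁ y∈p = y∈p
  ... | inj₂ y∈x = subst (_∈ₛ p) (sym (x∈⁅y⁆⇒x≡y _ y∈x)) x∈p

-- A tuple monomial with slot `i` left free. The bound on `rest` makes it an admissible multiplier
-- of the equations, and `other∈` records that the pairs of the remaining slots stay fixed.
record Slot {n m} (i : Fin (suc m)) (u v : Vec (Fin n) (suc m)) : Set where
  field
    rest      : Subset (n ℕ.* n)
    ∣rest∣≤   : ∣ rest ∣ ≤ m
    img-fill  : ∀ (a b : Fin n) → img (u [ i ]≔ a) (v [ i ]≔ b) ≡ rest ∪ pair a b
    other∈    : ∀ j → j ≢ i → at (lookup u j) (lookup v j) ∈ₛ rest

slot : (i : Fin (suc m)) (u v : Vec (Fin n) (suc m)) → Slot i u v
slot zero (x ∷ u) (y ∷ v) = record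
  { rest     = img u v
  ; ∣rest∣≤  = ∣img∣≤ u v
  ; img-fill = λ a b → ∪-comm (pair a b) (img u v)
  ; other∈   = λ { zero j≢i → contradiction refl j≢i ; (suc j) _ → ∈-img⁺ u v j }
  }
slot {suc m} (suc i) (x ∷ u) (y ∷ v) = record
  { rest     = pair x y ∪ rest
  ; ∣rest∣≤  = ∣⁅x⁆∪p∣≤ (at x y) rest ∣rest∣≤
  ; img-fill = λ a b → trans (cong (pair x y ∪_) (img-fill a b)) (sym (∪-assoc _ _ _))
  ; other∈   = λ { zero _ → x∈p∪q⁺ (inj₁ (x∈⁅x⁆ _))
                 ; (suc j) j≢i → x∈p∪q⁺ (inj₂ (other∈ j (j≢i ∘ cong suc))) }
  }
  where open Slot (slot i u v)

-- δⁱ G i u for β = true, and δ̄ⁱ G i u for β = false.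
neighbours : Graph n → Bool → Fin m → Tuple n m → List (Tuple n m)
neighbours {n} Γ β i u = List.map (u [ i ]≔_)
  (filter (λ w → adj Γ (lookup u i) w Bool.≟ β) (allFin n))

-- φ S is the value that linearisation assigns to the square-free monomial with index
-- set S; k is one less than the level of the relaxation.
record System (R : OrderedRing) {n : ℕ} (k : ℕ) (G H : Graph n)
              (φ : Subset (n ℕ.* n) → OrderedRing.Carrier R) : Set where
  open Sums R
  field
    φ⊥≈1    : φ ⊥ ≈ 1#
    row     : ∀ I → ∣ I ∣ ≤ k → ∀ (a : Fin n) → ∑ₗ (allFin n) (λ w → φ (I ∪ pair a w)) ≈ φ I
    column  : ∀ I → ∣ I ∣ ≤ k → ∀ (b : Fin n) → ∑ₗ (allFin n) (λ w → φ (I ∪ pair w b)) ≈ φ I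
    commute : ∀ I → ∣ I ∣ ≤ k → ∀ (a b : Fin n) →
      ∑ₗ (allFin n) (λ w → 𝟙 (adj G a w Bool.≟ true) * φ (I ∪ pair w b)) ≈
      ∑ₗ (allFin n) (λ w → φ (I ∪ pair a w) * 𝟙 (adj H w b Bool.≟ true))
    nonNeg  : ∀ I → ∣ I ∣ ≤ suc k → NonNeg (φ I)

module Forward (R : OrderedRing) {n k : ℕ} {G H : Graph n}
  {φ : Subset (n ℕ.* n) → OrderedRing.Carrier R} (sys : System R k G H φ) where

  open Sums R
  open System sys

  Y : Tuple n m → Tuple n m → Carrier
  Y u v = φ (img u v)

  Pos : Tuple n m → Tuple n m → Set
  Pos u v = ¬ Y u v ≈ 0#

  Pos-permute : (σ : Permutation′ m) {u v : Tuple n m} → Pos u v → Pos (permute σ u) (permute σ v)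
  Pos-permute σ {u} {v} pos eq = pos (subst (λ S → φ S ≈ 0#) (img-permute σ u v) eq)

  module _ (S : Subset (n ℕ.* n)) (S≤k : ∣ S ∣ ≤ k) where

    nonNeg-∪ : ∀ (a b : Fin n) → NonNeg (φ (S ∪ pair a b))
    nonNeg-∪ a b = nonNeg _ (∣p∪⁅x⁆∣≤ S (at a b) S≤k)

    -- Since `at a c` already lies in `S`, the term at `c` is the whole row sum `φ S`, and
    -- nonnegativity leaves nothing for `b`.
    functional : ∀ {a b c : Fin n} → at a c ∈ₛ S → b ≢ c → φ (S ∪ pair a b) ≈ 0#
    functional {a} {b} {c} ac∈S b≢c = ∑≈term⇒≈0 {f = λ w → φ (S ∪ pair a w)} (nonNeg-∪ a)
      (≈-trans (row S S≤k a) (reflexive (cong φ (sym (∪-absorb ac∈S))))) b≢c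

    injective : ∀ {a b c : Fin n} → at c b ∈ₛ S → a ≢ c → φ (S ∪ pair a b) ≈ 0#
    injective {a} {b} {c} cb∈S a≢c = ∑≈term⇒≈0 {f = λ w → φ (S ∪ pair w b)} (λ w → nonNeg-∪ w b)
      (≈-trans (column S S≤k b) (reflexive (cong φ (sym (∪-absorb cb∈S))))) a≢c

  private
    refill : {u v : Tuple n (suc k)} (i : Fin (suc k)) (s : Slot i u v) →
             img u v ≡ Slot.rest s ∪ pair (lookup u i) (lookup v i)
    refill {u} {v} i s = trans
      (cong₂ img (sym (Vec.[]≔-lookup u i)) (sym (Vec.[]≔-lookup v i)))
      (Slot.img-fill s _ _)

  -- When slot `i` is freed, slot `j` stays in the monomial. If `uᵢ` and `uⱼ` coincide, it already
  -- prescribes `vⱼ` as the image of `uᵢ`.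
  Pos⇒≡ : {u v : Tuple n (suc k)} → Pos u v → ∀ i j → lookup u i ≡ lookup u j → lookup v i ≡ lookup v j
  Pos⇒≡ {u} {v} pos i j eq with i Fin.≟ j | lookup v i Fin.≟ lookup v j
  ... | yes refl | _      = refl
  ... | no _     | yes p  = p
  ... | no i≢j   | no vᵢ≢vⱼ = contradiction
    (≈-trans (reflexive (cong φ (refill i s)))
      (functional rest ∣rest∣≤ (subst (λ (a : Fin n) → at a (lookup v j) ∈ₛ rest) (sym eq)
        (other∈ j (i≢j ∘ sym))) vᵢ≢vⱼ)) pos
    where
    s = slot i u v
    open Slot s

  Pos⇒≡′ : {u v : Tuple n (suc k)} → Pos u v → ∀ i j → lookup v i ≡ lookup v j → lookup u i ≡ lookup u j
  Pos⇒≡′ {u} {v} pos i j eq with i Fin.≟ j | lookup u i Fin.≟ lookup u j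
  ... | yes refl | _      = refl
  ... | no _     | yes p  = p
  ... | no i≢j   | no uᵢ≢uⱼ = contradiction
    (≈-trans (reflexive (cong φ (refill i s)))
      (injective rest ∣rest∣≤ (subst (λ (b : Fin n) → at (lookup u j) b ∈ₛ rest) (sym eq)
        (other∈ j (i≢j ∘ sym))) uᵢ≢uⱼ)) pos
    where
    s = slot i u v
    open Slot s

  -- For non-neighbours, the vertex itself included, the edge equation is cancelled from the full
  -- sums: the whole column and the whole row both add up to `φ S`.
  commute-neighbours : ∀ β S → ∣ S ∣ ≤ k → ∀ (a b : Fin n) →
    ∑ₗ (allFin n) (λ w → 𝟙 (adj G a w Bool.≟ β) * φ (S ∪ pair w b)) ≈
    ∑ₗ (allFin n) (λ w → φ (S ∪ pair a w) * 𝟙 (adj H w b Bool.≟ β))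
  commute-neighbours true  S S≤k a b = commute S S≤k a b
  commute-neighbours false S S≤k a b = +-cancelˡ (left true) _ _ (begin
    left true + left false    ≈⟨ ∑-+ (allFin n) _ _ ⟨
    ∑ₗ (allFin n) (λ w → 𝟙 (adj G a w Bool.≟ true) * φ (S ∪ pair w b) +
                         𝟙 (adj G a w Bool.≟ false) * φ (S ∪ pair w b))
                              ≈⟨ ∑-cong (allFin n) (λ w → 𝟙-split (adj G a w) _) ⟩
    ∑ₗ (allFin n) (λ w → φ (S ∪ pair w b))  ≈⟨ column S S≤k b ⟩
    φ S                       ≈⟨ row S S≤k a ⟨
    ∑ₗ (allFin n) (λ w → φ (S ∪ pair a w))  ≈⟨ ∑-cong (allFin n) (λ w →
                                   ≈-trans (+-cong (*-comm _ _) (*-comm _ _)) (𝟙-split (adj H w b) _)) ⟨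
    ∑ₗ (allFin n) (λ w → φ (S ∪ pair a w) * 𝟙 (adj H w b Bool.≟ true) +
                         φ (S ∪ pair a w) * 𝟙 (adj H w b Bool.≟ false))
                              ≈⟨ ∑-+ (allFin n) _ _ ⟩
    right true + right false  ≈⟨ +-congʳ (commute S S≤k a b) ⟨
    left true + right false   ∎)
    where
    left right : Bool → Carrier
    left  β = ∑ₗ (allFin n) (λ w → 𝟙 (adj G a w Bool.≟ β) * φ (S ∪ pair w b))
    right β = ∑ₗ (allFin n) (λ w → φ (S ∪ pair a w) * 𝟙 (adj H w b Bool.≟ β))

  private
    room : ∀ (S : Subset (n ℕ.* n)) → ∣ S ∣ ℕ.+ suc m ≤ suc k → ∣ S ∣ ≤ k
    room {m} S S≤ = ℕ.≤-trans (ℕ.m≤m+n ∣ S ∣ m) (ℕ.≤-pred (subst (_≤ suc k) (ℕ.+-suc ∣ S ∣ m) S≤))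
    sized : ∀ (S : Subset (n ℕ.* n)) → ∣ S ∣ ℕ.+ suc m ≤ suc k → ∀
      (x : Fin (n ℕ.* n)) → ∣ S ∪ ⁅ x ⁆ ∣ ℕ.+ m ≤ suc k
    sized {m} S S≤ x = ℕ.≤-trans (ℕ.+-monoˡ-≤ m (∣p∪⁅x⁆∣≤ S x ℕ.≤-refl))
      (subst (_≤ suc k) (ℕ.+-suc ∣ S ∣ m) S≤)

  -- The tail is summed out by induction with the head pair moved into `S`, and the head by a row
  -- equation. The bound on `∣ S ∣ ℕ.+ m` guarantees that every multiplier met on the way has at
  -- most `k` variables.
  ∑ʳ-img : ∀ (u : Tuple n m) S → ∣ S ∣ ℕ.+ m ≤ suc k →
            ∑ₗ (tuples n m) (λ v → φ (S ∪ img u v)) ≈ φ S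
  ∑ʳ-img []      S _ = ≈-trans (+-identityʳ _) (reflexive (cong φ (∪-identityʳ S)))
  ∑ʳ-img {suc m} (a ∷ u) S S≤ = begin
    ∑ₗ (tuples n (suc m)) (λ v → φ (S ∪ img (a ∷ u) v))   ≈⟨ ∑-product _∷_ (allFin n) (tuples n m) _ ⟩
    ∑ₗ (allFin n) (λ w → ∑ₗ (tuples n m) (λ v → φ (S ∪ (pair a w ∪ img u v))))
      ≈⟨ ∑-cong (allFin n) (λ w → ∑-cong (tuples n m) (λ v → reflexive (cong φ (sym (∪-assoc S _ _))))) ⟩
    ∑ₗ (allFin n) (λ w → ∑ₗ (tuples n m) (λ v → φ ((S ∪ pair a w) ∪ img u v)))
      ≈⟨ ∑-cong (allFin n) (λ w → ∑ʳ-img u (S ∪ pair a w) (sized S S≤ (at a w))) ⟩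
    ∑ₗ (allFin n) (λ w → φ (S ∪ pair a w))                ≈⟨ row S (room S S≤) a ⟩
    φ S                                                   ∎

  ∑ˡ-img : ∀ (v : Tuple n m) S → ∣ S ∣ ℕ.+ m ≤ suc k →
            ∑ₗ (tuples n m) (λ u → φ (S ∪ img u v)) ≈ φ S
  ∑ˡ-img []      S _ = ≈-trans (+-identityʳ _) (reflexive (cong φ (∪-identityʳ S)))
  ∑ˡ-img {suc m} (b ∷ v) S S≤ = begin
    ∑ₗ (tuples n (suc m)) (λ u → φ (S ∪ img u (b ∷ v)))   ≈⟨ ∑-product _∷_ (allFin n) (tuples n m) _ ⟩
    ∑ₗ (allFin n) (λ w → ∑ₗ (tuples n m) (λ u → φ (S ∪ (pair w b ∪ img u v))))
      ≈⟨ ∑-cong (allFin n) (λ w → ∑-cong (tuples n m) (λ u → reflexive (cong φ (sym (∪-assoc S _ _))))) ⟩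
    ∑ₗ (allFin n) (λ w → ∑ₗ (tuples n m) (λ u → φ ((S ∪ pair w b) ∪ img u v)))
      ≈⟨ ∑-cong (allFin n) (λ w → ∑ˡ-img v (S ∪ pair w b) (sized S S≤ (at w b))) ⟩
    ∑ₗ (allFin n) (λ w → φ (S ∪ pair w b))                ≈⟨ column S (room S S≤) b ⟩
    φ S                                                   ∎

  private
    ⊥-room : ∣ ⊥ {n ℕ.* n} ∣ ℕ.+ suc k ≤ suc k
    ⊥-room = ℕ.≤-reflexive (cong (ℕ._+ suc k) (∣⊥∣≡0 (n ℕ.* n)))

  ∑ʳ-Y : ∀ (u : Tuple n (suc k)) → ∑ₗ (tuples n (suc k)) (Y u) ≈ 1#
  ∑ʳ-Y u = ≈-trans (∑-cong (tuples n (suc k)) (λ v → reflexive (cong φ (sym (∪-identityˡ _)))))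
    (≈-trans (∑ʳ-img u ⊥ ⊥-room) φ⊥≈1)

  ∑ˡ-Y : ∀ (v : Tuple n (suc k)) → ∑ₗ (tuples n (suc k)) (λ u → Y u v) ≈ 1#
  ∑ˡ-Y v = ≈-trans (∑-cong (tuples n (suc k)) (λ u → reflexive (cong φ (sym (∪-identityˡ _)))))
    (≈-trans (∑ˡ-img v ⊥ ⊥-room) φ⊥≈1)

  -- Where the predicates disagree, `x` cannot be nonzero. This yields only a double negation, which
  -- `≈0-stable` removes.
  𝟙*≈*𝟙 : ∀ {x : Carrier} {P Q : Set} (P? : Dec P) (Q? : Dec Q) → (¬ x ≈ 0# → P → Q) →
                  (¬ x ≈ 0# → Q → P) → 𝟙 P? * x ≈ x * 𝟙 Q?
  𝟙*≈*𝟙 (yes _) (yes _) f g = ≈-trans (*-identityˡ _) (≈-sym (*-identityʳ _))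
  𝟙*≈*𝟙 (no _)  (no _)  f g = ≈-trans (zeroˡ _) (≈-sym (zeroʳ _))
  𝟙*≈*𝟙 (yes p) (no ¬q) f g = ≈-trans (*-congˡ x≈0) (≈-trans (zeroʳ _) (≈-sym (zeroʳ _)))
    where x≈0 = ≈0-stable (λ x≉0 → ¬q (f x≉0 p))
  𝟙*≈*𝟙 (no ¬p) (yes q) f g = ≈-trans (zeroˡ _) (≈-sym (≈-trans (*-congʳ x≈0) (zeroˡ _)))
    where x≈0 = ≈0-stable (λ x≉0 → ¬p (g x≉0 q))

  module _ {P Q : Tuple n (suc k) → Set} (P? : ∀ u → Dec (P u)) (Q? : ∀ v → Dec (Q v))
           (P⇒Q : ∀ u v → Pos u v → P u → Q v) (Q⇒P : ∀ u v → Pos u v → Q v → P u) where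

    count-neighbours : ∀ β i {u v} → Pos u v →
      length (filter P? (neighbours G β i u)) ≡ length (filter Q? (neighbours H β i v))
    count-neighbours β i {u} {v} pos =
      fractional (allFin n) (allFin n) Z (φ rest) (row rest ∣rest∣≤) (column rest ∣rest∣≤)
        (λ a w → 𝟙 (adj G a w Bool.≟ β)) (λ b w → 𝟙 (adj H b w Bool.≟ β))
        (λ a b → reflexive (cong (λ x → 𝟙 (x Bool.≟ β)) (symmetric G a b)))
        (λ a b → reflexive (cong (λ x → 𝟙 (x Bool.≟ β)) (symmetric H a b)))
        (commute-neighbours β rest ∣rest∣≤)
        (λ a → 𝟙 (P? (u [ i ]≔ a))) (λ b → 𝟙 (Q? (v [ i ]≔ b)))
        (λ a b → 𝟙*≈*𝟙 {Z a b} (P? (u [ i ]≔ a)) (Q? (v [ i ]≔ b)) (P⇒Q _ _ ∘ Z⇒Pos a b) (Q⇒P _ _ ∘ Z⇒Pos a b))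
        -- The counts are functions of the vertex in slot `i`, the other slots being fixed by `u`
        -- and `v`; at `lookup u i` and `lookup v i` they are the two sides of the claim.
        (λ a → length (filter P? (List.map (u [ i ]≔_) (filter (λ w → adj G a w Bool.≟ β) (allFin n)))))
        (λ b → length (filter Q? (List.map (v [ i ]≔_) (filter (λ w → adj H b w Bool.≟ β) (allFin n)))))
        (λ a → count-map-filter×1 P? _ (u [ i ]≔_) (allFin n))
        (λ b → count-map-filter×1 Q? _ (v [ i ]≔_) (allFin n))
        (nonNeg-∪ rest ∣rest∣≤)
        (lookup u i) (lookup v i) (∈-allFin _) (∈-allFin _)
        (λ Z≈0 → pos (≈-trans (reflexive (cong φ (refill i (slot i u v)))) Z≈0))
      where
      open Slot (slot i u v)
      Z : Fin n → Fin n → Carrier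
      Z a b = φ (rest ∪ pair a b)
      Z⇒Pos : ∀ a b → ¬ Z a b ≈ 0# → Pos (u [ i ]≔ a) (v [ i ]≔ b)
      Z⇒Pos a b Z≉0 eq = Z≉0 (≈-trans (reflexive (cong φ (sym (img-fill a b)))) eq)

    count-tuples : length (filter P? (tuples n (suc k))) ≡ length (filter Q? (tuples n (suc k)))
    count-tuples = ×1-injective _ _ (begin
      length (filter P? ts) ×1                        ≈⟨ count×1 P? ts ⟩
      ∑ₗ ts (λ u → 𝟙 (P? u))                           ≈⟨ ∑-cong ts
        (λ u → ≈-trans (*-congˡ (∑ʳ-Y u)) (*-identityʳ _)) ⟨
      ∑ₗ ts (λ u → 𝟙 (P? u) * ∑ₗ ts (λ v → Y u v))      ≈⟨ ∑-cong ts (λ u → ∑-*ˡ ts _ _) ⟨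
      ∑ₗ ts (λ u → ∑ₗ ts (λ v → 𝟙 (P? u) * Y u v))      ≈⟨ ∑-cong ts
        (λ u → ∑-cong ts (λ v → 𝟙*≈*𝟙 {Y u v} (P? u) (Q? v) (P⇒Q u v) (Q⇒P u v))) ⟩
      ∑ₗ ts (λ u → ∑ₗ ts (λ v → Y u v * 𝟙 (Q? v)))      ≈⟨ ∑-swap ts ts _ ⟩
      ∑ₗ ts (λ v → ∑ₗ ts (λ u → Y u v * 𝟙 (Q? v)))      ≈⟨ ∑-cong ts (λ v → ∑-*ʳ ts _ _) ⟩
      ∑ₗ ts (λ v → ∑ₗ ts (λ u → Y u v) * 𝟙 (Q? v))      ≈⟨ ∑-cong ts
        (λ v → ≈-trans (*-congʳ (∑ˡ-Y v)) (*-identityˡ _)) ⟩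
      ∑ₗ ts (λ v → 𝟙 (Q? v))                           ≈⟨ count×1 Q? ts ⟨
      length (filter Q? ts) ×1                        ∎)
      where ts = tuples n (suc k)

  -- u_i and u_j are adjacent iff some neighbour w of u_i makes u [ i ]≔ w constant on {i , j}.
  Pos⇒adj≡ : {u v : Tuple n (suc k)} → Pos u v → ∀ i j →
             adj G (lookup u i) (lookup u j) ≡ adj H (lookup v i) (lookup v j)
  Pos⇒adj≡ {u} {v} pos i j with i Fin.≟ j
  ... | yes refl = trans (irreflexive G _) (sym (irreflexive H _))
  ... | no i≢j   = same-truth (≈-trans (≈-sym (adjacent G u)) (≈-trans
    (reflexive (cong _×1 (count-neighbours ≟ᵢⱼ ≟ᵢⱼ
      (λ x y pos′ → Pos⇒≡ {x} {y} pos′ i j) (λ x y pos′ → Pos⇒≡′ {x} {y} pos′ i j) true i {u} {v} pos)))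
    (adjacent H v)))
    where
    ≟ᵢⱼ : (x : Tuple n (suc k)) → Dec (lookup x i ≡ lookup x j)
    ≟ᵢⱼ x = lookup x i Fin.≟ lookup x j
    constant : (x : Tuple n (suc k)) (w : Fin n) → 𝟙 (≟ᵢⱼ (x [ i ]≔ w)) ≈ 𝟙 (w Fin.≟ lookup x j)
    constant x w = reflexive (cong₂ (λ a b → 𝟙 (a Fin.≟ b))
      (Vec.lookup∘updateAt i x) (Vec.lookup∘updateAt′ j i (i≢j ∘ sym) x))
    adjacent : ∀ Γ (x : Tuple n (suc k)) →
      length (filter ≟ᵢⱼ (neighbours Γ true i x)) ×1 ≈ 𝟙 (adj Γ (lookup x i) (lookup x j) Bool.≟ true)
    adjacent Γ x = ≈-trans (count-map-filter×1 ≟ᵢⱼ _ (x [ i ]≔_) (allFin n)) (≈-trans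
      (∑-cong (allFin n) (λ w → *-congˡ (constant x w))) (≈-trans
      (∑-single (allFin⁺ n) (∈-allFin (lookup x j))
        (λ w w≢ → ≈-trans (*-congˡ (𝟙-no (w Fin.≟ lookup x j) w≢)) (zeroʳ _)))
      (≈-trans (*-congˡ (𝟙-yes (lookup x j Fin.≟ lookup x j) refl)) (*-identityʳ _))))
    same-truth : ∀ {α β} → 𝟙 (α Bool.≟ true) ≈ 𝟙 (β Bool.≟ true) → α ≡ β
    same-truth {true}  {true}  _  = refl
    same-truth {false} {false} _  = refl
    same-truth {true}  {false} eq = contradiction eq 1≉0
    same-truth {false} {true}  eq = contradiction (≈-sym eq) 1≉0

  Pos⇒𝒞≡ : {u v : Tuple n (suc k)} → Pos u v → 𝒞 G u ≡ 𝒞 H v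
  Pos⇒𝒞≡ {u} {v} pos = Vec.tabulate-cong λ i → Vec.tabulate-cong λ j → entries i j
    where
    entries : ∀ i j →
      (if does (lookup u i Fin.≟ lookup u j) then + 0
       else if adj G (lookup u i) (lookup u j) then + 1 else -[1+ 0 ]) ≡
      (if does (lookup v i Fin.≟ lookup v j) then + 0
       else if adj H (lookup v i) (lookup v j) then + 1 else -[1+ 0 ])
    entries i j with lookup u i Fin.≟ lookup u j | lookup v i Fin.≟ lookup v j
    ... | yes _ | yes _ = refl
    ... | yes p | no ¬q = contradiction (Pos⇒≡ {u} {v} pos i j p) ¬q
    ... | no ¬p | yes q = contradiction (Pos⇒≡′ {u} {v} pos i j q) ¬p
    ... | no _  | no _  = cong (if_then + 1 else -[1+ 0 ]) (Pos⇒adj≡ {u} {v} pos i j)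

-- Self-maps of a finite set

-- A missed value could be punched out, giving an injection of `Fin (suc n)` into `Fin n`.
injective⇒surjective : {f : Fin n → Fin n} → Injective _≡_ _≡_ f → ∀ y → ∃[ x ] f x ≡ y
injective⇒surjective {suc n} {f} f-inj y with Fin.any? (λ x → f x Fin.≟ y)
... | yes hit = hit
... | no miss = contradiction (Fin.injective⇒≤ {f = λ x → punchOut (y≢f x)} avoid-inj) ℕ.1+n≰n
  where
  y≢f : ∀ x → y ≢ f x
  y≢f x eq = miss (x , sym eq)
  avoid-inj : Injective _≡_ _≡_ (λ x → punchOut (y≢f x))
  avoid-inj {x} {x′} eq = f-inj (Fin.punchOut-injective (y≢f x) (y≢f x′) eq)

-- A surjective `f` has a section. The section is injective, hence surjective, so `f` would be
-- injective too.
¬injective⇒misses : (f : Fin n → Fin n) {i j : Fin n} → f i ≡ f j → i ≢ j → ∃[ c ] (∀ x → f x ≢ c)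
¬injective⇒misses {n} f {i} {j} fi≡fj i≢j with Fin.all? (λ c → Fin.any? (λ x → f x Fin.≟ c))
... | no ¬onto with c , c∉ ← Fin.¬∀⟶∃¬ n _ (λ c → Fin.any? (λ x → f x Fin.≟ c)) ¬onto =
  c , λ x eq → c∉ (x , eq)
... | yes onto = contradiction i≡j i≢j
  where
  g : Fin n → Fin n
  g c = proj₁ (onto c)
  g-inj : Injective _≡_ _≡_ g
  g-inj {a} {b} eq = trans (sym (proj₂ (onto a))) (trans (cong f eq) (proj₂ (onto b)))
  i≡j : i ≡ j
  i≡j with a , refl ← injective⇒surjective g-inj i | b , refl ← injective⇒surjective g-inj j =
    cong g (trans (sym (proj₂ (onto a))) (trans fi≡fj (proj₂ (onto b))))

overwrite : Fin n → Fin n → Fin n → Fin n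
overwrite i j x with x Fin.≟ i
... | yes _ = j
... | no _  = x

overwrite-hit : (i j : Fin n) → overwrite i j i ≡ j
overwrite-hit i j with i Fin.≟ i
... | yes _ = refl
... | no i≢i = contradiction refl i≢i

overwrite-miss : {i x : Fin n} (j : Fin n) → x ≢ i → overwrite i j x ≡ x
overwrite-miss {i = i} {x} j x≢i with x Fin.≟ i
... | yes x≡i = contradiction x≡i x≢i
... | no _ = refl

-- The symmetric group and the maps identifying two points generate all self-maps of a finite set.
module _ (P : (Fin n → Fin n) → Set)
  (P-resp : ∀ {f g} → f ≗ g → P f → P g)
  (P-∘ : ∀ {f g} → P f → P g → P (f ∘ g))
  (P-perm : (τ : Permutation′ n) → P (τ ⟨$⟩ʳ_))
  (P-overwrite : ∀ i j → i ≢ j → P (overwrite i j)) where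

  private
    P-injective : ∀ f → Injective _≡_ _≡_ f → P f
    P-injective f f-inj = P-perm (permutation f (proj₁ ∘ onto)
      (λ y → proj₂ (onto y)) (λ x → f-inj (proj₂ (onto (f x)))))
      where onto = injective⇒surjective f-inj

    -- Induction on the number `m` of initial positions at which collisions are still allowed. A
    -- collision of position `m` with a later one is split off as an `overwrite`; the other factor
    -- is changed at that position so as to collide no longer.
    P-injectiveFrom : ∀ m → m ≤ n → ∀ f →
      (∀ i j → m ≤ toℕ i → m ≤ toℕ j → f i ≡ f j → i ≡ j) → P f
    P-injectiveFrom zero    _   f f-inj = P-injective f (λ {x} {y} → f-inj x y z≤n z≤n)
    P-injectiveFrom (suc m) m<n f f-inj with Fin.any? (λ j → (suc m ℕ.≤? toℕ j) ×-dec
      (f j Fin.≟ f (fromℕ< m<n)))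
    ... | no unique = P-injectiveFrom m (ℕ.<⇒≤ m<n) f f-inj′
      where
      i₀ = fromℕ< m<n
      eq-i₀ : ∀ i → m ≡ toℕ i → i ≡ i₀
      eq-i₀ i eq = Fin.toℕ-injective (trans (sym eq) (sym (Fin.toℕ-fromℕ< m<n)))
      f-inj′ : ∀ i j → m ≤ toℕ i → m ≤ toℕ j → f i ≡ f j → i ≡ j
      f-inj′ i j m≤i m≤j eq with m ℕ.≟ toℕ i | m ℕ.≟ toℕ j
      ... | yes p | yes q = trans (eq-i₀ i p) (sym (eq-i₀ j q))
      ... | yes p | no ¬q = contradiction (j , ℕ.≤∧≢⇒< m≤j ¬q , trans (sym eq) (cong f (eq-i₀ i p))) unique
      ... | no ¬p | yes q = contradiction (i , ℕ.≤∧≢⇒< m≤i ¬p , trans eq (cong f (eq-i₀ j q))) unique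
      ... | no ¬p | no ¬q = f-inj i j (ℕ.≤∧≢⇒< m≤i ¬p) (ℕ.≤∧≢⇒< m≤j ¬q) eq
    ... | yes (j₀ , m<j₀ , fj₀≡fi₀) = P-resp factor
            (P-∘ (P-injectiveFrom m (ℕ.<⇒≤ m<n) f′ f′-inj) (P-overwrite i₀ j₀ (j₀≢i₀ ∘ sym)))
      where
      i₀ = fromℕ< m<n
      j₀≢i₀ : j₀ ≢ i₀
      j₀≢i₀ refl = ℕ.<-irrefl (sym (Fin.toℕ-fromℕ< m<n)) m<j₀
      -- A value missed by `f` exists because of the collision, and placed at `i₀` it differs from
      -- every other value.
      c = proj₁ (¬injective⇒misses f fj₀≡fi₀ j₀≢i₀)
      c-missed = proj₂ (¬injective⇒misses f fj₀≡fi₀ j₀≢i₀)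
      f′ : Fin n → Fin n
      f′ x with x Fin.≟ i₀
      ... | yes _ = c
      ... | no _  = f x
      above : ∀ i → m ≤ toℕ i → i ≢ i₀ → suc m ≤ toℕ i
      above i m≤i i≢i₀ = ℕ.≤∧≢⇒< m≤i (λ eq →
        i≢i₀ (Fin.toℕ-injective (trans (sym eq) (sym (Fin.toℕ-fromℕ< m<n)))))
      f′-inj : ∀ i j → m ≤ toℕ i → m ≤ toℕ j → f′ i ≡ f′ j → i ≡ j
      f′-inj i j m≤i m≤j eq with i Fin.≟ i₀ | j Fin.≟ i₀
      ... | yes p | yes q = trans p (sym q)
      ... | yes p | no ¬q = contradiction (sym eq) (c-missed j)
      ... | no ¬p | yes q = contradiction eq (c-missed i)
      ... | no ¬p | no ¬q = f-inj i j (above i m≤i ¬p) (above j m≤j ¬q) eq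
      f′-miss : ∀ x → x ≢ i₀ → f′ x ≡ f x
      f′-miss x x≢i₀ with x Fin.≟ i₀
      ... | yes p = contradiction p x≢i₀
      ... | no _  = refl
      factor : f′ ∘ overwrite i₀ j₀ ≗ f
      factor x = cases (x Fin.≟ i₀)
        where
        cases : Dec (x ≡ i₀) → f′ (overwrite i₀ j₀ x) ≡ f x
        cases (yes refl) = trans (cong f′ (overwrite-hit i₀ j₀)) (trans (f′-miss j₀ j₀≢i₀) fj₀≡fi₀)
        cases (no x≢i₀) = trans (cong f′ (overwrite-miss j₀ x≢i₀)) (f′-miss x x≢i₀)

  all-selfMaps : ∀ f → P f
  all-selfMaps f = P-injectiveFrom n ℕ.≤-refl f
    (λ i _ n≤i → contradiction (Fin.toℕ<n i) (ℕ.≤⇒≯ n≤i))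

iter : (Fin n → Fin n) → ℕ → Fin n → Fin n
iter f zero    = id
iter f (suc m) = iter f m ∘ f

iter-+ : (f : Fin n → Fin n) (l m : ℕ) → iter f (l ℕ.+ m) ≗ iter f m ∘ iter f l
iter-+ f zero    m x = refl
iter-+ f (suc l) m x = iter-+ f l m (f x)

iter-injective : {f : Fin n → Fin n} → Injective _≡_ _≡_ f → ∀ m → Injective _≡_ _≡_ (iter f m)
iter-injective f-inj zero    eq = eq
iter-injective f-inj (suc m) eq = f-inj (iter-injective f-inj m eq)

-- Finite order: pigeonhole on the powers of f.
inverse-is-power : (f g : Fin n → Fin n) → (∀ x → f (g x) ≡ x) → (∀ x → g (f x) ≡ x) →
                   ∃[ d ] (∀ x → iter f d x ≡ g x)
inverse-is-power {n} f g fg gf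
  with i , j , i<j , eq ← Fin.pigeonhole (ℕ.n<1+n (length (tuples n n)))
         (λ i → Any.index (∈-tuples (tabulate (iter f (toℕ i))))) =
  d , λ x → trans (cong (iter f d) (sym (fg x))) (id-power (g x))
  where
  f-inj : Injective _≡_ _≡_ f
  f-inj {x} {y} e = trans (sym (gf x)) (trans (cong g e) (gf y))
  same : ∀ x → iter f (toℕ i) x ≡ iter f (toℕ j) x
  same x = trans (sym (Vec.lookup∘tabulate (iter f (toℕ i)) x)) (trans
    (cong (λ t → lookup t x) (SetoidMembership.index-injective (≡.setoid _)
      (∈-tuples (tabulate (iter f (toℕ i)))) (∈-tuples (tabulate (iter f (toℕ j)))) eq))
    (Vec.lookup∘tabulate (iter f (toℕ j)) x))
  -- The powers `i` and `j = suc d + i` agree, so the power `suc d` is the identity and the power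
  -- `d` is the inverse.
  d = toℕ j ℕ.∸ suc (toℕ i)
  id-power : ∀ x → iter f (suc d) x ≡ x
  id-power x = iter-injective f-inj (toℕ i) (trans (sym (iter-+ f (suc d) (toℕ i) x))
    (trans (cong (λ m → iter f m x) (trans (sym (ℕ.+-suc d (toℕ i))) (ℕ.m∸n+n≡m i<j))) (sym (same x))))

-- Contravariant reindexing. For a permutation it is `permute` by definition; non-injective maps
-- repeat entries and non-surjective ones drop entries.
pull : (Fin m → Fin k) → Tuple n k → Tuple n m
pull f u = tabulate (lookup u ∘ f)

lookup-pull : (f : Fin m → Fin k) (u : Tuple n k) (i : Fin m) → lookup (pull f u) i ≡ lookup u (f i)
lookup-pull f u = Vec.lookup∘tabulate (lookup u ∘ f)

lookup-ext : {u v : Tuple n m} → (∀ i → lookup u i ≡ lookup v i) → u ≡ v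
lookup-ext {u = u} {v} h = trans (sym (Vec.tabulate∘lookup u))
  (trans (Vec.tabulate-cong h) (Vec.tabulate∘lookup v))

pull-∘ : (f : Fin m → Fin m) (g : Fin m → Fin m) (u : Tuple n m) → pull g (pull f u) ≡ pull (f ∘ g) u
pull-∘ f g u = Vec.tabulate-cong (λ i → lookup-pull f u (g i))

pull-resp : {f g : Fin m → Fin k} → f ≗ g → (u : Tuple n k) → pull f u ≡ pull g u
pull-resp f≗g u = Vec.tabulate-cong (cong (lookup u) ∘ f≗g)

pull-overwrite : (i j : Fin m) (u : Tuple n m) → pull (overwrite i j) u ≡ u [ i ]≔ lookup u j
pull-overwrite i j u = lookup-ext (λ x → trans (lookup-pull (overwrite i j) u x) (cases x (x Fin.≟ i)))
  where
  cases : ∀ x → Dec (x ≡ i) → lookup u (overwrite i j x) ≡ lookup (u [ i ]≔ lookup u j) x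
  cases x (yes refl) = trans (cong (lookup u) (overwrite-hit x j)) (sym (Vec.lookup∘updateAt x u))
  cases x (no x≢i)   = trans (cong (lookup u) (overwrite-miss j x≢i)) (sym (Vec.lookup∘updateAt′ x i x≢i u))

-- From stable colourings to points of the relaxation

infix 4 _≟ᵗ_
_≟ᵗ_ : (u v : Tuple n m) → Dec (u ≡ v)
_≟ᵗ_ = Vec.≡-dec Fin._≟_

tuples-unique : ∀ n m → Unique (tuples n m)
tuples-unique n zero    = [] ∷ []
tuples-unique n (suc m) =
  cartesianProductWith⁺ _∷_ Vec.∷-injective (allFin⁺ n) (tuples-unique n m)

-- A colouring of the tuples of two graphs (the first component of an element of
-- Bool × Tuple tells the graph) that C-V-C refinement does not split.
record Stable {n k : ℕ} (σ₁ σ₂ : Permutation′ k) (Γ : Bool → Graph n)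
              (π : Partition (Bool × Tuple n k)) : Set where
  open Partition π
  field
    permuted₁ : ∀ {s t u v} → (s , u) ∼ (t , v) → (s , permute σ₁ u) ∼ (t , permute σ₁ v)
    permuted₂ : ∀ {s t u v} → (s , u) ∼ (t , v) → (s , permute σ₂ u) ∼ (t , permute σ₂ v)
    pattern≡  : ∀ {s t u v} → (s , u) ∼ (t , v) → ∀ i j → lookup u i ≡ lookup u j → lookup v i ≡ lookup v j
    counts    : ∀ {s t u v} → (s , u) ∼ (t , v) → ∀ β i z →
      length (filter (λ x → (s , x) ∼? z) (neighbours (Γ s) β i u)) ≡
      length (filter (λ x → (t , x) ∼? z) (neighbours (Γ t) β i v))
    balanced  : ∀ z s t → length (filter (λ x → (s , x) ∼? z) (tuples n k)) ≡
                          length (filter (λ x → (t , x) ∼? z) (tuples n k))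

module Transport (R : OrderedRing) {n k : ℕ} {σ₁ σ₂ : Permutation′ (suc k)}
  (gen : GeneratesSymmetricGroup σ₁ σ₂) {Γ : Bool → Graph n}
  {π : Partition (Bool × Tuple n (suc k))} (stable : Stable σ₁ σ₂ Γ π) where

  open Sums R
  open Partition π
  open Stable stable

  K : ℕ
  K = suc k

  T : List (Tuple n K)
  T = tuples n K

  ∑-single-T : {f : Tuple n K → Carrier} (v : Tuple n K) → (∀ x → x ≢ v → f x ≈ 0#) → ∑ₗ T f ≈ f v
  ∑-single-T v = ∑-single (tuples-unique n K) (∈-tuples v)

  ∑-𝟙-T : (v : Tuple n K) (f : Tuple n K → Carrier) → ∑ₗ T (λ x → 𝟙 (v ≟ᵗ x) * f x) ≈ f v
  ∑-𝟙-T v f = ≈-trans (∑-single-T v (λ x x≢v → 𝟙*-no (v ≟ᵗ x) (x≢v ∘ sym))) (𝟙*-yes (v ≟ᵗ v) refl)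

  ∑-support : (ρ : Fin n → Tuple n K) → (∀ {a b} → ρ a ≡ ρ b → a ≡ b) → (f : Tuple n K → Carrier) →
              (∀ v → ¬ f v ≈ 0# → ∃[ w ] v ≡ ρ w) → ∑ₗ T f ≈ ∑ₗ (allFin n) (f ∘ ρ)
  ∑-support ρ ρ-inj f supp = begin
    ∑ₗ T f                                                 ≈⟨ ∑-cong T covered ⟩
    ∑ₗ T (λ v → ∑ₗ (allFin n) (λ w → 𝟙 (ρ w ≟ᵗ v) * f v))   ≈⟨ ∑-swap T (allFin n) _ ⟩
    ∑ₗ (allFin n) (λ w → ∑ₗ T (λ v → 𝟙 (ρ w ≟ᵗ v) * f v))   ≈⟨ ∑-cong (allFin n) (λ w → ∑-𝟙-T (ρ w) f) ⟩
    ∑ₗ (allFin n) (f ∘ ρ)                                  ∎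
    where
    covered : ∀ v → f v ≈ ∑ₗ (allFin n) (λ w → 𝟙 (ρ w ≟ᵗ v) * f v)
    covered v with Fin.any? (λ w → ρ w ≟ᵗ v)
    ... | yes (w , refl) = ≈-sym (≈-trans
      (∑-single (allFin⁺ n) (∈-allFin w) (λ x x≢w → 𝟙*-no (ρ x ≟ᵗ ρ w) (x≢w ∘ ρ-inj)))
      (𝟙*-yes (ρ w ≟ᵗ ρ w) refl))
    ... | no miss = ≈-trans
      (≈0-stable (λ fv≉0 → let w , eq = supp v fv≉0 in miss (w , sym eq)))
      (≈-sym (∑-zero (allFin n) (λ w → 𝟙*-no (ρ w ≟ᵗ v) (λ eq → miss (w , eq)))))

  Invariant : (Bool → Tuple n K → Carrier) → Set
  Invariant h = ∀ {s t u v} → (s , u) ∼ (t , v) → h s u ≈ h t v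

  ∼-invariant : ∀ z → Invariant (λ s u → 𝟙 ((s , u) ∼? z))
  ∼-invariant z u∼v = 𝟙-⇔ (_ ∼? z) (_ ∼? z) (∼-trans (∼-sym u∼v)) (∼-trans u∼v)

  𝟙-∼-sym : ∀ x z → 𝟙 (x ∼? z) ≈ 𝟙 (z ∼? x)
  𝟙-∼-sym x z = 𝟙-⇔ (x ∼? z) (z ∼? x) ∼-sym ∼-sym

  -- Counted on the side `true`; by `balanced` the other side gives the same number.
  cellSize : Bool × Tuple n K → ℕ
  cellSize z = length (filter (λ x → (true , x) ∼? z) T)

  size≈∑ : ∀ s z → ∑ₗ T (λ x → 𝟙 ((s , x) ∼? z)) ≈ cellSize z ×1
  size≈∑ s z = ≈-trans (≈-sym (count×1 (λ x → (s , x) ∼? z) T)) (reflexive (cong _×1 (balanced z s true)))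

  size≈∑′ : ∀ s z → ∑ₗ T (λ x → 𝟙 (z ∼? (s , x))) ≈ cellSize z ×1
  size≈∑′ s z = ≈-trans (∑-cong T (λ x → 𝟙-∼-sym z (s , x))) (size≈∑ s z)

  cellSize≢0 : ∀ z → ¬ cellSize z ≡ 0
  cellSize≢0 (s , u) eq = 1≉0 (≈-trans (≈-sym (𝟙-yes ((s , u) ∼? (s , u)) ∼-refl))
    (∑≈0⇒≈0 (λ x → nonNeg-𝟙 ((s , x) ∼? (s , u)))
      (≈-trans (size≈∑ s (s , u)) (reflexive (cong _×1 eq))) (∈-tuples u)))

  reciprocal : ∀ m → ¬ m ≡ 0 → ∃[ r ] NonNeg r × r * m ×1 ≈ 1#
  reciprocal zero    m≢0 = contradiction refl m≢0
  reciprocal (suc m) _   = recip m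

  weight : Bool × Tuple n K → Carrier
  weight z = proj₁ (reciprocal (cellSize z) (cellSize≢0 z))

  nonNeg-weight : ∀ z → NonNeg (weight z)
  nonNeg-weight z = proj₁ (proj₂ (reciprocal (cellSize z) (cellSize≢0 z)))

  weight*size : ∀ z → weight z * cellSize z ×1 ≈ 1#
  weight*size z = proj₂ (proj₂ (reciprocal (cellSize z) (cellSize≢0 z)))

  -- Cross-multiplication: both weights are multiplied in, and each cancels its own cell size.
  weight-cross : ∀ {x y} z z′ → cellSize z ×1 * x ≈ cellSize z′ ×1 * y → weight z′ * x ≈ weight z * y
  weight-cross {x} {y} z z′ eq = begin
    weight z′ * x                                     ≈⟨ *-congˡ (cancel z x) ⟨
    weight z′ * (weight z * (cellSize z ×1 * x))      ≈⟨ *-congˡ (*-congˡ eq) ⟩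
    weight z′ * (weight z * (cellSize z′ ×1 * y))     ≈⟨ *-swapˡ _ _ _ ⟩
    weight z * (weight z′ * (cellSize z′ ×1 * y))     ≈⟨ *-congˡ (cancel z′ y) ⟩
    weight z * y                                      ∎
    where
    cancel : ∀ z x → weight z * (cellSize z ×1 * x) ≈ x
    cancel z x = ≈-trans (≈-sym (*-assoc _ _ _)) (≈-trans (*-congʳ (weight*size z)) (*-identityˡ x))

  size-cong : ∀ {z z′} → z ∼ z′ → cellSize z ×1 ≈ cellSize z′ ×1
  size-cong {z} {z′} z∼z′ = ≈-trans (≈-sym (size≈∑ true z)) (≈-trans
    (∑-cong T (λ x → 𝟙-⇔ ((true , x) ∼? z) ((true , x) ∼? z′) (λ p → ∼-trans p z∼z′)
      (λ p → ∼-trans p (∼-sym z∼z′))))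
    (size≈∑ true z′))

  weight-cong : ∀ {z z′} → z ∼ z′ → weight z ≈ weight z′
  weight-cong {z} {z′} z∼z′ = ≈-sym (≈-trans (≈-sym (*-identityʳ _)) (≈-trans
    (weight-cross z z′ (*-congʳ (size-cong z∼z′))) (*-identityʳ _)))

  -- An invariant function equals its average over a cell. Summing over all tuples with weights
  -- replaces a sum over cells, so no representatives have to be chosen, and `h` becomes a
  -- combination of cell indicators.
  expand : ∀ h → Invariant h → ∀ s x →
           h s x ≈ ∑ₗ T (λ z → 𝟙 ((s , x) ∼? (true , z)) * (h true z * weight (true , z)))
  expand h inv s x = ≈-sym (begin
    ∑ₗ T (λ z → 𝟙 ((s , x) ∼? (true , z)) * (h true z * weight (true , z)))
      ≈⟨ ∑-cong T (λ z → 𝟙*-cong ((s , x) ∼? (true , z))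
        (λ x∼z → *-cong (≈-sym (inv x∼z)) (≈-sym (weight-cong x∼z)))) ⟩
    ∑ₗ T (λ z → 𝟙 ((s , x) ∼? (true , z)) * (h s x * weight (s , x)))  ≈⟨ ∑-*ʳ T _ _ ⟩
    ∑ₗ T (λ z → 𝟙 ((s , x) ∼? (true , z))) * (h s x * weight (s , x))  ≈⟨ *-congʳ (size≈∑′ true (s , x)) ⟩
    cellSize (s , x) ×1 * (h s x * weight (s , x))                     ≈⟨ *-comm _ _ ⟩
    h s x * weight (s , x) * cellSize (s , x) ×1                       ≈⟨ *-assoc _ _ _ ⟩
    h s x * (weight (s , x) * cellSize (s , x) ×1)                     ≈⟨ *-congˡ (weight*size (s , x)) ⟩
    h s x * 1#                                                         ≈⟨ *-identityʳ _ ⟩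
    h s x                                                              ∎)

  -- The counting condition of stability is the case of a cell indicator; `expand` extends it
  -- linearly to every invariant function.
  neighbour-sum : ∀ h → Invariant h → ∀ {s t u v} → (s , u) ∼ (t , v) → ∀ β i →
    ∑ₗ (allFin n) (λ w → 𝟙 (adj (Γ s) (lookup u i) w Bool.≟ β) * h s (u [ i ]≔ w)) ≈
    ∑ₗ (allFin n) (λ w → 𝟙 (adj (Γ t) (lookup v i) w Bool.≟ β) * h t (v [ i ]≔ w))
  neighbour-sum h inv {s} {t} {u} {v} u∼v β i =
    ≈-trans (by-cells s u) (≈-trans (∑-cong T (λ z → *-congʳ (same z))) (≈-sym (by-cells t v)))
    where
    number : Bool → Tuple n K → Tuple n K → Carrier
    number s u z = ∑ₗ (allFin n) (λ w → 𝟙 (adj (Γ s) (lookup u i) w Bool.≟ β) * 𝟙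
      ((s , u [ i ]≔ w) ∼? (true , z)))
    same : ∀ z → number s u z ≈ number t v z
    same z = ≈-trans (≈-sym (count-map-filter×1 (λ x → (s , x) ∼? (true , z)) _ (u [ i ]≔_) (allFin n)))
      (≈-trans (reflexive (cong _×1 (counts u∼v β i (true , z))))
        (count-map-filter×1 (λ x → (t , x) ∼? (true , z)) _ (v [ i ]≔_) (allFin n)))
    by-cells : ∀ s u →
      ∑ₗ (allFin n) (λ w → 𝟙 (adj (Γ s) (lookup u i) w Bool.≟ β) * h s (u [ i ]≔ w)) ≈
      ∑ₗ T (λ z → number s u z * (h true z * weight (true , z)))
    by-cells s u = begin
      ∑ₗ (allFin n) (λ w → 𝟙 (edge? w) * h s (u [ i ]≔ w))
        ≈⟨ ∑-cong (allFin n) (λ w → ≈-trans (*-congˡ (expand h inv s _)) (≈-sym (∑-*ˡ T _ _))) ⟩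
      ∑ₗ (allFin n) (λ w → ∑ₗ T (λ z → 𝟙 (edge? w) * (𝟙 ((s , u [ i ]≔ w) ∼? (true , z)) *
        (h true z * weight (true , z)))))
        ≈⟨ ∑-swap (allFin n) T _ ⟩
      ∑ₗ T (λ z → ∑ₗ (allFin n) (λ w → 𝟙 (edge? w) * (𝟙 ((s , u [ i ]≔ w) ∼? (true , z)) *
        (h true z * weight (true , z)))))
        ≈⟨ ∑-cong T (λ z → ≈-trans (∑-cong (allFin n) (λ w → ≈-sym (*-assoc _ _ _))) (∑-*ʳ (allFin n) _ _)) ⟩
      ∑ₗ T (λ z → number s u z * (h true z * weight (true , z)))  ∎
      where
      edge? : ∀ w → Dec (adj (Γ s) (lookup u i) w ≡ β)
      edge? w = adj (Γ s) (lookup u i) w Bool.≟ β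

  line-sum : ∀ h → Invariant h → ∀ {s t u v} → (s , u) ∼ (t , v) → ∀ i →
    ∑ₗ (allFin n) (λ w → h s (u [ i ]≔ w)) ≈ ∑ₗ (allFin n) (λ w → h t (v [ i ]≔ w))
  line-sum h inv {s} {t} {u} {v} u∼v i = ≈-trans (≈-sym (split s u))
    (≈-trans (+-cong (neighbour-sum h inv u∼v true i) (neighbour-sum h inv u∼v false i)) (split t v))
    where
    split : ∀ s u → ∑ₗ (allFin n) (λ w → 𝟙 (adj (Γ s) (lookup u i) w Bool.≟ true) * h s (u [ i ]≔ w)) +
                    ∑ₗ (allFin n) (λ w → 𝟙 (adj (Γ s) (lookup u i) w Bool.≟ false) * h s (u [ i ]≔ w)) ≈
                    ∑ₗ (allFin n) (λ w → h s (u [ i ]≔ w))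
    split s u = ≈-trans (≈-sym (∑-+ (allFin n) _ _)) (∑-cong (allFin n)
      (λ w → 𝟙-split (adj (Γ s) (lookup u i) w) _))

  Compatible : (Fin K → Fin K) → Set
  Compatible f = ∀ {s t u v} → (s , u) ∼ (t , v) → (s , pull f u) ∼ (t , pull f v)

  -- The adjoint of `pull f` on functions: summation over its fibres.
  push : (Fin K → Fin K) → (Bool → Tuple n K → Carrier) → Bool → Tuple n K → Carrier
  push f h s t = ∑ₗ T (λ x → 𝟙 (pull f x ≟ᵗ t) * h s x)

  -- The second half says that the part of a cell lying in the fibre over a point has a size
  -- depending only on the cell of that point. Each half is closed under composition, so it can be
  -- checked on generators.
  Admissible : (Fin K → Fin K) → Set
  Admissible f = Compatible f × (∀ h → Invariant h → Invariant (push f h))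

  Compatible-resp : ∀ {f g} → f ≗ g → Compatible f → Compatible g
  Compatible-resp f≗g cf {s} {t} {u} {v} u∼v =
    subst₂ (λ x y → (s , x) ∼ (t , y)) (pull-resp f≗g u) (pull-resp f≗g v) (cf u∼v)

  Compatible-∘ : ∀ {f g} → Compatible f → Compatible g → Compatible (f ∘ g)
  Compatible-∘ {f} {g} cf cg {s} {t} {u} {v} u∼v =
    subst₂ (λ x y → (s , x) ∼ (t , y)) (pull-∘ f g u) (pull-∘ f g v) (cg (cf u∼v))

  Compatible-id : Compatible id
  Compatible-id {s} {t} = subst₂ (λ x y → (s , x) ∼ (t , y)) (sym (Vec.tabulate∘lookup _))
    (sym (Vec.tabulate∘lookup _))

  Compatible-iter : ∀ {f} → Compatible f → ∀ d → Compatible (iter f d)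
  Compatible-iter cf zero    = Compatible-id
  Compatible-iter {f} cf (suc d) = Compatible-∘ {iter f d} {f} (Compatible-iter cf d) cf

  -- Stability speaks of the generators in the forward direction. An inverse is reached as a power,
  -- every permutation of a finite set having finite order.
  Compatible-generated : ∀ {τ} → Generated σ₁ σ₂ τ → Compatible (τ ⟨$⟩ʳ_)
  Compatible-generated gen₁ = permuted₁
  Compatible-generated gen₂ = permuted₂
  Compatible-generated identity = Compatible-id
  Compatible-generated (inverse {τ} g)
    with d , eq ← inverse-is-power (τ ⟨$⟩ʳ_) (τ ⟨$⟩ˡ_) (λ x → Perm.inverseʳ τ) (λ x → Perm.inverseˡ τ) =
    Compatible-resp {iter (τ ⟨$⟩ʳ_) d} {τ ⟨$⟩ˡ_} eq (Compatible-iter (Compatible-generated g) d)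
  -- `τ ∘ₚ ρ` applies `τ` first, so as a function it is `ρ` after `τ`.
  Compatible-generated (compose {τ} {ρ} g h) = Compatible-∘ {ρ ⟨$⟩ʳ_} {τ ⟨$⟩ʳ_} (Compatible-generated h)
    (Compatible-generated g)
  Compatible-generated (respects {τ} {ρ} τ≈ρ g) = Compatible-resp {τ ⟨$⟩ʳ_} {ρ ⟨$⟩ʳ_} τ≈ρ
    (Compatible-generated g)

  Admissible-resp : ∀ {f g} → f ≗ g → Admissible f → Admissible g
  Admissible-resp {f} {g} f≗g (cf , pf) = Compatible-resp {f} {g} f≗g cf , λ h inv {s} {t} {u} {v} u∼v →
    ≈-trans (≈-sym (same h s u)) (≈-trans (pf h inv u∼v) (same h t v))
    where
    same : ∀ h s t → push f h s t ≈ push g h s t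
    same h s t = ∑-cong T (λ x → *-congʳ (reflexive (cong (λ y → 𝟙 (y ≟ᵗ t)) (pull-resp f≗g x))))

  push-∘ : ∀ f g h s t → push (f ∘ g) h s t ≈ push g (push f h) s t
  push-∘ f g h s t = ≈-sym (begin
    ∑ₗ T (λ y → 𝟙 (pull g y ≟ᵗ t) * ∑ₗ T (λ x → 𝟙 (pull f x ≟ᵗ y) * h s x))
      ≈⟨ ∑-cong T (λ y → ∑-*ˡ T _ _) ⟨
    ∑ₗ T (λ y → ∑ₗ T (λ x → 𝟙 (pull g y ≟ᵗ t) * (𝟙 (pull f x ≟ᵗ y) * h s x)))
      ≈⟨ ∑-swap T T _ ⟩
    ∑ₗ T (λ x → ∑ₗ T (λ y → 𝟙 (pull g y ≟ᵗ t) * (𝟙 (pull f x ≟ᵗ y) * h s x)))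
      ≈⟨ ∑-cong T (λ x → ∑-cong T (λ y → *-swapˡ _ _ _)) ⟩
    ∑ₗ T (λ x → ∑ₗ T (λ y → 𝟙 (pull f x ≟ᵗ y) * (𝟙 (pull g y ≟ᵗ t) * h s x)))
      ≈⟨ ∑-cong T (λ x → ∑-𝟙-T (pull f x) _) ⟩
    ∑ₗ T (λ x → 𝟙 (pull g (pull f x) ≟ᵗ t) * h s x)
      ≈⟨ ∑-cong T (λ x → *-congʳ (reflexive (cong (λ y → 𝟙 (y ≟ᵗ t)) (pull-∘ f g x)))) ⟩
    push (f ∘ g) h s t  ∎)

  Admissible-∘ : ∀ {f g} → Admissible f → Admissible g → Admissible (f ∘ g)
  Admissible-∘ {f} {g} (cf , pf) (cg , pg) = Compatible-∘ {f} {g} cf cg , λ h inv {s} {t} {u} {v} u∼v →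
    ≈-trans (push-∘ f g h s u) (≈-trans (pg (push f h) (pf h inv) u∼v) (≈-sym (push-∘ f g h t v)))

  Admissible-perm : (τ : Permutation′ K) → Admissible (τ ⟨$⟩ʳ_)
  Admissible-perm τ = Compatible-generated (gen τ) , λ h inv {s} {t} {u} {v} u∼v →
    ≈-trans (push-perm h s u) (≈-trans (inv (Compatible-generated (inverse (gen τ)) u∼v))
      (≈-sym (push-perm h t v)))
    where
    back-forth : ∀ x → pull (τ ⟨$⟩ˡ_) (pull (τ ⟨$⟩ʳ_) x) ≡ x
    back-forth x = trans (pull-∘ (τ ⟨$⟩ʳ_) (τ ⟨$⟩ˡ_) x)
      (trans (pull-resp {f = (τ ⟨$⟩ʳ_) ∘ (τ ⟨$⟩ˡ_)} {g = id} (λ _ → Perm.inverseʳ τ) x) (Vec.tabulate∘lookup x))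
    forth-back : ∀ x → pull (τ ⟨$⟩ʳ_) (pull (τ ⟨$⟩ˡ_) x) ≡ x
    forth-back x = trans (pull-∘ (τ ⟨$⟩ˡ_) (τ ⟨$⟩ʳ_) x)
      (trans (pull-resp {f = (τ ⟨$⟩ˡ_) ∘ (τ ⟨$⟩ʳ_)} {g = id} (λ _ → Perm.inverseˡ τ) x) (Vec.tabulate∘lookup x))
    push-perm : ∀ h s t → push (τ ⟨$⟩ʳ_) h s t ≈ h s (pull (τ ⟨$⟩ˡ_) t)
    push-perm h s t = ≈-trans
      (∑-single-T (pull (τ ⟨$⟩ˡ_) t) (λ x x≢ → 𝟙*-no (pull (τ ⟨$⟩ʳ_) x ≟ᵗ t)
        (λ eq → x≢ (trans (sym (back-forth x)) (cong (pull (τ ⟨$⟩ˡ_)) eq)))))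
      (𝟙*-yes (pull (τ ⟨$⟩ʳ_) (pull (τ ⟨$⟩ˡ_) t) ≟ᵗ t) (forth-back t))

  pattern? : ∀ {s t u v} → (s , u) ∼ (t , v) → ∀ i j →
             𝟙 (lookup u i Fin.≟ lookup u j) ≈ 𝟙 (lookup v i Fin.≟ lookup v j)
  pattern? u∼v i j = 𝟙-⇔ (_ Fin.≟ _) (_ Fin.≟ _) (pattern≡ u∼v i j) (pattern≡ (∼-sym u∼v) i j)

  -- Compatibility: line counts provide some `v [ i ]≔ w` in the cell of the overwritten `u`, and
  -- the equality of its entries `i` and `j` forces `w` to be `vⱼ`. Pushing: the fibre over `t` is
  -- empty unless `tᵢ = tⱼ`, and then it is the whole line through `t` in direction `i`.
  Admissible-overwrite : ∀ i j → i ≢ j → Admissible (overwrite i j)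
  Admissible-overwrite i j i≢j = compatible , λ h inv {s} {t} {u} {v} u∼v →
    ≈-trans (push-overwrite h s u) (≈-trans
      (*-cong (pattern? u∼v i j) (line-sum h inv u∼v i)) (≈-sym (push-overwrite h t v)))
    where
    compatible : Compatible (overwrite i j)
    compatible {s} {t} {u} {v} u∼v with Fin.any? (λ w → (t , v [ i ]≔ w) ∼? (s , pull (overwrite i j) u))
    ... | no none = contradiction
      (≈-trans (≈-sym (𝟙-yes ((s , u [ i ]≔ lookup u j) ∼? z)
        (subst (λ x → (s , x) ∼ z) (pull-overwrite i j u) ∼-refl)))
        (∑≈0⇒≈0 {f = λ w → 𝟙 ((s , u [ i ]≔ w) ∼? z)} (λ w → nonNeg-𝟙 ((s , u [ i ]≔ w) ∼? z))
          (≈-trans (line-sum (λ s x → 𝟙 ((s , x) ∼? z)) (∼-invariant z) u∼v i)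
            (∑-zero (allFin n) (λ w → 𝟙-no ((t , v [ i ]≔ w) ∼? z) (λ p → none (w , p)))))
          (∈-allFin (lookup u j)))) 1≉0
      where z = s , pull (overwrite i j) u
    ... | yes (w , v′∼u′) = subst (λ x → (s , pull (overwrite i j) u) ∼ (t , x))
      (trans (cong (v [ i ]≔_) w≡) (sym (pull-overwrite i j v))) (∼-sym v′∼u′)
      where
      u′ᵢ≡u′ⱼ : lookup (pull (overwrite i j) u) i ≡ lookup (pull (overwrite i j) u) j
      u′ᵢ≡u′ⱼ = trans (lookup-pull (overwrite i j) u i) (trans
        (cong (lookup u) (trans (overwrite-hit i j) (sym (overwrite-miss j (i≢j ∘ sym)))))
        (sym (lookup-pull (overwrite i j) u j)))
      w≡ : w ≡ lookup v j
      w≡ = trans (sym (Vec.lookup∘updateAt i v)) (trans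
        (pattern≡ (∼-sym v′∼u′) i j u′ᵢ≡u′ⱼ) (Vec.lookup∘updateAt′ j i (i≢j ∘ sym) v))
    hits : ∀ t x → 𝟙 (pull (overwrite i j) x ≟ᵗ t) ≈
           𝟙 (lookup t i Fin.≟ lookup t j) * ∑ₗ (allFin n) (λ w → 𝟙 (t [ i ]≔ w ≟ᵗ x))
    hits t x = ≈-trans (by-cases (lookup t i Fin.≟ lookup t j)) (*-congˡ (≈-sym one))
      where
      one : ∑ₗ (allFin n) (λ w → 𝟙 (t [ i ]≔ w ≟ᵗ x)) ≈ 𝟙 (t [ i ]≔ lookup x i ≟ᵗ x)
      one = ∑-single (allFin⁺ n) (∈-allFin (lookup x i)) (λ w w≢ → 𝟙-no (t [ i ]≔ w ≟ᵗ x)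
        (λ eq → w≢ (trans (sym (Vec.lookup∘updateAt i t)) (cong (λ y → lookup y i) eq))))
      at-i : lookup (pull (overwrite i j) x) i ≡ lookup x j
      at-i = trans (lookup-pull (overwrite i j) x i) (cong (lookup x) (overwrite-hit i j))
      off-i : ∀ {l} → l ≢ i → lookup (pull (overwrite i j) x) l ≡ lookup x l
      off-i {l} l≢i = trans (lookup-pull (overwrite i j) x l) (cong (lookup x) (overwrite-miss j l≢i))
      by-cases : (d : Dec (lookup t i ≡ lookup t j)) →
        𝟙 (pull (overwrite i j) x ≟ᵗ t) ≈ 𝟙 d * 𝟙 (t [ i ]≔ lookup x i ≟ᵗ x)
      by-cases (no tᵢ≢tⱼ) = ≈-trans (𝟙-no (pull (overwrite i j) x ≟ᵗ t)
        (λ eq → tᵢ≢tⱼ (subst (λ t → lookup t i ≡ lookup t j) eq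
        (trans at-i (sym (off-i (i≢j ∘ sym))))))) (≈-sym (zeroˡ _))
      by-cases (yes tᵢ≡tⱼ) = ≈-trans (𝟙-⇔ (pull (overwrite i j) x ≟ᵗ t)
        (t [ i ]≔ lookup x i ≟ᵗ x) to from) (≈-sym (*-identityˡ _))
        where
        to : pull (overwrite i j) x ≡ t → t [ i ]≔ lookup x i ≡ x
        to refl = lookup-ext (λ l → at-l l (l Fin.≟ i))
          where
          at-l : ∀ l → Dec (l ≡ i) → lookup (pull (overwrite i j) x [ i ]≔ lookup x i) l ≡ lookup x l
          at-l l (yes refl) = Vec.lookup∘updateAt l (pull (overwrite i j) x)
          at-l l (no l≢i)   = trans (Vec.lookup∘updateAt′ l i l≢i (pull (overwrite i j) x)) (off-i l≢i)
        from : t [ i ]≔ lookup x i ≡ x → pull (overwrite i j) x ≡ t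
        from eq = lookup-ext (λ l → at-l l (l Fin.≟ i))
          where
          x≡t : ∀ {l} → l ≢ i → lookup x l ≡ lookup t l
          x≡t {l} l≢i = trans (cong (λ y → lookup y l) (sym eq)) (Vec.lookup∘updateAt′ l i l≢i t)
          at-l : ∀ l → Dec (l ≡ i) → lookup (pull (overwrite i j) x) l ≡ lookup t l
          at-l l (yes refl) = trans at-i (trans (x≡t (i≢j ∘ sym)) (sym tᵢ≡tⱼ))
          at-l l (no l≢i)   = trans (off-i l≢i) (x≡t l≢i)
    push-overwrite : ∀ h s t → push (overwrite i j) h s t ≈
      𝟙 (lookup t i Fin.≟ lookup t j) * ∑ₗ (allFin n) (λ w → h s (t [ i ]≔ w))
    push-overwrite h s t = begin
      ∑ₗ T (λ x → 𝟙 (pull (overwrite i j) x ≟ᵗ t) * h s x)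
        ≈⟨ ∑-cong T (λ x → ≈-trans (*-congʳ (hits t x))
          (≈-trans (*-assoc _ _ _) (*-congˡ (≈-sym (∑-*ʳ (allFin n) _ _))))) ⟩
      ∑ₗ T (λ x → 𝟙 (lookup t i Fin.≟ lookup t j) * ∑ₗ (allFin n) (λ w → 𝟙 (t [ i ]≔ w ≟ᵗ x) * h s x))
        ≈⟨ ∑-*ˡ T _ _ ⟩
      𝟙 (lookup t i Fin.≟ lookup t j) * ∑ₗ T (λ x → ∑ₗ (allFin n) (λ w → 𝟙 (t [ i ]≔ w ≟ᵗ x) * h s x))
        ≈⟨ *-congˡ (≈-trans (∑-swap T (allFin n) _) (∑-cong (allFin n) (λ w → ∑-𝟙-T (t [ i ]≔ w) (h s)))) ⟩
      𝟙 (lookup t i Fin.≟ lookup t j) * ∑ₗ (allFin n) (λ w → h s (t [ i ]≔ w))  ∎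

  admissible : ∀ f → Admissible f
  admissible = all-selfMaps Admissible Admissible-resp (λ {f} {g} → Admissible-∘ {f} {g}) Admissible-perm Admissible-overwrite

  Y : Bool → Bool → Tuple n K → Tuple n K → Carrier
  Y s t u v = 𝟙 ((s , u) ∼? (t , v)) * weight (s , u)

  nonNeg-Y : ∀ s t u v → NonNeg (Y s t u v)
  nonNeg-Y s t u v = nonNeg-𝟙* ((s , u) ∼? (t , v)) (nonNeg-weight _)

  Y≉0⇒∼ : ∀ {s t u v} → ¬ Y s t u v ≈ 0# → (s , u) ∼ (t , v)
  Y≉0⇒∼ Y≉0 = decidable-stable (_ ∼? _) (λ ¬u∼v → Y≉0 (𝟙*-no (_ ∼? _) ¬u∼v))

  Y-sym : ∀ s t u v → Y s t u v ≈ Y t s v u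
  Y-sym s t u v = ≈-trans (𝟙*-cong ((s , u) ∼? (t , v)) weight-cong) (*-congʳ (𝟙-∼-sym (s , u) (t , v)))

  ∑-Y : ∀ s t u → ∑ₗ T (Y s t u) ≈ 1#
  ∑-Y s t u = begin
    ∑ₗ T (λ v → 𝟙 ((s , u) ∼? (t , v)) * weight (s , u))  ≈⟨ ∑-*ʳ T _ _ ⟩
    ∑ₗ T (λ v → 𝟙 ((s , u) ∼? (t , v))) * weight (s , u)  ≈⟨ *-congʳ (size≈∑′ t (s , u)) ⟩
    cellSize (s , u) ×1 * weight (s , u)                  ≈⟨ *-comm _ _ ⟩
    weight (s , u) * cellSize (s , u) ×1                  ≈⟨ weight*size (s , u) ⟩
    1#                                                    ∎

  -- With `u′ = pull f u`, the fibre count `push f h t` vanishes off the cell of `u′`, is constant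
  -- on it by admissibility, and sums over it to the size of the cell of `u`. It is therefore a
  -- quotient of two cell sizes, which turns `weight (s , u)` into `weight (s , u′)`.
  marginal : ∀ f s t u w → ∑ₗ T (λ v → 𝟙 (pull f v ≟ᵗ w) * Y s t u v) ≈ Y s t (pull f u) w
  marginal f s t u w = begin
    ∑ₗ T (λ v → 𝟙 (pull f v ≟ᵗ w) * (h t v * weight (s , u)))
      ≈⟨ ≈-trans (∑-cong T (λ v → ≈-sym (*-assoc _ _ _))) (∑-*ʳ T _ _) ⟩
    push f h t w * weight (s , u)
      ≈⟨ by-cases ((s , pull f u) ∼? (t , w)) ⟩
    Y s t (pull f u) w ∎
    where
    h : Bool → Tuple n K → Carrier
    h t v = 𝟙 ((s , u) ∼? (t , v))
    h-inv : Invariant h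
    h-inv {s′} {t′} {v} {v′} v∼v′ = 𝟙-⇔ ((s , u) ∼? (s′ , v)) ((s , u) ∼? (t′ , v′))
      (λ p → ∼-trans p v∼v′) (λ p → ∼-trans p (∼-sym v∼v′))
    u′ = pull f u
    total : ∑ₗ T (λ w → 𝟙 ((s , u′) ∼? (t , w)) * push f h t w) ≈ cellSize (s , u) ×1
    total = begin
      ∑ₗ T (λ w → 𝟙 ((s , u′) ∼? (t , w)) * push f h t w)
        ≈⟨ ≈-trans (∑-cong T (λ w → ≈-sym (∑-*ˡ T _ _))) (∑-swap T T _) ⟩
      ∑ₗ T (λ x → ∑ₗ T (λ w → 𝟙 ((s , u′) ∼? (t , w)) * (𝟙 (pull f x ≟ᵗ w) * h t x)))
        ≈⟨ ∑-cong T (λ x → ≈-trans (∑-cong T (λ w → *-swapˡ _ _ _)) (∑-𝟙-T (pull f x) _)) ⟩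
      ∑ₗ T (λ x → 𝟙 ((s , u′) ∼? (t , pull f x)) * h t x)
        ≈⟨ ∑-cong T absorb ⟩
      ∑ₗ T (h t)
        ≈⟨ size≈∑′ t (s , u) ⟩
      cellSize (s , u) ×1 ∎
      where
      absorb : ∀ x → 𝟙 ((s , u′) ∼? (t , pull f x)) * h t x ≈ h t x
      absorb x = ≈-trans (*-comm _ _) (≈-trans
        (𝟙*-cong ((s , u) ∼? (t , x)) (λ u∼x → 𝟙-yes (_ ∼? _) (proj₁ (admissible f) u∼x))) (*-identityʳ _))
    by-cases : (d : Dec ((s , u′) ∼ (t , w))) → push f h t w * weight (s , u) ≈ 𝟙 d * weight (s , u′)
    by-cases (no u′≁w) = ≈-trans (*-congʳ (∑-zero T zeros)) (≈-trans (zeroˡ _) (≈-sym (zeroˡ _)))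
      where
      zeros : ∀ x → 𝟙 (pull f x ≟ᵗ w) * h t x ≈ 0#
      zeros x = ≈-trans (*-comm _ _) (≈-trans
        (𝟙*-cong ((s , u) ∼? (t , x)) (λ u∼x → 𝟙-no (pull f x ≟ᵗ w)
          (λ { refl → u′≁w (proj₁ (admissible f) u∼x) }))) (zeroʳ _))
    by-cases (yes u′∼w) = begin
      push f h t w * weight (s , u)   ≈⟨ *-comm _ _ ⟩
      weight (s , u) * push f h t w   ≈⟨ weight-cross (s , u′) (s , u) cross ⟩
      weight (s , u′) * 1#            ≈⟨ *-comm _ _ ⟩
      1# * weight (s , u′)            ∎
      where
      cross : cellSize (s , u′) ×1 * push f h t w ≈ cellSize (s , u) ×1 * 1#
      cross = begin
        cellSize (s , u′) ×1 * push f h t w                     ≈⟨ *-congʳ (size≈∑′ t (s , u′)) ⟨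
        ∑ₗ T (λ x → 𝟙 ((s , u′) ∼? (t , x))) * push f h t w     ≈⟨ ∑-*ʳ T _ _ ⟨
        ∑ₗ T (λ x → 𝟙 ((s , u′) ∼? (t , x)) * push f h t w)
          ≈⟨ ∑-cong T (λ x → 𝟙*-cong ((s , u′) ∼? (t , x)) (λ u′∼x →
               proj₂ (admissible f) h h-inv (∼-trans (∼-sym u′∼w) u′∼x))) ⟩
        ∑ₗ T (λ x → 𝟙 ((s , u′) ∼? (t , x)) * push f h t x)     ≈⟨ total ⟩
        cellSize (s , u) ×1                                     ≈⟨ *-identityʳ _ ⟨
        cellSize (s , u) ×1 * 1#                                ∎

  -- That `g` undoes `f` on `u` is a statement about the equality pattern of `u`, hence true on its
  -- whole cell. So `pull f` is injective there and the marginal has a single term.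
  Y-pull : ∀ f g s t u v → pull g (pull f u) ≡ u → pull g (pull f v) ≡ v →
           Y s t (pull f u) (pull f v) ≈ Y s t u v
  Y-pull f g s t u v gfu gfv = ≈-trans (≈-sym (marginal f s t u (pull f v))) (≈-trans
    (∑-single-T v off) (𝟙*-yes (pull f v ≟ᵗ pull f v) refl))
    where
    off : ∀ x → x ≢ v → 𝟙 (pull f x ≟ᵗ pull f v) * Y s t u x ≈ 0#
    off x x≢v = ≈-trans (𝟙*-cong (pull f x ≟ᵗ pull f v) (λ fx≡fv → 𝟙*-no (_ ∼? _)
      (λ u∼x → x≢v (trans (sym (gfx u∼x)) (trans (cong (pull g) fx≡fv) gfv))))) (zeroʳ _)
      where
      gfx : (s , u) ∼ (t , x) → pull g (pull f x) ≡ x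
      gfx u∼x = trans (pull-∘ f g x) (lookup-ext λ i → trans (lookup-pull (λ j → f (g j)) x i)
        (pattern≡ u∼x (f (g i)) i (trans (sym (lookup-pull (f ∘ g) u i))
          (cong (λ y → lookup y i) (trans (sym (pull-∘ f g u)) gfu)))))

-- One element is split off per slot, and the last one is repeated over the slots that remain; the
-- repetition is why `S` has to be nonempty.
represent : ∀ m (S : Subset (n ℕ.* n)) → Nonempty S → ∣ S ∣ ≤ m →
            Σ (Vec (Fin n) m) λ u → Σ (Vec (Fin n) m) λ v → img u v ≡ S
represent zero S (x , x∈S) S≤0 =
  contradiction (ℕ.<-≤-trans (x∈p⇒∣p-x∣<∣p∣ x∈S) S≤0) ℕ.n≮0
represent {n} (suc m) S (x , x∈S) S≤m = extend (nonempty? (S Subset.- x))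
  where
  a b : Fin n
  a = quotient n x
  b = remainder {n} n x
  x≡ : at a b ≡ x
  x≡ = Fin.combine-remQuot {n} n x
  other : ∀ {y} → y ∈ₛ S → y ≡ x ⊎ y ∈ₛ (S Subset.- x)
  other {y} y∈S with y Fin.≟ x
  ... | yes y≡x = inj₁ y≡x
  ... | no y≢x  = inj₂ (x∈p∧x≢y⇒x∈p-y y∈S y≢x)
  extend : Dec (Nonempty (S Subset.- x)) →
           Σ (Vec (Fin n) (suc m)) λ u → Σ (Vec (Fin n) (suc m)) λ v → img u v ≡ S
  extend (yes ne)
    with u , v , eq ← represent {n} m (S Subset.- x) ne (ℕ.≤-pred (ℕ.≤-trans (x∈p⇒∣p-x∣<∣p∣ x∈S) S≤m)) =
    a ∷ u , b ∷ v , ⊆-antisym to from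
    where
    to : img (a ∷ u) (b ∷ v) ⊆ S
    to y∈ with x∈p∪q⁻ (pair a b) (img u v) y∈
    ... | inj₁ y∈₁ = subst (_∈ₛ S) (sym (trans (x∈⁅y⁆⇒x≡y _ y∈₁) x≡)) x∈S
    ... | inj₂ y∈₂ = p─q⊆p S ⁅ x ⁆ (subst (_ ∈ₛ_) eq y∈₂)
    from : S ⊆ img (a ∷ u) (b ∷ v)
    from y∈ with other y∈
    ... | inj₁ refl = x∈p∪q⁺ (inj₁ (subst (λ z → x ∈ₛ ⁅ z ⁆) (sym x≡) (x∈⁅x⁆ x)))
    ... | inj₂ y∈₂  = x∈p∪q⁺ (inj₂ (subst (_ ∈ₛ_) (sym eq) y∈₂))
  extend (no em) = as , bs , ⊆-antisym to from
    where
    as bs : Vec (Fin n) (suc m)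
    as = Vec.replicate (suc m) a
    bs = Vec.replicate (suc m) b
    to : img as bs ⊆ S
    to y∈ with i , eq ← ∈-img⁻ as bs y∈ = subst (_∈ₛ S)
      (sym (trans eq (trans (cong₂ at (Vec.lookup-replicate i a) (Vec.lookup-replicate i b)) x≡))) x∈S
    from : S ⊆ img as bs
    from y∈ with other y∈
    ... | inj₁ refl = subst (_∈ₛ img as bs) x≡ (∈-img⁺ as bs zero)
    ... | inj₂ y∈₂  = contradiction (_ , y∈₂) em

-- Containment of monomials becomes reindexing. The map need be neither injective nor surjective,
-- which is why permutations of the slots are not enough.
img-⊆⇒pull : ∀ {l} (u v : Vec (Fin n) m) (u′ v′ : Vec (Fin n) l) → img u′ v′ ⊆ img u v →
             ∃[ f ] u′ ≡ pull f u × v′ ≡ pull f v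
img-⊆⇒pull u v u′ v′ sub = proj₁ ∘ find
  , lookup-ext (λ i → trans (proj₁ (proj₂ (find i))) (sym (lookup-pull (proj₁ ∘ find) u i)))
  , lookup-ext (λ i → trans (proj₂ (proj₂ (find i))) (sym (lookup-pull (proj₁ ∘ find) v i)))
  where
  find : ∀ i → ∃[ j ] lookup u′ i ≡ lookup u j × lookup v′ i ≡ lookup v j
  find i = ∈-img-lookup u v (sub (∈-img⁺ u′ v′ i))

-- Separates two treatments of the empty monomial: for `k = 0` it is the image of the empty tuples,
-- otherwise there is room for an auxiliary variable.
fin-or-⊥ : ∀ n k → Fin k ⊎ (Σ (Vec (Fin n) k) λ u → Σ (Vec (Fin n) k) λ v → img u v ≡ ⊥)
fin-or-⊥ n zero    = inj₂ ([] , [] , refl)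
fin-or-⊥ n (suc k) = inj₁ zero

-- On subsets of J, ψ is the moment functional of a weighted family of 0/1 points.
record Sampled (R : OrderedRing) {N : ℕ} (J : Subset N) (ψ : Subset N → OrderedRing.Carrier R) : Set where
  open Sums R
  field
    samples     : List (Carrier × Subset N)
    nonNegative : ∀ {s} → s ∈ samples → NonNeg (proj₁ s)
    represents  : ∀ {L} → L ⊆ J → ψ L ≈ ∑ₗ samples (λ (w , ω) → w * 𝟙 (L ⊆? ω))

module Backward (R : OrderedRing) {n k : ℕ} {σ₁ σ₂ : Permutation′ (suc k)}
  (gen : GeneratesSymmetricGroup σ₁ σ₂) {Γ : Bool → Graph n}
  {π : Partition (Bool × Tuple n (suc k))} (stable : Stable σ₁ σ₂ Γ π) where

  open Sums R
  open Partition π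
  open Stable stable
  open Transport R gen stable

  -- This is the marginal along the map copying entry `j` of the tail into slot zero: its fibre over
  -- `lookup v j ∷ v` consists of the tuples `w ∷ v`, and on the left it erases `a`.
  row-Y : ∀ s t (j : Fin k) (u v : Tuple n k) a →
          ∑ₗ (allFin n) (λ w → Y s t (a ∷ u) (w ∷ v)) ≈ Y s t (lookup u j ∷ u) (lookup v j ∷ v)
  row-Y s t j u v a = begin
    ∑ₗ (allFin n) (λ w → Y s t (a ∷ u) (w ∷ v))
      ≈⟨ ∑-cong (allFin n) (λ w → 𝟙*-yes (pull f (w ∷ v) ≟ᵗ vⱼ∷v) (pull-overwrite zero (suc j) (w ∷ v))) ⟨
    ∑ₗ (allFin n) (λ w → 𝟙 (pull f (w ∷ v) ≟ᵗ vⱼ∷v) * Y s t (a ∷ u) (w ∷ v))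
      ≈⟨ ∑-support (_∷ v) Vec.∷-injectiveˡ (λ x → 𝟙 (pull f x ≟ᵗ vⱼ∷v) * Y s t (a ∷ u) x) supp ⟨
    ∑ₗ T (λ x → 𝟙 (pull f x ≟ᵗ vⱼ∷v) * Y s t (a ∷ u) x)
      ≈⟨ marginal f s t (a ∷ u) vⱼ∷v ⟩
    Y s t (pull f (a ∷ u)) vⱼ∷v
      ≡⟨ cong (λ x → Y s t x vⱼ∷v) (pull-overwrite zero (suc j) (a ∷ u)) ⟩
    Y s t (lookup u j ∷ u) vⱼ∷v  ∎
    where
    f : Fin K → Fin K
    f = overwrite zero (suc j)
    vⱼ∷v : Tuple n K
    vⱼ∷v = lookup v j ∷ v
    supp : ∀ x → ¬ 𝟙 (pull f x ≟ᵗ vⱼ∷v) * Y s t (a ∷ u) x ≈ 0# → ∃[ w ] x ≡ w ∷ v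
    supp (x ∷ x′) ≉0 = x , cong (x ∷_) (Vec.∷-injectiveʳ (trans (sym (pull-overwrite zero (suc j) (x ∷ x′)))
      (decidable-stable (pull f (x ∷ x′) ≟ᵗ vⱼ∷v) (λ ¬eq → ≉0 (𝟙*-no (pull f (x ∷ x′) ≟ᵗ vⱼ∷v) ¬eq)))))

  diagonal : Fin n → Tuple n K
  diagonal = Vec.replicate K

  -- Tuples of the same colour have the same equality pattern, so only constant tuples contribute to
  -- the full sum of `Y`. This covers the empty monomial, where `row-Y` has no entry to copy.
  row-diagonal : ∀ s t a → ∑ₗ (allFin n) (λ w → Y s t (diagonal a) (diagonal w)) ≈ 1#
  row-diagonal s t a = ≈-trans (≈-sym (∑-support diagonal Vec.∷-injectiveˡ (Y s t (diagonal a)) supp))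
    (∑-Y s t (diagonal a))
    where
    supp : ∀ v → ¬ Y s t (diagonal a) v ≈ 0# → ∃[ w ] v ≡ diagonal w
    supp v ≉0 = lookup v zero , lookup-ext (λ i → trans
      (pattern≡ (Y≉0⇒∼ ≉0) i zero (Vec.lookup-replicate i a)) (sym (Vec.lookup-replicate i (lookup v zero))))

  -- Both sides count, up to normalisation, the pairs (x , y) in the cells of a ∷ u and
  -- b ∷ v such that y arises from x by moving the first entry along an edge.
  commute-Y : ∀ s t (u v : Tuple n k) a b →
    ∑ₗ (allFin n) (λ w → 𝟙 (adj (Γ s) a w Bool.≟ true) * Y s t (w ∷ u) (b ∷ v)) ≈
    ∑ₗ (allFin n) (λ w → Y s t (a ∷ u) (w ∷ v) * 𝟙 (adj (Γ t) w b Bool.≟ true))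
  commute-Y s t u v a b = begin
    ∑ₗ (allFin n) (λ w → 𝟙 (adj (Γ s) a w Bool.≟ true) * Y s t (w ∷ u) (b ∷ v))
      ≈⟨ ∑-cong (allFin n) (λ w → ≈-trans
           (*-congˡ (𝟙*-cong ((s , w ∷ u) ∼? y) weight-cong)) (≈-sym (*-assoc _ _ _))) ⟩
    ∑ₗ (allFin n) (λ w → 𝟙 (adj (Γ s) a w Bool.≟ true) * 𝟙 ((s , w ∷ u) ∼? y) * weight y)
      ≈⟨ ∑-*ʳ (allFin n) _ _ ⟩
    degree s (a ∷ u) y * weight y   ≈⟨ *-comm _ _ ⟩
    weight y * degree s (a ∷ u) y   ≈⟨ weight-cross x y double-count ⟩
    weight x * degree t (b ∷ v) x   ≈⟨ *-comm _ _ ⟩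
    degree t (b ∷ v) x * weight x
      ≈⟨ ∑-*ʳ (allFin n) _ _ ⟨
    ∑ₗ (allFin n) (λ w → 𝟙 (adj (Γ t) b w Bool.≟ true) * 𝟙 ((t , w ∷ v) ∼? x) * weight x)
      ≈⟨ ∑-cong (allFin n) (λ w → ≈-trans (*-assoc _ _ _) (≈-trans (*-comm _ _)
           (*-cong (*-congʳ (𝟙-∼-sym (t , w ∷ v) x))
             (reflexive (cong (λ α → 𝟙 (α Bool.≟ true)) (symmetric (Γ t) b w)))))) ⟩
    ∑ₗ (allFin n) (λ w → Y s t (a ∷ u) (w ∷ v) * 𝟙 (adj (Γ t) w b Bool.≟ true))  ∎
    where
    x y : Bool × Tuple n K
    x = s , a ∷ u
    y = t , b ∷ v
    degree : Bool → Tuple n K → Bool × Tuple n K → Carrier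
    degree s x z = ∑ₗ (allFin n) (λ w → 𝟙 (adj (Γ s) (lookup x zero) w Bool.≟ true) * 𝟙
      ((s , x [ zero ]≔ w) ∼? z))
    degree-cong : ∀ {s t x x′} z → (s , x) ∼ (t , x′) → degree s x z ≈ degree t x′ z
    degree-cong z x∼x′ = neighbour-sum (λ s x → 𝟙 ((s , x) ∼? z)) (∼-invariant z) x∼x′ true zero
    -- The sum runs over tuples of side `s` while the representative of the cell lies on side `t`;
    -- `degree-cong` carries the degree across.
    sum-degrees : ∀ z t x′ z′ → z ≡ (t , x′) →
      ∑ₗ T (λ x → 𝟙 ((s , x) ∼? z) * degree s x z′) ≈ cellSize z ×1 * degree t x′ z′
    sum-degrees .(t , x′) t x′ z′ refl = begin
      ∑ₗ T (λ x → 𝟙 ((s , x) ∼? (t , x′)) * degree s x z′)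
        ≈⟨ ∑-cong T (λ x → 𝟙*-cong ((s , x) ∼? (t , x′)) (degree-cong z′)) ⟩
      ∑ₗ T (λ x → 𝟙 ((s , x) ∼? (t , x′)) * degree t x′ z′)  ≈⟨ ∑-*ʳ T _ _ ⟩
      ∑ₗ T (λ x → 𝟙 ((s , x) ∼? (t , x′))) * degree t x′ z′  ≈⟨ *-congʳ (size≈∑ s (t , x′)) ⟩
      cellSize (t , x′) ×1 * degree t x′ z′                  ∎
    edges : Bool × Tuple n K → Bool × Tuple n K → Fin n → Fin n → Tuple n k → Carrier
    edges z z′ c d e = 𝟙 ((s , c ∷ e) ∼? z) * (𝟙 (adj (Γ s) c d Bool.≟ true) * 𝟙 ((s , d ∷ e) ∼? z′))
    unfold : ∀ z z′ → ∑ₗ T (λ x → 𝟙 ((s , x) ∼? z) * degree s x z′) ≈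
      ∑ₗ (allFin n) (λ c → ∑ₗ (allFin n) (λ d → ∑ₗ (tuples n k) (edges z z′ c d)))
    unfold z z′ = ≈-trans (∑-product _∷_ (allFin n) (tuples n k) _)
      (∑-cong (allFin n) (λ c → ≈-trans
        (∑-cong (tuples n k) (λ e → ≈-sym (∑-*ˡ (allFin n) _ _))) (∑-swap (tuples n k) (allFin n) _)))
    -- Both sides become sums over tuples of the one side `s`, so the reversal of an edge stays
    -- within a single graph.
    double-count : cellSize x ×1 * degree s (a ∷ u) y ≈ cellSize y ×1 * degree t (b ∷ v) x
    double-count = begin
      cellSize x ×1 * degree s (a ∷ u) y                 ≈⟨ sum-degrees x s (a ∷ u) y refl ⟨
      ∑ₗ T (λ z → 𝟙 ((s , z) ∼? x) * degree s z y)        ≈⟨ unfold x y ⟩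
      ∑ₗ (allFin n) (λ c → ∑ₗ (allFin n) (λ d → ∑ₗ (tuples n k) (edges x y c d)))
        ≈⟨ ∑-swap (allFin n) (allFin n) _ ⟩
      ∑ₗ (allFin n) (λ d → ∑ₗ (allFin n) (λ c → ∑ₗ (tuples n k) (edges x y c d)))
        ≈⟨ ∑-cong (allFin n) (λ d → ∑-cong (allFin n) (λ c → ∑-cong (tuples n k) (λ e → reverse c d e))) ⟩
      ∑ₗ (allFin n) (λ d → ∑ₗ (allFin n) (λ c → ∑ₗ (tuples n k) (edges y x d c)))
        ≈⟨ unfold y x ⟨
      ∑ₗ T (λ z → 𝟙 ((s , z) ∼? y) * degree s z x)        ≈⟨ sum-degrees y t (b ∷ v) x refl ⟩
      cellSize y ×1 * degree t (b ∷ v) x                 ∎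
      where
      reverse : ∀ c d e → edges x y c d e ≈ edges y x d c e
      reverse c d e = ≈-trans (*-congˡ (*-comm _ _)) (≈-trans (*-swapˡ _ _ _) (*-congˡ (≈-trans (*-comm _ _)
        (*-congʳ (reflexive (cong (λ α → 𝟙 (α Bool.≟ true)) (symmetric (Γ s) c d)))))))

  -- Two descriptions of the same set of pairs are reindexings of each other, so `Y-pull` compares
  -- them: `Y` depends on the monomial alone.
  Y-img : ∀ s t (u v u′ v′ : Tuple n K) → img u v ≡ img u′ v′ → Y s t u v ≈ Y s t u′ v′
  Y-img s t u v u′ v′ eq
    with f , refl , refl ← img-⊆⇒pull u v u′ v′ (⊆-reflexive (sym eq))
       | g , u≡ , v≡ ← img-⊆⇒pull u′ v′ u v (⊆-reflexive eq) =
    ≈-sym (Y-pull f g s t u v (sym u≡) (sym v≡))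

  opaque
    -- φ S is irrelevant for |S| > K.
    φ : Subset (n ℕ.* n) → Carrier
    φ S = value (nonempty? S) (∣ S ∣ ℕ.≤? K)
      where
      value : Dec (Nonempty S) → Dec (∣ S ∣ ≤ K) → Carrier
      value (no _)   _        = 1#
      value (yes ne) (yes S≤) = let u , v , _ = represent {n} K S ne S≤ in Y true false u v
      value (yes _)  (no _)   = 0#

    φ-empty : ∀ {S} → ¬ Nonempty S → φ S ≈ 1#
    φ-empty {S} em with nonempty? S
    ... | yes ne = contradiction ne em
    ... | no _   = ≈-refl

    φ-img : ∀ u v {S} → img u v ≡ S → φ S ≈ Y true false u v
    φ-img u v refl with nonempty? (img u v) | ∣ img u v ∣ ℕ.≤? K
    ... | yes ne | yes S≤ = Y-img true false _ _ u v (proj₂ (proj₂ (represent {n} K (img u v) ne S≤)))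
    ... | yes _  | no S≰  = contradiction (∣img∣≤ u v) S≰
    ... | no em  | _      = contradiction (_ , ∈-img⁺ u v zero) em

    nonNeg-φ : ∀ S → NonNeg (φ S)
    nonNeg-φ S with nonempty? S | ∣ S ∣ ℕ.≤? K
    ... | yes _  | yes _ = nonNeg-Y true false _ _
    ... | yes _  | no _  = nonNeg-0
    ... | no _   | _     = nonNeg-1

  φ-fill : ∀ (u v : Tuple n k) a b {S} → img u v ≡ S → φ (S ∪ pair a b) ≈ Y true false (a ∷ u) (b ∷ v)
  φ-fill u v a b {S} eq = φ-img (a ∷ u) (b ∷ v) (trans (cong (pair a b ∪_) eq) (∪-comm (pair a b) S))

  -- Repeating a pair fills the free slot without changing the monomial; this is the form in which
  -- `row-Y` delivers its sum.
  φ-double : ∀ (j : Fin k) (u v : Tuple n k) {S} → img u v ≡ S →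
             φ S ≈ Y true false (lookup u j ∷ u) (lookup v j ∷ v)
  φ-double j u v refl = φ-img (lookup u j ∷ u) (lookup v j ∷ v)
    (trans (∪-comm (pair (lookup u j) (lookup v j)) (img u v)) (∪-absorb (∈-img⁺ u v j)))

  φ-pair : ∀ a b {S} → ¬ Nonempty S → φ (S ∪ pair a b) ≈ Y true false (diagonal a) (diagonal b)
  φ-pair a b {S} em = φ-img (diagonal a) (diagonal b) (⊆-antisym to from)
    where
    to : img (diagonal a) (diagonal b) ⊆ S ∪ pair a b
    to x∈ with i , eq ← ∈-img⁻ (diagonal a) (diagonal b) x∈ = x∈p∪q⁺ (inj₂ (subst (_∈ₛ pair a b)
      (sym (trans eq (cong₂ at (Vec.lookup-replicate i a) (Vec.lookup-replicate i b)))) (x∈⁅x⁆ _)))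
    from : S ∪ pair a b ⊆ img (diagonal a) (diagonal b)
    from x∈ with x∈p∪q⁻ S (pair a b) x∈
    ... | inj₁ x∈S = contradiction (_ , x∈S) em
    ... | inj₂ x∈ab = subst (_∈ₛ img (diagonal a) (diagonal b)) (sym (x∈⁅y⁆⇒x≡y _ x∈ab))
                        (∈-img⁺ (diagonal a) (diagonal b) zero)

  slotOf : ∀ (u v : Tuple n k) {S} → img u v ≡ S → Nonempty S → Fin k
  slotOf u v refl (x , x∈) = proj₁ (∈-img⁻ u v x∈)

  φ-row : ∀ S → ∣ S ∣ ≤ k → ∀ (a : Fin n) → ∑ₗ (allFin n) (λ w → φ (S ∪ pair a w)) ≈ φ S
  φ-row S S≤ a with nonempty? S
  ... | no em = ≈-trans (∑-cong (allFin n) (λ w → φ-pair a w em))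
                  (≈-trans (row-diagonal true false a) (≈-sym (φ-empty em)))
  ... | yes ne with u , v , eq ← represent {n} k S ne S≤ = begin
    ∑ₗ (allFin n) (λ w → φ (S ∪ pair a w))                     ≈⟨ ∑-cong (allFin n) (λ w → φ-fill u v a w eq) ⟩
    ∑ₗ (allFin n) (λ w → Y true false (a ∷ u) (w ∷ v))          ≈⟨ row-Y true false j u v a ⟩
    Y true false (lookup u j ∷ u) (lookup v j ∷ v)             ≈⟨ φ-double j u v eq ⟨
    φ S                                                        ∎
    where j = slotOf u v eq ne

  φ-column : ∀ S → ∣ S ∣ ≤ k → ∀ (b : Fin n) → ∑ₗ (allFin n) (λ w → φ (S ∪ pair w b)) ≈ φ S
  φ-column S S≤ b with nonempty? S
  ... | no em = ≈-trans (∑-cong (allFin n) (λ w → ≈-trans (φ-pair w b em) (Y-sym true false _ _)))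
                  (≈-trans (row-diagonal false true b) (≈-sym (φ-empty em)))
  ... | yes ne with u , v , eq ← represent {n} k S ne S≤ = begin
    ∑ₗ (allFin n) (λ w → φ (S ∪ pair w b))
      ≈⟨ ∑-cong (allFin n) (λ w → ≈-trans (φ-fill u v w b eq) (Y-sym true false (w ∷ u) (b ∷ v))) ⟩
    ∑ₗ (allFin n) (λ w → Y false true (b ∷ v) (w ∷ u))          ≈⟨ row-Y false true j v u b ⟩
    Y false true (lookup v j ∷ v) (lookup u j ∷ u)             ≈⟨ Y-sym true false (lookup u j ∷ u)
      (lookup v j ∷ v) ⟨
    Y true false (lookup u j ∷ u) (lookup v j ∷ v)             ≈⟨ φ-double j u v eq ⟨
    φ S                                                        ∎
    where j = slotOf u v eq ne

  Commutes : Subset (n ℕ.* n) → Set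
  Commutes S = ∀ a b →
    ∑ₗ (allFin n) (λ w → 𝟙 (adj (Γ true) a w Bool.≟ true) * φ (S ∪ pair w b)) ≈
    ∑ₗ (allFin n) (λ w → φ (S ∪ pair a w) * 𝟙 (adj (Γ false) w b Bool.≟ true))

  commutes-img : ∀ (u v : Tuple n k) {S} → img u v ≡ S → Commutes S
  commutes-img u v eq a b = ≈-trans (∑-cong (allFin n) (λ w → *-congˡ (φ-fill u v w b eq)))
    (≈-trans (commute-Y true false u v a b) (≈-sym (∑-cong (allFin n) (λ w → *-congʳ (φ-fill u v a w eq)))))

  commutes-nonempty : ∀ S → ∣ S ∣ ≤ k → Nonempty S → Commutes S
  commutes-nonempty S S≤ ne with u , v , eq ← represent {n} k S ne S≤ = commutes-img u v eq

  -- For the empty monomial when k ≥ 1, first spread the equation over the row a.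
  commutes-⊥ : 1 ≤ k → Commutes ⊥
  commutes-⊥ 1≤k a b = begin
    ∑ₗ (allFin n) (λ w → edgeG w * φ (⊥ ∪ pair w b))
      ≈⟨ ∑-cong (allFin n) (λ w → *-congˡ (reflexive (cong φ (∪-identityˡ (pair w b))))) ⟩
    ∑ₗ (allFin n) (λ w → edgeG w * φ (pair w b))
      ≈⟨ ∑-cong (allFin n) (λ w → ≈-trans (*-congˡ (≈-sym (φ-row (pair w b) (small w b) a)))
        (≈-sym (∑-*ˡ (allFin n) _ _))) ⟩
    ∑ₗ (allFin n) (λ w → ∑ₗ (allFin n) (λ d → edgeG w * φ (pair w b ∪ pair a d)))
      ≈⟨ ∑-swap (allFin n) (allFin n) _ ⟩
    ∑ₗ (allFin n) (λ d → ∑ₗ (allFin n) (λ w → edgeG w * φ (pair w b ∪ pair a d)))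
      ≈⟨ ∑-cong (allFin n) (λ d → ≈-trans
           (∑-cong (allFin n) (λ w → *-congˡ (reflexive (cong φ (∪-comm (pair w b) (pair a d))))))
           (commutes-nonempty (pair a d) (small a d) (at a d , x∈⁅x⁆ _) a b)) ⟩
    ∑ₗ (allFin n) (λ d → ∑ₗ (allFin n) (λ w → φ (pair a d ∪ pair a w) * edgeH w))
      ≈⟨ ∑-swap (allFin n) (allFin n) _ ⟩
    ∑ₗ (allFin n) (λ w → ∑ₗ (allFin n) (λ d → φ (pair a d ∪ pair a w) * edgeH w))
      ≈⟨ ∑-cong (allFin n) (λ w → ≈-trans (∑-*ʳ (allFin n) _ _) (*-congʳ (≈-trans
           (∑-cong (allFin n) (λ d → reflexive (cong φ (∪-comm (pair a d) (pair a w)))))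
           (φ-row (pair a w) (small a w) a)))) ⟩
    ∑ₗ (allFin n) (λ w → φ (pair a w) * edgeH w)
      ≈⟨ ∑-cong (allFin n) (λ w → *-congʳ (reflexive (cong φ (sym (∪-identityˡ (pair a w)))))) ⟩
    ∑ₗ (allFin n) (λ w → φ (⊥ ∪ pair a w) * edgeH w)  ∎
    where
    edgeG edgeH : Fin n → Carrier
    edgeG w = 𝟙 (adj (Γ true) a w Bool.≟ true)
    edgeH w = 𝟙 (adj (Γ false) w b Bool.≟ true)
    small : ∀ (c d : Fin n) → ∣ pair c d ∣ ≤ k
    small c d = ℕ.≤-trans (ℕ.≤-reflexive (∣⁅x⁆∣≡1 (at c d))) 1≤k

  φ-commute : ∀ S → ∣ S ∣ ≤ k → Commutes S
  φ-commute S S≤ with nonempty? S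
  ... | yes ne = commutes-nonempty S S≤ ne
  ... | no em with refl ← Empty-unique em | fin-or-⊥ n k
  ...   | inj₁ j            = commutes-⊥ (ℕ.≤-trans (s≤s z≤n) (Fin.toℕ<n j))
  ...   | inj₂ (u , v , eq) = commutes-img u v eq

  system : System R k (Γ true) (Γ false) φ
  system = record
    { φ⊥≈1    = φ-empty (λ (_ , x∈⊥) → ∉⊥ x∈⊥)
    ; row     = φ-row
    ; column  = φ-column
    ; commute = φ-commute
    ; nonNeg  = λ S _ → nonNeg-φ S
    }

  φ-single : ∀ a b → φ (pair a b) ≈ Y true false (diagonal a) (diagonal b)
  φ-single a b = ≈-trans (reflexive (cong φ (sym (∪-identityˡ (pair a b))))) (φ-pair a b (λ (_ , x∈⊥) → ∉⊥ x∈⊥))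

  -- The constant self-map with value `i` carries the relation to constant tuples, where `Y` is the
  -- weight of a cell. A weight has nonzero product with the cell size.
  ∼⇒φ≉0 : ∀ {u v} → (true , u) ∼ (false , v) → ∀ i → ¬ φ (pair (lookup u i) (lookup v i)) ≈ 0#
  ∼⇒φ≉0 {u} {v} u∼v i φ≈0 = 1≉0 (begin
    1#                                                        ≈⟨ weight*size _ ⟨
    weight (true , u′) * cellSize (true , u′) ×1              ≈⟨ *-congʳ
      (𝟙*-yes ((true , u′) ∼? (false , v′)) u′∼v′) ⟨
    Y true false u′ v′ * cellSize (true , u′) ×1              ≈⟨ *-congʳ (≈-trans (≈-sym (φ-single _ _)) φ≈0) ⟩
    0# * cellSize (true , u′) ×1                              ≈⟨ zeroˡ _ ⟩
    0#                                                        ∎)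
    where
    u′ v′ : Tuple n K
    u′ = diagonal (lookup u i)
    v′ = diagonal (lookup v i)
    constant : ∀ u → pull {k = K} (λ _ → i) u ≡ diagonal (lookup u i)
    constant u = lookup-ext (λ j → trans (lookup-pull (λ _ → i) u j)
      (sym (Vec.lookup-replicate j (lookup u i))))
    u′∼v′ : (true , u′) ∼ (false , v′)
    u′∼v′ = subst₂ (λ x y → (true , x) ∼ (false , y)) (constant u) (constant v)
      (proj₁ (admissible (λ _ → i)) u∼v)

  -- For `J = img u v` the samples are the sets `img u x` with weight `Y true false u x`. If `L` is
  -- the part of `J` selected by `f`, then for `x` of the colour of `u` the sample contains `L`
  -- exactly when `pull f x ≡ pull f v`, an event whose probability is given by `marginal`.
  sampled : ∀ J → ∣ J ∣ ≤ K → Sampled R J φ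
  sampled J J≤ with nonempty? J
  ... | no em = record
    -- No pair of nonempty tuples represents the empty set; its only moment is 1, realised by the
    -- zero point with weight 1.
    { samples = (1# , ⊥) ∷ [] ; nonNegative = λ { (here refl) → nonNeg-1 }
    ; represents = λ {L} L⊆J → ≈-trans (φ-empty (λ (x , x∈) → em (x , L⊆J x∈)))
        (≈-sym (≈-trans (+-identityʳ _) (≈-trans (*-identityˡ _)
          (𝟙-yes (L ⊆? ⊥) (λ x∈L → contradiction (_ , L⊆J x∈L) em))))) }
  ... | yes ne with u , v , refl ← represent {n} K J ne J≤ = record
    { samples = List.map (λ x → Y true false u x , img u x) T
    ; nonNegative = λ s∈ → let x , _ , eq = ∈-map⁻ _ s∈ in
        subst (λ s → NonNeg (proj₁ s)) (sym eq) (nonNeg-Y true false u x)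
    ; represents = λ {L} L⊆J → ≈-trans (expectation L L⊆J) (≈-sym (∑-map _ T _)) }
    where
    expectation : ∀ L → L ⊆ img u v → φ L ≈ ∑ₗ T (λ x → Y true false u x * 𝟙 (L ⊆? img u x))
    expectation L L⊆ with nonempty? L
    ... | no em = ≈-trans (φ-empty em) (≈-trans (≈-sym (∑-Y true false u)) (∑-cong T (λ x → ≈-sym
      (≈-trans (*-congˡ (𝟙-yes (L ⊆? img u x) (λ y∈ → contradiction (_ , y∈) em))) (*-identityʳ _)))))
    ... | yes ne′
      with u′ , v′ , refl ← represent {n} K L ne′ (ℕ.≤-trans (p⊆q⇒∣p∣≤∣q∣ L⊆) J≤)
      with f , refl , refl ← img-⊆⇒pull u v u′ v′ L⊆ = begin
      φ (img (pull f u) (pull f v))       ≈⟨ φ-img (pull f u) (pull f v) refl ⟩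
      Y true false (pull f u) (pull f v)  ≈⟨ marginal f true false u (pull f v) ⟨
      ∑ₗ T (λ x → 𝟙 (pull f x ≟ᵗ pull f v) * Y true false u x)
        ≈⟨ ∑-cong T (λ x → ≈-trans (*-comm _ _) (same x)) ⟩
      ∑ₗ T (λ x → Y true false u x * 𝟙 (img (pull f u) (pull f v) ⊆? img u x))  ∎
      where
      same : ∀ x → Y true false u x * 𝟙 (pull f x ≟ᵗ pull f v) ≈
                   Y true false u x * 𝟙 (img (pull f u) (pull f v) ⊆? img u x)
      same x = ≈-trans (*-assoc _ _ _) (≈-trans (𝟙*-cong ((true , u) ∼? (false , x)) (λ u∼x → *-congˡ
        (𝟙-⇔ (pull f x ≟ᵗ pull f v) (img (pull f u) (pull f v) ⊆? img u x) to (from u∼x))))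
          (≈-sym (*-assoc _ _ _)))
        where
        to : pull f x ≡ pull f v → img (pull f u) (pull f v) ⊆ img u x
        to eq y∈ with i , refl ← ∈-img⁻ (pull f u) (pull f v) y∈ = subst₂ (λ (a b : Fin n) → at a b ∈ₛ img u x)
          (sym (lookup-pull f u i))
          (trans (sym (lookup-pull f x i)) (cong (λ t → lookup t i) eq))
          (∈-img⁺ u x (f i))
        -- Containment places each pair of `L` in some slot `j` of `img u x`; the equality pattern
        -- shared by `u` and `x` identifies that slot with `f i`.
        from : (true , u) ∼ (false , x) → img (pull f u) (pull f v) ⊆ img u x → pull f x ≡ pull f v
        from u∼x sub = lookup-ext (λ i → entry≡ i (∈-img-lookup u x (sub (∈-img⁺ (pull f u) (pull f v) i))))
          where
          entry≡ : ∀ i → (∃[ j ] lookup (pull f u) i ≡ lookup u j × lookup (pull f v) i ≡ lookup x j) →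
                   lookup (pull f x) i ≡ lookup (pull f v) i
          entry≡ i (j , u′ᵢ≡uⱼ , v′ᵢ≡xⱼ) = trans (lookup-pull f x i) (trans
            (pattern≡ u∼x (f i) j (trans (sym (lookup-pull f u i)) u′ᵢ≡uⱼ)) (sym v′ᵢ≡xⱼ))

-- The real numbers as an ordered ring

private
  ℚ-ring : AlmostCommutativeRing 0ℓ 0ℓ
  ℚ-ring = fromCommutativeRing ℚ.+-*-commutativeRing (λ q → dec⇒maybe (0ℚ ℚ.≟ q))

  half-positive : ∀ {ε} → 0ℚ ℚ.< ε → 0ℚ ℚ.< ½ ℚ.* ε
  half-positive {ε} 0<ε = subst (ℚ._< ½ ℚ.* ε) (ℚ.*-zeroʳ ½) (ℚ.*-monoʳ-<-pos ½ 0<ε)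

  halves : ∀ ε → ½ ℚ.* ε ℚ.+ ½ ℚ.* ε ≡ ε
  halves ε = trans (sym (ℚ.*-distribʳ-+ ε ½ ½)) (ℚ.*-identityˡ ε)

  ∣-∣<-halves : ∀ {a b ε} → ℚ.∣ a ∣ ℚ.< ½ ℚ.* ε → ℚ.∣ b ∣ ℚ.< ½ ℚ.* ε → ℚ.∣ a ℚ.+ b ∣ ℚ.< ε
  ∣-∣<-halves {a} {b} {ε} p q = ℚ.≤-<-trans (ℚ.∣p+q∣≤∣p∣+∣q∣ a b)
    (subst (ℚ.∣ a ∣ ℚ.+ ℚ.∣ b ∣ ℚ.<_) (halves ε) (ℚ.+-mono-< p q))

  <-neg-<⇒∣-∣< : ∀ {a ε} → a ℚ.< ε → ℚ.- a ℚ.< ε → ℚ.∣ a ∣ ℚ.< ε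
  <-neg-<⇒∣-∣< {a} {ε} p q with ℚ.∣p∣≡p∨∣p∣≡-p a
  ... | inj₁ eq = subst (ℚ._< ε) (sym eq) p
  ... | inj₂ eq = subst (ℚ._< ε) (sym eq) q

  p≤∣p∣ : ∀ p → p ℚ.≤ ℚ.∣ p ∣
  p≤∣p∣ p with ℚ.≤-total 0ℚ p
  ... | inj₁ 0≤p = ℚ.≤-reflexive (sym (ℚ.0≤p⇒∣p∣≡p 0≤p))
  ... | inj₂ p≤0 = ℚ.≤-trans p≤0 (ℚ.0≤∣p∣ p)

  cancel-+ : ∀ {a b} → 0ℚ ℚ.< a ℚ.+ b → ℚ.- a ℚ.< b
  cancel-+ {a} {b} p = subst₂ ℚ._<_ (ℚ.+-identityʳ (ℚ.- a)) (rearrange a b) (ℚ.+-monoʳ-< (ℚ.- a) p)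
    where
    rearrange : ∀ a b → ℚ.- a ℚ.+ (a ℚ.+ b) ≡ b
    rearrange = solve-∀ ℚ-ring

Null : (ℕ → ℚ) → Set
Null s = ∀ ε → 0ℚ ℚ.< ε → ∃[ N ] ∀ n → N ℕ.≤ n → ℚ.∣ s n ∣ ℚ.< ε

Null-resp : ∀ {s t} → (∀ n → s n ≡ t n) → Null s → Null t
Null-resp s≡t null ε 0<ε = let N , h = null ε 0<ε in
  N , λ n N≤n → subst (λ q → ℚ.∣ q ∣ ℚ.< ε) (s≡t n) (h n N≤n)

Null-0 : Null (λ _ → 0ℚ)
Null-0 ε 0<ε = 0 , λ _ _ → 0<ε

Null-+ : ∀ {s t} → Null s → Null t → Null (λ n → s n ℚ.+ t n)
Null-+ {s} {t} null null′ ε 0<ε =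
  let N , h = null (½ ℚ.* ε) (half-positive 0<ε)
      N′ , h′ = null′ (½ ℚ.* ε) (half-positive 0<ε)
  in N ℕ.⊔ N′ , λ n N≤n → ∣-∣<-halves {s n} {t n} (h n (ℕ.m⊔n≤o⇒m≤o N N′ N≤n)) (h′ n (ℕ.m⊔n≤o⇒n≤o N N′ N≤n))

Null-neg : ∀ {s} → Null s → Null (λ n → ℚ.- s n)
Null-neg {s} null ε 0<ε = let N , h = null ε 0<ε in
  N , λ n N≤n → subst (ℚ._< ε) (sym (ℚ.∣-p∣≡∣p∣ (s n))) (h n N≤n)

eventually-bounded : ∀ s → Cauchy s → ∃[ N ] ∃[ B ] 0ℚ ℚ.< B × (∀ n → N ℕ.≤ n → ℚ.∣ s n ∣ ℚ.< B)
eventually-bounded s cauchy-s =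
  let N , h = cauchy-s 1ℚ (ℚ.positive⁻¹ 1ℚ) in
  N , ℚ.∣ s N ∣ ℚ.+ 1ℚ , ℚ.+-mono-≤-< (ℚ.0≤∣p∣ (s N)) (ℚ.positive⁻¹ 1ℚ) , λ n N≤n →
    ℚ.≤-<-trans (subst (λ q → ℚ.∣ q ∣ ℚ.≤ ℚ.∣ s N ∣ ℚ.+ ℚ.∣ s n ℚ.- s N ∣) (rearrange (s N) (s n))
      (ℚ.∣p+q∣≤∣p∣+∣q∣ (s N) _))
      (ℚ.+-monoʳ-< ℚ.∣ s N ∣ (h n N N≤n ℕ.≤-refl))
  where
  rearrange : ∀ a b → a ℚ.+ (b ℚ.- a) ≡ b
  rearrange = solve-∀ ℚ-ring

Null-* : ∀ {s t} → Cauchy s → Null t → Null (λ n → s n ℚ.* t n)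
Null-* {s} {t} cauchy-s null ε 0<ε =
  let N , B , 0<B , bounded = eventually-bounded s cauchy-s
      instance
        B-positive : ℚ.Positive B
        B-positive = ℚ.positive 0<B
        B-nonZero : ℚ.NonZero B
        B-nonZero = ℚ.pos⇒nonZero B
        1/B-positive : ℚ.Positive (ℚ.1/ B)
        1/B-positive = ℚ.1/pos⇒pos B
      η = (ℚ.1/ B) ℚ.* ε
      Bη≡ε : B ℚ.* η ≡ ε
      Bη≡ε = trans (sym (ℚ.*-assoc B (ℚ.1/ B) ε)) (trans (cong (ℚ._* ε) (ℚ.*-inverseʳ B)) (ℚ.*-identityˡ ε))
      N′ , h = null η (subst (ℚ._< η) (ℚ.*-zeroʳ (ℚ.1/ B)) (ℚ.*-monoʳ-<-pos (ℚ.1/ B) 0<ε))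
  in N ℕ.⊔ N′ , λ n N≤n → begin-strict
    ℚ.∣ s n ℚ.* t n ∣          ≡⟨ ℚ.∣p*q∣≡∣p∣*∣q∣ (s n) (t n) ⟩
    ℚ.∣ s n ∣ ℚ.* ℚ.∣ t n ∣    ≤⟨ ℚ.*-monoʳ-≤-nonNeg ℚ.∣ t n ∣ {{ℚ.∣-∣-nonNeg (t n)}}
      (ℚ.<⇒≤ (bounded n (ℕ.m⊔n≤o⇒m≤o N N′ N≤n))) ⟩
    B ℚ.* ℚ.∣ t n ∣            <⟨ ℚ.*-monoʳ-<-pos B (h n (ℕ.m⊔n≤o⇒n≤o N N′ N≤n)) ⟩
    B ℚ.* η                    ≡⟨ Bη≡ε ⟩
    ε                          ∎
  where open ℚ.≤-Reasoning

-- Records instead of the bare definitions, and opaque operations below, so that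
-- unification recovers the arguments.
infix 4 _≋_
record _≋_ (x y : ℝ) : Set where
  constructor ≋⁺
  field ≋⁻ : x ≈ℝ y
open _≋_ public

record NonNegℝ (x : ℝ) : Set where
  constructor nonNeg⁺
  field nonNeg⁻ : 0ℝ ≤ℝ x
open NonNegℝ public

pointwise : ∀ {x y} → (∀ n → seq x n ≡ seq y n) → x ≋ y
pointwise {x} {y} h = ≋⁺ (Null-resp (λ n → sym (trans (cong (ℚ._- seq y n) (h n))
  (ℚ.+-inverseʳ (seq y n)))) Null-0)

≋-refl : ∀ {x} → x ≋ x
≋-refl = pointwise (λ _ → refl)

≋-sym : ∀ {x y} → x ≋ y → y ≋ x
≋-sym {x} {y} (≋⁺ h) = ≋⁺ (Null-resp (λ n → rearrange (seq x n) (seq y n)) (Null-neg h))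
  where
  rearrange : ∀ a b → ℚ.- (a ℚ.- b) ≡ b ℚ.- a
  rearrange = solve-∀ ℚ-ring

≋-trans : ∀ {x y z} → x ≋ y → y ≋ z → x ≋ z
≋-trans {x} {y} {z} (≋⁺ h) (≋⁺ h′) = ≋⁺ (Null-resp (λ n → rearrange (seq x n) (seq y n) (seq z n))
  (Null-+ h h′))
  where
  rearrange : ∀ a b c → (a ℚ.- b) ℚ.+ (b ℚ.- c) ≡ a ℚ.- c
  rearrange = solve-∀ ℚ-ring

infixl 6 _⊕_
infixl 7 _⊗_
infix  8 ⊖_

opaque
  _⊕_ _⊗_ : ℝ → ℝ → ℝ
  _⊕_ = _+ℝ_
  _⊗_ = _*ℝ_

  ⊖_ : ℝ → ℝ
  ⊖_ = -ℝ_

  +ℝ≋⊕ : ∀ x y → x +ℝ y ≋ x ⊕ y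
  +ℝ≋⊕ x y = ≋-refl

  *ℝ≋⊗ : ∀ x y → x *ℝ y ≋ x ⊗ y
  *ℝ≋⊗ x y = ≋-refl

  -ℝ≋⊖ : ∀ x → -ℝ x ≋ ⊖ x
  -ℝ≋⊖ x = ≋-refl

  seq-⊕ : ∀ x y n → seq (x ⊕ y) n ≡ seq x n ℚ.+ seq y n
  seq-⊕ x y n = refl

  seq-⊗ : ∀ x y n → seq (x ⊗ y) n ≡ seq x n ℚ.* seq y n
  seq-⊗ x y n = refl

  ⊕-⊗-isCommutativeRing : IsCommutativeRing _≋_ _⊕_ _⊗_ ⊖_ 0ℝ 1ℝ
  ⊕-⊗-isCommutativeRing = record
    { isRing = record
      { +-isAbelianGroup = record
        { isGroup = record
          { isMonoid = record
            { isSemigroup = record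
              { isMagma = record
                { isEquivalence = record { refl = ≋-refl ; sym = ≋-sym ; trans = ≋-trans }
                ; ∙-cong = λ {x} {y} {u} {v} (≋⁺ h) (≋⁺ h′) → ≋⁺ (Null-resp
                    (λ n → add (seq x n) (seq y n) (seq u n) (seq v n)) (Null-+ h h′)) }
              ; assoc = λ x y z → pointwise (λ n → ℚ.+-assoc (seq x n) (seq y n) (seq z n)) }
            ; identity = (λ x → pointwise (λ n → ℚ.+-identityˡ (seq x n)))
                       , (λ x → pointwise (λ n → ℚ.+-identityʳ (seq x n))) }
          ; inverse = (λ x → pointwise (λ n → ℚ.+-inverseˡ (seq x n)))
                    , (λ x → pointwise (λ n → ℚ.+-inverseʳ (seq x n)))
          ; ⁻¹-cong = λ {x} {y} (≋⁺ h) → ≋⁺ (Null-resp (λ n → negate (seq x n) (seq y n)) (Null-neg h)) }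
        ; comm = λ x y → pointwise (λ n → ℚ.+-comm (seq x n) (seq y n)) }
      ; *-cong = λ {x} {y} {u} {v} (≋⁺ h) (≋⁺ h′) → ≋⁺ (Null-resp
          (λ n → multiply (seq x n) (seq y n) (seq u n) (seq v n))
          (Null-+ {λ n → seq x n ℚ.* (seq u n ℚ.- seq v n)}
            (Null-* {seq x} {λ n → seq u n ℚ.- seq v n} (cauchy x) h′) (Null-* {seq v} (cauchy v) h)))
      ; *-assoc = λ x y z → pointwise (λ n → ℚ.*-assoc (seq x n) (seq y n) (seq z n))
      ; *-identity = (λ x → pointwise (λ n → ℚ.*-identityˡ (seq x n)))
                   , (λ x → pointwise (λ n → ℚ.*-identityʳ (seq x n)))
      ; distrib = (λ x y z → pointwise (λ n → ℚ.*-distribˡ-+ (seq x n) (seq y n) (seq z n)))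
                , (λ x y z → pointwise (λ n → ℚ.*-distribʳ-+ (seq x n) (seq y n) (seq z n)))
      }
    ; *-comm = λ x y → pointwise (λ n → ℚ.*-comm (seq x n) (seq y n))
    }
    where
    add : ∀ x y u v → (x ℚ.- y) ℚ.+ (u ℚ.- v) ≡ (x ℚ.+ u) ℚ.- (y ℚ.+ v)
    add = solve-∀ ℚ-ring
    negate : ∀ x y → ℚ.- (x ℚ.- y) ≡ (ℚ.- x) ℚ.- (ℚ.- y)
    negate = solve-∀ ℚ-ring
    multiply : ∀ x y u v → x ℚ.* (u ℚ.- v) ℚ.+ v ℚ.* (x ℚ.- y) ≡ (x ℚ.* u) ℚ.- (y ℚ.* v)
    multiply = solve-∀ ℚ-ring

ℝ-commutativeRing : CommutativeRing 0ℓ 0ℓ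
ℝ-commutativeRing = record { isCommutativeRing = ⊕-⊗-isCommutativeRing }

≋0⇒Null : ∀ {x} → x ≋ 0ℝ → Null (seq x)
≋0⇒Null {x} (≋⁺ h) = Null-resp (λ n → ℚ.+-identityʳ (seq x n)) h

Null⇒≋0 : ∀ {x} → Null (seq x) → x ≋ 0ℝ
Null⇒≋0 {x} h = ≋⁺ (Null-resp (λ n → sym (ℚ.+-identityʳ (seq x n))) h)

private
  <-halves : ∀ {a b ε} → a ℚ.< ½ ℚ.* ε → b ℚ.< ½ ℚ.* ε → a ℚ.+ b ℚ.< ε
  <-halves {a} {b} {ε} p q = subst (a ℚ.+ b ℚ.<_) (halves ε) (ℚ.+-mono-< p q)

  nonNeg-elim : ∀ {x} → NonNegℝ x → ∀ ε → 0ℚ ℚ.< ε → ∃[ N ] ∀ n → N ℕ.≤ n → ℚ.- seq x n ℚ.< ε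
  nonNeg-elim {x} (nonNeg⁺ h) ε 0<ε = let N , p = h ε 0<ε in N , λ n N≤n → cancel-+ {seq x n} {ε} (p n N≤n)

  nonNeg-intro : ∀ {x} → (∀ ε → 0ℚ ℚ.< ε → ∃[ N ] ∀ n → N ℕ.≤ n → ℚ.- seq x n ℚ.< ε) → NonNegℝ x
  nonNeg-intro {x} h = nonNeg⁺ λ ε 0<ε → let N , p = h ε 0<ε in N , λ n N≤n →
    subst₂ ℚ._<_ (ℚ.+-inverseʳ (seq x n)) refl (ℚ.+-monoʳ-< (seq x n) (p n N≤n))

NonNegℝ-resp : ∀ {x y} → x ≋ y → NonNegℝ x → NonNegℝ y
NonNegℝ-resp {x} {y} (≋⁺ h) x≥0 = nonNeg-intro λ ε 0<ε →
  let N , p = h (½ ℚ.* ε) (half-positive 0<ε)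
      N′ , q = nonNeg-elim x≥0 (½ ℚ.* ε) (half-positive 0<ε)
  in N ℕ.⊔ N′ , λ n N≤n → subst (ℚ._< ε) (rearrange (seq x n) (seq y n))
       (<-halves (ℚ.≤-<-trans (p≤∣p∣ _) (p n (ℕ.m⊔n≤o⇒m≤o N N′ N≤n))) (q n (ℕ.m⊔n≤o⇒n≤o N N′ N≤n)))
  where
  rearrange : ∀ a b → (a ℚ.- b) ℚ.+ (ℚ.- a) ≡ ℚ.- b
  rearrange = solve-∀ ℚ-ring

NonNegℝ-+ : ∀ {x y} → NonNegℝ x → NonNegℝ y → NonNegℝ (x ⊕ y)
NonNegℝ-+ {x} {y} x≥0 y≥0 = nonNeg-intro λ ε 0<ε →
  let N , p = nonNeg-elim x≥0 (½ ℚ.* ε) (half-positive 0<ε)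
      N′ , q = nonNeg-elim y≥0 (½ ℚ.* ε) (half-positive 0<ε)
  in N ℕ.⊔ N′ , λ n N≤n → subst (ℚ._< ε)
       (trans (sym (ℚ.neg-distrib-+ (seq x n) (seq y n))) (cong ℚ.-_ (sym (seq-⊕ x y n))))
       (<-halves (p n (ℕ.m⊔n≤o⇒m≤o N N′ N≤n)) (q n (ℕ.m⊔n≤o⇒n≤o N N′ N≤n)))

NonNegℝ-fromℚ : ∀ {q} → 0ℚ ℚ.≤ q → NonNegℝ (fromℚ q)
NonNegℝ-fromℚ {q} 0≤q = nonNeg⁺ λ ε 0<ε → 0 , λ n _ → ℚ.+-mono-≤-< 0≤q 0<ε

-- The lower bound is the nonnegativity of `x`; the upper one comes from writing `x` as
-- `(x + y) - y`, with `y` nonnegative and the sum null.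
NonNegℝ-pointed : ∀ {x y} → NonNegℝ x → NonNegℝ y → x ⊕ y ≋ 0ℝ → x ≋ 0ℝ
NonNegℝ-pointed {x} {y} x≥0 y≥0 x+y≈0 = Null⇒≋0 λ ε 0<ε →
  let N₁ , p = nonNeg-elim x≥0 ε 0<ε
      N₂ , q = nonNeg-elim y≥0 (½ ℚ.* ε) (half-positive 0<ε)
      N₃ , r = ≋0⇒Null x+y≈0 (½ ℚ.* ε) (half-positive 0<ε)
  in N₁ ℕ.⊔ (N₂ ℕ.⊔ N₃) , λ n N≤n →
    let N₂₃≤n = ℕ.m⊔n≤o⇒n≤o N₁ (N₂ ℕ.⊔ N₃) N≤n in
    <-neg-<⇒∣-∣< (subst (ℚ._< ε) (rearrange (seq x n) (seq y n)) (<-halves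
      (ℚ.≤-<-trans (ℚ.≤-trans (ℚ.≤-reflexive (sym (seq-⊕ x y n))) (p≤∣p∣ _)) (r n (ℕ.m⊔n≤o⇒n≤o N₂ N₃ N₂₃≤n)))
      (q n (ℕ.m⊔n≤o⇒m≤o N₂ N₃ N₂₃≤n))))
      (p n (ℕ.m⊔n≤o⇒m≤o N₁ (N₂ ℕ.⊔ N₃) N≤n))
  where
  rearrange : ∀ a b → (a ℚ.+ b) ℚ.+ (ℚ.- b) ≡ a
  rearrange = solve-∀ ℚ-ring

-- Past a suitable index `N` the sequence stays close to its term there. Comparing that rational
-- term with `δ` is decidable, and a negative answer would refute `x ≋ 0ℝ`, which the hypothesis
-- excludes.
≋0-stable : ∀ {x} → ¬ ¬ x ≋ 0ℝ → x ≋ 0ℝ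
≋0-stable {x} ¬¬x≈0 = Null⇒≋0 λ ε 0<ε →
  let δ = ½ ℚ.* ε
      0<δ = half-positive 0<ε
      N , p = cauchy x (½ ℚ.* δ) (half-positive 0<δ)
  in N , λ n N≤n → subst (λ q → ℚ.∣ q ∣ ℚ.< ε) (rearrange (seq x n) (seq x N))
    (∣-∣<-halves (ℚ.<-trans (p n N N≤n ℕ.≤-refl) (half< 0<δ)) (small δ N 0<δ p))
  where
  rearrange : ∀ a b → (a ℚ.- b) ℚ.+ b ≡ a
  rearrange = solve-∀ ℚ-ring
  half< : ∀ {δ} → 0ℚ ℚ.< δ → ½ ℚ.* δ ℚ.< δ
  half< {δ} 0<δ = subst₂ ℚ._<_ (ℚ.+-identityʳ _) (halves δ) (ℚ.+-monoʳ-< (½ ℚ.* δ) (half-positive 0<δ))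
  small : ∀ δ N → 0ℚ ℚ.< δ → (∀ m n → N ℕ.≤ m → N ℕ.≤ n → ℚ.∣ seq x m ℚ.- seq x n ∣ ℚ.< ½ ℚ.* δ) →
          ℚ.∣ seq x N ∣ ℚ.< δ
  small δ N 0<δ p with ℚ.∣ seq x N ∣ ℚ.<? δ
  ... | yes lt = lt
  ... | no ≮δ = contradiction (λ x≈0 → ≮δ (let N′ , q = ≋0⇒Null x≈0 (½ ℚ.* δ) (half-positive 0<δ) in
    subst (λ q → ℚ.∣ q ∣ ℚ.< δ) (rearrange (seq x N) (seq x (N ℕ.⊔ N′)))
      (∣-∣<-halves (p N (N ℕ.⊔ N′) ℕ.≤-refl (ℕ.m≤m⊔n N N′)) (q (N ℕ.⊔ N′) (ℕ.m≤n⊔m N N′))))) ¬¬x≈0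

1≋̸0 : ¬ 1ℝ ≋ 0ℝ
1≋̸0 (≋⁺ h) = let N , p = h 1ℚ (ℚ.positive⁻¹ 1ℚ) in ℚ.<-irrefl refl (p N ℕ.≤-refl)

private
  numeralℚ : ℕ → ℚ
  numeralℚ zero    = 0ℚ
  numeralℚ (suc m) = 1ℚ ℚ.+ numeralℚ m

  0≤numeralℚ : ∀ m → 0ℚ ℚ.≤ numeralℚ m
  0≤numeralℚ zero    = ℚ.≤-refl
  0≤numeralℚ (suc m) = ℚ.+-mono-≤ (ℚ.<⇒≤ (ℚ.positive⁻¹ 1ℚ)) (0≤numeralℚ m)

  seq-numeral : ∀ m n → seq (numeral ℝ-commutativeRing m) n ≡ numeralℚ m
  seq-numeral zero    n = refl
  seq-numeral (suc m) n = trans (seq-⊕ 1ℝ _ n) (cong (1ℚ ℚ.+_) (seq-numeral m n))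

reciprocalℝ : ∀ m → ∃[ r ] NonNegℝ r × r ⊗ numeral ℝ-commutativeRing (suc m) ≋ 1ℝ
reciprocalℝ m = fromℚ (ℚ.1/ q) , NonNegℝ-fromℚ (ℚ.<⇒≤ (ℚ.positive⁻¹ (ℚ.1/ q))) , pointwise (λ n →
  trans (seq-⊗ (fromℚ (ℚ.1/ q)) _ n) (trans (cong ((ℚ.1/ q) ℚ.*_) (seq-numeral (suc m) n)) (ℚ.*-inverseˡ q)))
  where
  q : ℚ
  q = numeralℚ (suc m)
  instance
    q-positive : ℚ.Positive q
    q-positive = ℚ.positive (ℚ.+-mono-<-≤ (ℚ.positive⁻¹ 1ℚ) (0≤numeralℚ m))
    q-nonZero : ℚ.NonZero q
    q-nonZero = ℚ.pos⇒nonZero q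
    1/q-positive : ℚ.Positive (ℚ.1/ q)
    1/q-positive = ℚ.1/pos⇒pos q

ℝ-orderedRing : OrderedRing
ℝ-orderedRing = record
  { commutativeRing = ℝ-commutativeRing
  ; NonNeg      = NonNegℝ
  ; nonNeg-resp = NonNegℝ-resp
  ; nonNeg-0    = NonNegℝ-fromℚ ℚ.≤-refl
  ; nonNeg-1    = NonNegℝ-fromℚ (ℚ.<⇒≤ (ℚ.positive⁻¹ 1ℚ))
  ; nonNeg-+    = NonNegℝ-+
  ; pointed     = NonNegℝ-pointed
  ; 1≉0         = 1≋̸0
  ; ≈0-stable   = ≋0-stable
  ; recip       = reciprocalℝ
  }

-- Linearisation

module Linearisation where

  open Sums ℝ-orderedRing

  support-+ : (e e′ : Vec ℕ N) → support (Vec.zipWith ℕ._+_ e e′) ≡ support e ∪ support e′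
  support-+ []          []       = refl
  support-+ (zero ∷ e)  (x ∷ e′) = cong ((0 ℕ.<ᵇ x) ∷_) (support-+ e e′)
  support-+ (suc _ ∷ e) (x ∷ e′) = cong (true ∷_) (support-+ e e′)

  support-0 : ∀ N → support (Vec.replicate N 0) ≡ ⊥
  support-0 zero    = refl
  support-0 (suc N) = cong (false ∷_) (support-0 N)

  support-var : (i : Fin N) → support (Vec.replicate N 0 [ i ]≔ 1) ≡ ⁅ i ⁆
  support-var {suc N} zero    = cong (true ∷_) (support-0 N)
  support-var         (suc i) = cong (false ∷_) (support-var i)

  -- Linearisation against any functional on sets, with `φ ⊥` in place of the built-in value 1. In
  -- this generality multiplying by a monomial is the shift of `φ` by a union, and multiplying by
  -- `1 - xᵢ` is a difference of such shifts.
  lin : (Subset N → ℝ) → Poly N → ℝ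
  lin φ []            = 0#
  lin φ ((c , e) ∷ p) = c * φ (support e) + lin φ p

  total : (Subset N → ℝ) → Subset N → ℝ
  total y S = if does (nonempty? S) then y S else 1ℝ

  linearise≈lin : (y : Subset N → ℝ) (p : Poly N) → linearise y p ≈ lin (total y) p
  linearise≈lin y []            = ≈-refl
  linearise≈lin y ((c , e) ∷ p) = ≈-trans (+ℝ≋⊕ _ _) (+-cong (*ℝ≋⊗ _ _) (linearise≈lin y p))

  lin-cong : {φ ψ : Subset N → ℝ} → (∀ S → φ S ≈ ψ S) → (p : Poly N) → lin φ p ≈ lin ψ p
  lin-cong h []            = ≈-refl
  lin-cong h ((c , e) ∷ p) = +-cong (*-congˡ (h (support e))) (lin-cong h p)

  lin-difference : (φ ψ : Subset N → ℝ) (p : Poly N) → lin (λ S → φ S + - ψ S) p + lin ψ p ≈ lin φ p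
  lin-difference φ ψ []            = +-identityˡ 0#
  lin-difference φ ψ ((c , e) ∷ p) = ≈-trans (+-interchange _ _ _ _) (+-cong
    (≈-trans (≈-sym (distribˡ c _ _)) (*-congˡ (x-y+y≈x _ _)))
    (lin-difference φ ψ p))

  lin-+ : (φ : Subset N → ℝ) (p q : Poly N) → lin φ (p +ᴾ q) ≈ lin φ p + lin φ q
  lin-+ φ []            q = ≈-sym (+-identityˡ _)
  lin-+ φ ((c , e) ∷ p) q = ≈-trans (+-congˡ (lin-+ φ p q)) (≈-sym (+-assoc _ _ _))

  lin-neg : (φ : Subset N → ℝ) (p q : Poly N) → lin φ (p -ᴾ q) + lin φ q ≈ lin φ p
  lin-neg φ p q = begin
    lin φ (p -ᴾ q) + lin φ q           ≈⟨ +-congʳ (lin-+ φ p (negated q)) ⟩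
    lin φ p + lin φ (negated q) + lin φ q    ≈⟨ +-assoc _ _ _ ⟩
    lin φ p + (lin φ (negated q) + lin φ q)  ≈⟨ +-congˡ (cancel q) ⟩
    lin φ p + 0#                       ≈⟨ +-identityʳ _ ⟩
    lin φ p                            ∎
    where
    negated : Poly _ → Poly _
    negated q = [] -ᴾ q
    cancel : ∀ q → lin φ (negated q) + lin φ q ≈ 0#
    cancel []            = +-identityˡ 0#
    cancel ((c , e) ∷ q) = begin
      (-ℝ c * φ (support e) + lin φ (negated q)) + (c * φ (support e) + lin φ q)  ≈⟨ +-interchange _ _ _ _ ⟩
      (-ℝ c * φ (support e) + c * φ (support e)) + (lin φ (negated q) + lin φ q)
        ≈⟨ +-cong (≈-trans (≈-sym (distribʳ _ _ _)) (*-congʳ (≈-trans (+-congʳ (-ℝ≋⊖ c)) (-‿inverseˡ c))))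
          (cancel q) ⟩
      0# * φ (support e) + 0#  ≈⟨ ≈-trans (+-identityʳ _) (zeroˡ _) ⟩
      0#                       ∎

  lin-∑ : ∀ {m} (φ : Subset N → ℝ) (f : Fin m → Poly N) → lin φ (∑ f) ≈ ∑ₗ (allFin m) (λ i → lin φ (f i))
  lin-∑ {m = m} φ f = go (allFin m)
    where
    go : ∀ is → lin φ (foldr (λ i p → f i +ᴾ p) [] is) ≈ ∑ₗ is (λ i → lin φ (f i))
    go []       = ≈-refl
    go (i ∷ is) = ≈-trans (lin-+ φ (f i) _) (+-congˡ (go is))

  lin-const : (φ : Subset N → ℝ) (c : ℝ) → lin φ (const c) ≈ c * φ ⊥
  lin-const φ c = ≈-trans (+-identityʳ _) (*-congˡ (reflexive (cong φ (support-0 _))))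

  lin-var : (φ : Subset N → ℝ) (i : Fin N) → lin φ (var i) ≈ φ ⁅ i ⁆
  lin-var φ i = ≈-trans (+-identityʳ _) (≈-trans (*-identityˡ _) (reflexive (cong φ (support-var i))))

  times : ℝ → Vec ℕ N → Poly N → Poly N
  times c e = List.map (λ (c′ , e′) → c *ℝ c′ , Vec.zipWith ℕ._+_ e e′)

  lin-times : (φ : Subset N → ℝ) (c : ℝ) (e : Vec ℕ N) (p : Poly N) →
              lin φ (times c e p) ≈ c * lin (λ S → φ (support e ∪ S)) p
  lin-times φ c e []              = ≈-sym (zeroʳ c)
  lin-times φ c e ((c′ , e′) ∷ p) = ≈-trans
    (+-cong (≈-trans (*-cong (*ℝ≋⊗ c c′) (reflexive (cong φ (support-+ e e′)))) (*-assoc c c′ _))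
      (lin-times φ c e p))
    (≈-sym (distribˡ c _ _))

  lin-monomial* : (φ : Subset N → ℝ) (c : ℝ) (e : Vec ℕ N) (p : Poly N) →
                  lin φ (((c , e) ∷ []) *ᴾ p) ≈ c * lin (λ S → φ (support e ∪ S)) p
  lin-monomial* φ c e p = ≈-trans (lin-+ φ (times c e p) []) (≈-trans (+-identityʳ _) (lin-times φ c e p))

  lin-const* : (φ : Subset N → ℝ) (c : ℝ) (p : Poly N) → lin φ (const c *ᴾ p) ≈ c * lin φ p
  lin-const* φ c p = ≈-trans (lin-monomial* φ c (Vec.replicate _ 0) p) (*-congˡ (lin-cong
    (λ S → reflexive (cong φ (trans (cong (_∪ S) (support-0 _)) (∪-identityˡ S)))) p))

  lin-var* : (φ : Subset N → ℝ) (i : Fin N) (p : Poly N) →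
             lin φ (var i *ᴾ p) ≈ lin (λ S → φ (⁅ i ⁆ ∪ S)) p
  lin-var* φ i p = ≈-trans (lin-monomial* φ 1ℝ _ p) (≈-trans (*-identityˡ _)
    (lin-cong (λ S → reflexive (cong (λ T → φ (T ∪ S)) (support-var i))) p))

  lin-complement* : (φ : Subset N → ℝ) (i : Fin N) (p : Poly N) →
    lin φ ((const 1ℝ -ᴾ var i) *ᴾ p) ≈ lin (λ S → φ S + - φ (⁅ i ⁆ ∪ S)) p
  lin-complement* {N} φ i p = +-cancelʳ (lin (λ S → φ (⁅ i ⁆ ∪ S)) p) _ _ (begin
    lin φ ((const 1ℝ -ᴾ var i) *ᴾ p) + x
      ≈⟨ +-congʳ (lin-+ φ (times 1ℝ (Vec.replicate N 0) p) _) ⟩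
    lin φ (times 1ℝ (Vec.replicate N 0) p) + lin φ (times (-ℝ 1ℝ) eᵢ p ++ []) + x
      ≈⟨ +-cong (+-cong first second) ≈-refl ⟩
    lin φ p + - x + x
      ≈⟨ x-y+y≈x _ x ⟩
    lin φ p
      ≈⟨ lin-difference φ (λ S → φ (⁅ i ⁆ ∪ S)) p ⟨
    lin (λ S → φ S + - φ (⁅ i ⁆ ∪ S)) p + x  ∎)
    where
    eᵢ : Vec ℕ N
    eᵢ = Vec.replicate N 0 [ i ]≔ 1
    x : ℝ
    x = lin (λ S → φ (⁅ i ⁆ ∪ S)) p
    first : lin φ (times 1ℝ (Vec.replicate N 0) p) ≈ lin φ p
    first = ≈-trans (≈-trans (≈-sym (+-identityʳ _)) (≈-sym (lin-+ φ (times 1ℝ (Vec.replicate N 0) p) [])))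
      (≈-trans (lin-const* φ 1ℝ p) (*-identityˡ _))
    second : lin φ (times (-ℝ 1ℝ) eᵢ p ++ []) ≈ - x
    second = ≈-trans (lin-monomial* φ (-ℝ 1ℝ) eᵢ p) (≈-trans
      (*-cong (-ℝ≋⊖ 1ℝ) (lin-cong (λ S → reflexive (cong (λ T → φ (T ∪ S)) (support-var i))) p))
      (-1*x≈-x x))

  -- A product of variables is a single term, but its coefficient is a product of ones, equal to 1
  -- only up to the equality of reals.
  record Monomial (I : Subset N) (p : Poly N) : Set where
    field
      {coefficient} : ℝ
      {exponent}    : Vec ℕ N
      isTerm        : p ≡ (coefficient , exponent) ∷ []
      coefficient≈1 : coefficient ≈ 1#
      support≡      : support exponent ≡ I

  ∏-var : (I : Subset N) → Monomial I (∏[ I ] var)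
  ∏-var {N} I = record
    { isTerm = proj₁ result ; coefficient≈1 = proj₁ (proj₂ result)
    ; support≡ = ⊆-antisym (λ x∈ → proj₂ (proj₁ (proj₂ (proj₂ result)) x∈))
                            (λ x∈ → proj₂ (proj₂ (proj₂ result)) (∈-allFin _) x∈) }
    where
    P : List (Fin N) → Poly N
    P = foldr (λ i p → if lookup I i then var i *ᴾ p else p) (const 1ℝ)
    T : List (Fin N) → ℝ × Vec ℕ N
    T = foldr (λ i (c , e) → if lookup I i then (1ℝ *ℝ c , Vec.zipWith ℕ._+_
      (Vec.replicate N 0 [ i ]≔ 1) e) else (c , e))
              (1ℝ , Vec.replicate N 0)
    -- The support of the partial product is `I` restricted to the indices in `is`.
    go : ∀ is → P is ≡ T is ∷ [] × proj₁ (T is) ≈ 1# ×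
         (∀ {x} → x ∈ₛ support (proj₂ (T is)) → x ∈ is × x ∈ₛ I) ×
         (∀ {x} → x ∈ is → x ∈ₛ I → x ∈ₛ support (proj₂ (T is)))
    go [] = refl , ≈-refl , (λ x∈ → contradiction (subst (_ ∈ₛ_) (support-0 N) x∈) ∉⊥) , λ ()
    go (i ∷ is) with lookup I i in eq | go is
    ... | false | P≡ , c≈1 , to , from = P≡ , c≈1 , (λ x∈ → let x∈is , x∈I = to x∈ in there x∈is , x∈I) , from′
      where
      from′ : ∀ {x} → x ∈ i ∷ is → x ∈ₛ I → x ∈ₛ support (proj₂ (T is))
      from′ (here refl)  x∈I = contradiction (trans (sym eq) (Vec.[]=⇒lookup x∈I)) λ ()
      from′ (there x∈is) x∈I = from x∈is x∈I
    ... | true | P≡ , c≈1 , to , from =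
      cong (var i *ᴾ_) P≡ , ≈-trans (*ℝ≋⊗ _ _) (≈-trans (*-identityˡ _) c≈1) , to′ , from′
      where
      e = proj₂ (T is)
      supp : support (Vec.zipWith ℕ._+_ (Vec.replicate N 0 [ i ]≔ 1) e) ≡ ⁅ i ⁆ ∪ support e
      supp = trans (support-+ (Vec.replicate N 0 [ i ]≔ 1) e) (cong (_∪ support e) (support-var i))
      to′ : ∀ {x} → x ∈ₛ support (Vec.zipWith ℕ._+_ (Vec.replicate N 0 [ i ]≔ 1) e) → x ∈ i ∷ is × x ∈ₛ I
      to′ x∈ with x∈p∪q⁻ ⁅ i ⁆ (support e) (subst (_ ∈ₛ_) supp x∈)
      ... | inj₁ x∈i with refl ← x∈⁅y⁆⇒x≡y i x∈i = here refl , Vec.lookup⇒[]= i I eq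
      ... | inj₂ x∈e = let x∈is , x∈I = to x∈e in there x∈is , x∈I
      from′ : ∀ {x} → x ∈ i ∷ is → x ∈ₛ I → x ∈ₛ support (Vec.zipWith ℕ._+_ (Vec.replicate N 0 [ i ]≔ 1) e)
      from′ (here refl)  x∈I = subst (_ ∈ₛ_) (sym supp) (x∈p∪q⁺ (inj₁ (x∈⁅x⁆ i)))
      from′ (there x∈is) x∈I = subst (_ ∈ₛ_) (sym supp) (x∈p∪q⁺ (inj₂ (from x∈is x∈I)))
    result = go (allFin N)

  lin-∏-var* : (φ : Subset N → ℝ) (I : Subset N) (p : Poly N) →
               lin φ (∏[ I ] var *ᴾ p) ≈ lin (λ S → φ (I ∪ S)) p
  lin-∏-var* φ I p = ≈-trans (reflexive (cong (λ q → lin φ (q *ᴾ p)) isTerm))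
    (≈-trans (lin-monomial* φ coefficient exponent p) (≈-trans (*-congʳ coefficient≈1) (≈-trans (*-identityˡ _)
      (lin-cong (λ S → reflexive (cong (λ T → φ (T ∪ S)) support≡)) p))))
    where open Monomial (∏-var I)

  -- Keeps the samples containing I: multiplication by ∏_{i∈I} xᵢ.
  Sampled-∪ : {J I : Subset N} {φ : Subset N → ℝ} → I ⊆ J →
              Sampled ℝ-orderedRing J φ → Sampled ℝ-orderedRing J (λ S → φ (I ∪ S))
  Sampled-∪ {J = J} {I} {φ} I⊆J s = record
    { samples = List.map (λ (w , ω) → 𝟙 (I ⊆? ω) * w , ω) samples
    ; nonNegative = λ t∈ → let (w , ω) , s∈ , eq = ∈-map⁻ _ t∈ in
        subst (λ t → NonNeg (proj₁ t)) (sym eq) (nonNeg-𝟙* (I ⊆? ω) (nonNegative s∈))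
    ; represents = λ {L} L⊆J → ≈-trans (represents (λ x∈ → union L⊆J (x∈p∪q⁻ I L x∈)))
        (≈-sym (≈-trans (∑-map _ samples _) (∑-cong samples (λ (w , ω) → same L w ω)))) }
    where
    open Sampled s
    union : ∀ {L x} → L ⊆ J → x ∈ₛ I ⊎ x ∈ₛ L → x ∈ₛ J
    union L⊆J (inj₁ x∈I) = I⊆J x∈I
    union L⊆J (inj₂ x∈L) = L⊆J x∈L
    same : ∀ L w ω → 𝟙 (I ⊆? ω) * w * 𝟙 (L ⊆? ω) ≈ w * 𝟙 (I ∪ L ⊆? ω)
    same L w ω with I ⊆? ω
    ... | no I⊈ω = ≈-trans (≈-trans (*-congʳ (zeroˡ w)) (zeroˡ _)) (≈-sym (≈-trans
      (*-congˡ (𝟙-no (I ∪ L ⊆? ω) (λ sub → I⊈ω (λ x∈ → sub (x∈p∪q⁺ (inj₁ x∈)))))) (zeroʳ w)))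
    ... | yes I⊆ω = *-cong (*-identityˡ w) (𝟙-⇔ (L ⊆? ω) (I ∪ L ⊆? ω)
      (λ L⊆ω x∈ → both L⊆ω (x∈p∪q⁻ I L x∈)) (λ sub x∈ → sub (x∈p∪q⁺ (inj₂ x∈))))
      where
      both : ∀ {x} → L ⊆ ω → x ∈ₛ I ⊎ x ∈ₛ L → x ∈ₛ ω
      both L⊆ω (inj₁ x∈I) = I⊆ω x∈I
      both L⊆ω (inj₂ x∈L) = L⊆ω x∈L

  -- Keeps the samples without i: multiplication by 1 - xᵢ.
  Sampled-complement : {J : Subset N} {φ : Subset N → ℝ} (i : Fin N) → i ∈ₛ J →
    Sampled ℝ-orderedRing J φ → Sampled ℝ-orderedRing J (λ S → φ S + - φ (⁅ i ⁆ ∪ S))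
  Sampled-complement {N} {J} {φ} i i∈J s = record
    { samples = List.map (λ (w , ω) → without ω * w , ω) samples
    ; nonNegative = λ t∈ → let (w , ω) , s∈ , eq = ∈-map⁻ _ t∈ in
        subst (λ t → NonNeg (proj₁ t)) (sym eq) (nn w ω (nonNegative s∈))
    ; represents = λ {L} L⊆J → +-cancelʳ (φ (⁅ i ⁆ ∪ L)) _ _ (begin
        φ L + - φ (⁅ i ⁆ ∪ L) + φ (⁅ i ⁆ ∪ L)
          ≈⟨ x-y+y≈x _ _ ⟩
        φ L
          ≈⟨ represents L⊆J ⟩
        ∑ₗ samples (λ (w , ω) → w * 𝟙 (L ⊆? ω))
          ≈⟨ ∑-cong samples (λ (w , ω) → split L w ω) ⟨
        ∑ₗ samples (λ (w , ω) → without ω * w * 𝟙 (L ⊆? ω) + 𝟙 (⁅ i ⁆ ⊆? ω) * w * 𝟙 (L ⊆? ω))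
          ≈⟨ ∑-+ samples _ _ ⟩
        ∑ₗ samples (λ (w , ω) → without ω * w * 𝟙 (L ⊆? ω)) + ∑ₗ samples
          (λ (w , ω) → 𝟙 (⁅ i ⁆ ⊆? ω) * w * 𝟙 (L ⊆? ω))
          ≈⟨ +-cong (∑-map _ samples _) (≈-trans (Sampled.represents with-i L⊆J) (∑-map _ samples _)) ⟨
        ∑ₗ (List.map (λ (w , ω) → without ω * w , ω) samples) (λ (w , ω) → w * 𝟙 (L ⊆? ω)) + φ (⁅ i ⁆ ∪ L)  ∎) }
    where
    open Sampled s
    with-i : Sampled ℝ-orderedRing J (λ S → φ (⁅ i ⁆ ∪ S))
    with-i = Sampled-∪ (λ x∈ → subst (_∈ₛ J) (sym (x∈⁅y⁆⇒x≡y i x∈)) i∈J) s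
    without : Subset N → ℝ
    without ω = if does (⁅ i ⁆ ⊆? ω) then 0# else 1#
    nn : ∀ w ω → NonNeg w → NonNeg (without ω * w)
    nn w ω w≥0 with ⁅ i ⁆ ⊆? ω
    ... | yes _ = nonNeg-resp (≈-sym (zeroˡ w)) nonNeg-0
    ... | no _  = nonNeg-resp (≈-sym (*-identityˡ w)) w≥0
    split : ∀ L w ω → without ω * w * 𝟙 (L ⊆? ω) + 𝟙 (⁅ i ⁆ ⊆? ω) * w * 𝟙 (L ⊆? ω) ≈ w * 𝟙 (L ⊆? ω)
    split L w ω = ≈-trans (≈-sym (distribʳ _ _ _)) (*-congʳ (≈-trans (≈-sym (distribʳ _ _ _))
      (≈-trans (*-congʳ one) (*-identityˡ w))))
      where
      one : without ω + 𝟙 (⁅ i ⁆ ⊆? ω) ≈ 1#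
      one with ⁅ i ⁆ ⊆? ω
      ... | yes _ = +-identityˡ _
      ... | no _  = +-identityʳ _

  complements : Subset N → List (Fin N) → Poly N
  complements S = foldr (λ i p → if lookup S i then (const 1ℝ -ᴾ var i) *ᴾ p else p) (const 1ℝ)

  -- Every factor of the box term keeps the functional sampled, by discarding samples. When no
  -- factor is left, the value is the total weight of the survivors.
  nonNeg-lin-boxTerm : (φ : Subset N → ℝ) {I J : Subset N} → I ⊆ J → Sampled ℝ-orderedRing J φ →
                       NonNeg (lin φ (boxTerm I J))
  nonNeg-lin-boxTerm {N} φ {I} {J} I⊆J s = nonNeg-resp (≈-sym (lin-∏-var* φ I (complements (J ─ I) (allFin N))))
    (go (allFin N) (λ S → φ (I ∪ S)) (Sampled-∪ I⊆J s))
    where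
    go : ∀ is ψ → Sampled ℝ-orderedRing J ψ →
         NonNeg (lin ψ (complements (J ─ I) is))
    go [] ψ s = nonNeg-resp (≈-sym (≈-trans (lin-const ψ 1ℝ) (≈-trans (*-identityˡ _) (represents ⊥⊆))))
      (nonNeg-samples samples nonNegative)
      where
      open Sampled s
      nonNeg-samples : ∀ ss → (∀ {t} → t ∈ ss → NonNeg (proj₁ t)) → NonNeg (∑ₗ ss (λ (w , ω) → w * 𝟙 (⊥ ⊆? ω)))
      nonNeg-samples []             nn = nonNeg-0
      nonNeg-samples ((w , ω) ∷ ss) nn = nonNeg-+
        (nonNeg-resp (*-comm _ _) (nonNeg-𝟙* (⊥ ⊆? ω) (nn (here refl)))) (nonNeg-samples ss (nn ∘ there))
    go (i ∷ is) ψ s with lookup (J ─ I) i in eq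
    ... | false = go is ψ s
    ... | true  = nonNeg-resp (≈-sym (lin-complement* ψ i (complements (J ─ I) is)))
      (go is (λ S → ψ S + - ψ (⁅ i ⁆ ∪ S)) (Sampled-complement i (p─q⊆p J I (Vec.lookup⇒[]= i (J ─ I) eq)) s))

  -- No complementary factor remains, so this box inequality is the nonnegativity of a single lifted
  -- variable.
  lin-boxTerm-diagonal : (φ : Subset N → ℝ) (I : Subset N) → lin φ (boxTerm I I) ≈ φ I
  lin-boxTerm-diagonal {N} φ I = ≈-trans (lin-∏-var* φ I (complements (I ─ I) (allFin N))) (≈-trans
    (reflexive (cong (lin (λ S → φ (I ∪ S))) (trivial (allFin N))))
    (≈-trans (lin-const (λ S → φ (I ∪ S)) 1ℝ) (≈-trans (*-identityˡ _) (reflexive (cong φ (∪-identityʳ I))))))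
    where
    lookup-─ : ∀ {N} (p : Subset N) i → lookup (p ─ p) i ≡ false
    lookup-─ (inside  ∷ p) zero    = refl
    lookup-─ (outside ∷ p) zero    = refl
    lookup-─ (inside  ∷ p) (suc i) = lookup-─ p i
    lookup-─ (outside ∷ p) (suc i) = lookup-─ p i
    trivial : ∀ is → complements (I ─ I) is ≡ const 1ℝ
    trivial []       = refl
    trivial (i ∷ is) with lookup (I ─ I) i | lookup-─ I i
    ... | false | _ = trivial is

  ≈⇒lin-≈0 : (φ : Subset N → ℝ) (p q : Poly N) → lin φ p ≈ lin φ q → lin φ (p -ᴾ q) ≈ 0#
  ≈⇒lin-≈0 φ p q eq = +-cancelʳ (lin φ q) _ _ (≈-trans (lin-neg φ p q) (≈-trans eq (≈-sym (+-identityˡ _))))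

  lin-≈0⇒≈ : (φ : Subset N → ℝ) (p q : Poly N) → lin φ (p -ᴾ q) ≈ 0# → lin φ p ≈ lin φ q
  lin-≈0⇒≈ φ p q eq = ≈-trans (≈-sym (lin-neg φ p q)) (≈-trans (+-congʳ eq) (+-identityˡ _))

  module _ {n : ℕ} (ψ : Subset (n ℕ.* n) → ℝ) where

    lin-rowSum : ∀ a → lin ψ (∑ (λ w → entry a w)) ≈ ∑ₗ (allFin n) (λ w → ψ (pair a w))
    lin-rowSum a = ≈-trans (lin-∑ ψ (λ w → entry a w)) (∑-cong (allFin n) (λ w → lin-var ψ (at a w)))

    lin-columnSum : ∀ b → lin ψ (∑ (λ w → entry w b)) ≈ ∑ₗ (allFin n) (λ w → ψ (pair w b))
    lin-columnSum b = ≈-trans (lin-∑ ψ (λ w → entry w b)) (∑-cong (allFin n) (λ w → lin-var ψ (at w b)))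

    lin-1 : lin ψ (const 1ℝ) ≈ ψ ⊥
    lin-1 = ≈-trans (lin-const ψ 1ℝ) (*-identityˡ _)

    adjacency≈𝟙 : ∀ (G : Graph n) a b → adjacencyMatrix G a b ≈ 𝟙 (adj G a b Bool.≟ true)
    adjacency≈𝟙 G a b with adj G a b
    ... | true  = ≈-refl
    ... | false = ≈-refl

    lin-AX : ∀ (G : Graph n) a b → lin ψ (∑ (λ w → const (adjacencyMatrix G a w) *ᴾ entry w b)) ≈
             ∑ₗ (allFin n) (λ w → 𝟙 (adj G a w Bool.≟ true) * ψ (pair w b))
    lin-AX G a b = ≈-trans (lin-∑ ψ (λ w → const (adjacencyMatrix G a w) *ᴾ entry w b))
      (∑-cong (allFin n) (λ w →
      ≈-trans (lin-const* ψ (adjacencyMatrix G a w) (entry w b))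
        (*-cong (adjacency≈𝟙 G a w) (lin-var ψ (at w b)))))

    lin-XA : ∀ (H : Graph n) a b → lin ψ (∑ (λ w → entry a w *ᴾ const (adjacencyMatrix H w b))) ≈
             ∑ₗ (allFin n) (λ w → ψ (pair a w) * 𝟙 (adj H w b Bool.≟ true))
    lin-XA H a b = ≈-trans (lin-∑ ψ (λ w → entry a w *ᴾ const (adjacencyMatrix H w b)))
      (∑-cong (allFin n) (λ w →
      ≈-trans (lin-var* ψ (at a w) (const (adjacencyMatrix H w b)))
        (≈-trans (lin-const (λ S → ψ (pair a w ∪ S)) (adjacencyMatrix H w b))
        (≈-trans (*-cong (adjacency≈𝟙 H w b) (reflexive (cong ψ (∪-identityʳ (pair a w))))) (*-comm _ _)))))

  module _ {n k : ℕ} {G H : Graph n} where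

    relaxation⇒system : {y : Subset (n ℕ.* n) → ℝ} → LiftedPolyhedron (suc k) (polytopeEqs G H) [] y →
                        System ℝ-orderedRing k G H (total y)
    relaxation⇒system {y} lifted = record
      { φ⊥≈1    = empty
      ; row     = λ I I≤ a → ≈-trans (≈-sym (lin-rowSum (shift I) a)) (≈-trans
          (holds I I≤ (∑ (λ w → entry a w)) (const 1ℝ) (∈-++⁺ˡ (∈-map⁺ rowEq (∈-allFin a)))) (constant I))
      ; column  = λ I I≤ b → ≈-trans (≈-sym (lin-columnSum (shift I) b)) (≈-trans
          (holds I I≤ (∑ (λ w → entry w b)) (const 1ℝ)
            (∈-++⁺ʳ (List.map rowEq (allFin n)) (∈-++⁺ˡ (∈-map⁺ columnEq (∈-allFin b))))) (constant I))
      ; commute = λ I I≤ a b → ≈-trans (≈-sym (lin-AX (shift I) G a b)) (≈-trans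
          (holds I I≤ (∑ (λ w → const (adjacencyMatrix G a w) *ᴾ entry w b))
            (∑ (λ w → entry a w *ᴾ const (adjacencyMatrix H w b)))
            (∈-++⁺ʳ (List.map rowEq (allFin n)) (∈-++⁺ʳ (List.map columnEq (allFin n))
              (∈-cartesianProductWith⁺ (commutationEq G H) (∈-allFin a) (∈-allFin b)))))
          (lin-XA (shift I) H a b))
      ; nonNeg  = λ I I≤ → nonNeg-resp
          (≈-trans (linearise≈lin y (boxTerm I I)) (lin-boxTerm-diagonal (total y) I)) (nonNeg⁺ (box I I id I≤))
      }
      where
      open LiftedPolyhedron lifted
      shift : Subset (n ℕ.* n) → Subset (n ℕ.* n) → ℝ
      shift I S = total y (I ∪ S)
      empty : total y ⊥ ≈ 1#
      empty with nonempty? (⊥ {n ℕ.* n})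
      ... | yes (_ , x∈) = contradiction x∈ ∉⊥
      ... | no _         = ≈-refl
      constant : ∀ I → lin (shift I) (const 1ℝ) ≈ total y I
      constant I = ≈-trans (lin-1 {n} (shift I)) (reflexive (cong (total y) (∪-identityʳ I)))
      holds : ∀ I → ∣ I ∣ ≤ k → ∀ p q → p -ᴾ q ∈ polytopeEqs G H → lin (shift I) p ≈ lin (shift I) q
      holds I I≤ p q ∈eqs = lin-≈0⇒≈ (shift I) p q (≈-trans (≈-sym (lin-∏-var* (total y) I (p -ᴾ q)))
        (≈-trans (≈-sym (linearise≈lin y (∏[ I ] var *ᴾ (p -ᴾ q)))) (≋⁺ (equality I I≤ (p -ᴾ q) ∈eqs))))

    system⇒relaxation : {φ : Subset (n ℕ.* n) → ℝ} → System ℝ-orderedRing k G H φ →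
      (∀ J → ∣ J ∣ ≤ suc k → Sampled ℝ-orderedRing J φ) → LiftedPolyhedron (suc k) (polytopeEqs G H) [] φ
    system⇒relaxation {φ} sys sampled = record
      { equality   = λ I I≤ f f∈ → ≋⁻ (≈-trans (linearise≈ (∏[ I ] var *ᴾ f))
          (≈-trans (lin-∏-var* φ I f) (equations I I≤ f (∈-++⁻ (List.map rowEq (allFin n)) f∈))))
      ; inequality = λ _ _ _ _ _ ()
      ; box        = λ I J I⊆J J≤ → nonNeg⁻ (nonNeg-resp (≈-sym (linearise≈ (boxTerm I J)))
          (nonNeg-lin-boxTerm φ I⊆J (sampled J J≤)))
      }
      where
      open System sys
      -- The default value 1 at the empty set agrees with `φ⊥≈1`.
      total≈ : ∀ S → total φ S ≈ φ S
      total≈ S with nonempty? S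
      ... | yes _  = ≈-refl
      ... | no em  = ≈-trans (≈-sym φ⊥≈1) (reflexive (cong φ (sym (Empty-unique em))))
      linearise≈ : ∀ p → linearise φ p ≈ lin φ p
      linearise≈ p = ≈-trans (linearise≈lin φ p) (lin-cong total≈ p)
      shift : Subset (n ℕ.* n) → Subset (n ℕ.* n) → ℝ
      shift I S = φ (I ∪ S)
      constant : ∀ I → lin (shift I) (const 1ℝ) ≈ φ I
      constant I = ≈-trans (lin-1 {n} (shift I)) (reflexive (cong φ (∪-identityʳ I)))
      equations : ∀ I → ∣ I ∣ ≤ k → ∀ f → f ∈ List.map rowEq (allFin n) ⊎
        f ∈ List.map columnEq (allFin n) ++ List.cartesianProductWith (commutationEq G H) (allFin n)
          (allFin n) →
        lin (shift I) f ≈ 0#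
      equations I I≤ f (inj₁ f∈) with a , _ , refl ← ∈-map⁻ rowEq f∈ =
        ≈⇒lin-≈0 (shift I) (∑ (λ w → entry a w)) (const 1ℝ)
          (≈-trans (lin-rowSum (shift I) a) (≈-trans (row I I≤ a) (≈-sym (constant I))))
      equations I I≤ f (inj₂ f∈) with ∈-++⁻ (List.map columnEq (allFin n)) f∈
      ... | inj₁ f∈′ with b , _ , refl ← ∈-map⁻ columnEq f∈′ =
        ≈⇒lin-≈0 (shift I) (∑ (λ w → entry w b)) (const 1ℝ)
          (≈-trans (lin-columnSum (shift I) b) (≈-trans (column I I≤ b) (≈-sym (constant I))))
      ... | inj₂ f∈′ with a , b , _ , _ , refl ← ∈-cartesianProductWith⁻ (commutationEq G H) (allFin n)
          (allFin n) f∈′ =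
        ≈⇒lin-≈0 (shift I) (∑ (λ w → const (adjacencyMatrix G a w) *ᴾ entry w b))
          (∑ (λ w → entry a w *ᴾ const (adjacencyMatrix H w b)))
          (≈-trans (lin-AX (shift I) G a b) (≈-trans (commute I I≤ a b) (≈-sym (lin-XA (shift I) H a b))))

open Linearisation using (total; relaxation⇒system; system⇒relaxation)

-- Asymmetry

-- Termination of both refinement procedures is read off from it: a monotone count that pauses for
-- one round witnesses stability.
plateau : (f : ℕ → ℕ) → (∀ m → f (suc m) ≤ f m) → ∃[ m ] f (suc m) ≡ f m
plateau f decreasing = search (f 0) 0 ℕ.≤-refl
  where
  search : ∀ bound m → f m ≤ bound → ∃[ m ] f (suc m) ≡ f m
  search bound m fm≤ with f (suc m) ℕ.≟ f m
  ... | yes eq = m , eq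
  search zero        m fm≤ | no neq =
    contradiction (ℕ.≤-antisym (decreasing m) (ℕ.≤-trans fm≤ z≤n)) neq
  search (suc bound) m fm≤ | no neq =
    search bound (suc m) (ℕ.≤-pred (ℕ.≤-trans (ℕ.≤∧≢⇒< (decreasing m) neq) fm≤))

sum-mono : (xs : List A) {f g : A → ℕ} → (∀ x → f x ≤ g x) → sum (List.map f xs) ≤ sum (List.map g xs)
sum-mono []       h = z≤n
sum-mono (x ∷ xs) h = ℕ.+-mono-≤ (h x) (sum-mono xs h)

+-≡⇒≡ : ∀ {a b c d} → a ≤ b → c ≤ d → a ℕ.+ c ≡ b ℕ.+ d → a ≡ b × c ≡ d
+-≡⇒≡ {a} {b} {c} {d} a≤b c≤d eq = a≡b , ℕ.+-cancelˡ-≡ a c d (trans eq (cong (ℕ._+ d) (sym a≡b)))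
  where
  a≡b : a ≡ b
  a≡b = ℕ.≤-antisym a≤b (ℕ.+-cancelʳ-≤ d b a
    (ℕ.≤-trans (ℕ.≤-reflexive (sym eq)) (ℕ.+-monoʳ-≤ a c≤d)))

sum-≡⇒≡ : {xs : List A} {f g : A → ℕ} → (∀ x → f x ≤ g x) →
          sum (List.map f xs) ≡ sum (List.map g xs) → ∀ {x} → x ∈ xs → f x ≡ g x
sum-≡⇒≡ {xs = x ∷ xs} h eq x∈ with +-≡⇒≡ (h x) (sum-mono xs h) eq | x∈
... | eq₁ , _   | here refl = eq₁
... | _   , eq₂ | there x∈′ = sum-≡⇒≡ h eq₂ x∈′

-- Only the zeros of 𝒞 are needed: they record which entries coincide.
𝒞≡⇒pattern≡ : (G H : Graph n) (u v : Tuple n k) → 𝒞 G u ≡ 𝒞 H v →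
              ∀ i j → lookup u i ≡ lookup u j → lookup v i ≡ lookup v j
𝒞≡⇒pattern≡ {n} {k} G H u v eq i j uᵢ≡uⱼ =
  zero-entry (lookup v i) (lookup v j) (trans (sym (entry≡ H v)) (trans
    (cong (λ M → lookup (lookup M i) j) (sym eq)) (trans (entry≡ G u) u-entry)))
  where
  value : Graph n → Fin n → Fin n → _
  value Γ a b = if does (a Fin.≟ b) then + 0 else if adj Γ a b then + 1 else -[1+ 0 ]
  entry≡ : ∀ Γ (w : Tuple n k) → lookup (lookup (𝒞 Γ w) i) j ≡ value Γ (lookup w i) (lookup w j)
  entry≡ Γ w = trans (cong (λ r → lookup r j) (Vec.lookup∘tabulate _ i)) (Vec.lookup∘tabulate _ j)
  u-entry : value G (lookup u i) (lookup u j) ≡ + 0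
  u-entry rewrite dec-true (lookup u i Fin.≟ lookup u j) uᵢ≡uⱼ = refl
  zero-entry : ∀ a b → value H a b ≡ + 0 → a ≡ b
  zero-entry a b eq with a Fin.≟ b
  ... | yes a≡b = a≡b
  ... | no _ with adj H a b
  zero-entry a b () | no _ | true
  zero-entry a b () | no _ | false

img-replicate : ∀ m (a b : Fin n) → img (Vec.replicate (suc m) a) (Vec.replicate (suc m) b) ≡ pair a b
img-replicate zero    a b = ∪-identityʳ (pair a b)
img-replicate (suc m) a b = trans (cong (pair a b ∪_) (img-replicate m a b)) (∪-idem (pair a b))

module Points where

  open Sums ℝ-orderedRing

  𝒯⇒system : (G H : Graph n) (X : Matrix n) → 𝒯 (suc k) G H X →
    ∃[ φ ] System ℝ-orderedRing k G H φ × (∀ a b → X a b ≈ φ (pair a b))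
  𝒯⇒system {n} G H X (y , lifted , X≈y) = total y , relaxation⇒system lifted , λ a b →
    ≈-trans (reflexive (cong₂ X (sym (cong proj₁ (Fin.remQuot-combine a b)))
      (sym (cong proj₂ (Fin.remQuot-combine {n} {n} a b)))))
      (≈-trans (≋⁺ (X≈y (at a b))) (nonempty≈ a b))
    where
    nonempty≈ : ∀ (a b : Fin n) → y (pair a b) ≈ total y (pair a b)
    nonempty≈ a b with nonempty? (pair a b)
    ... | yes _ = ≈-refl
    ... | no em = contradiction (_ , x∈⁅x⁆ (at a b)) em

  system⇒𝒯 : {G H : Graph n} {X : Matrix n} {φ : Subset (n ℕ.* n) → ℝ} → System ℝ-orderedRing k G H φ →
    (∀ J → ∣ J ∣ ≤ suc k → Sampled ℝ-orderedRing J φ) → (∀ a b → X a b ≈ φ (pair a b)) → 𝒯 (suc k) G H X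
  system⇒𝒯 {n} {φ = φ} sys sampled X≈φ = φ , system⇒relaxation sys sampled , λ i →
    ≋⁻ (≈-trans (X≈φ (quotient n i) (remainder {n} n i))
      (reflexive (cong (λ j → φ ⁅ j ⁆) (Fin.combine-remQuot {n} n i))))

open Points

module Asymmetry {n k : ℕ} (σ₁ σ₂ : Permutation′ (suc k)) where

  open Sums ℝ-orderedRing

  open CVC {n} {suc k} σ₁ σ₂

  -- Forgetting the side amounts to two copies of the same graph with identical colours, the case in
  -- which the joint construction gives points of `𝒯` for one graph.
  sided : Partition (Tuple n (suc k)) → Partition (Bool × Tuple n (suc k))
  sided π = record
    { _∼_ = λ (_ , u) (_ , v) → u ∼ v
    ; isDecEquivalence = record
      { isEquivalence = record { refl = ∼-refl ; sym = ∼-sym ; trans = ∼-trans }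
      ; _≟_ = λ (_ , u) (_ , v) → u ∼? v } }
    where open Partition π

  iterate-refines : ∀ G N {u v} → Partition._∼_ (iterate G (suc N)) u v → Partition._∼_ (iterate G N) u v
  iterate-refines G N = proj₁

  opaque
    -- The number of equivalent pairs never grows. When it pauses, every single indicator pauses,
    -- since none of them can increase to compensate for another.
    stabilises : ∀ G → ∃[ N ] StabilisesAt G N
    stabilises G = let N , eq = plateau related related-decreasing in
      N , λ u v → mk⇔ (iterate-refines G N) (λ u∼v → decidable-stable (Partition._∼?_ (iterate G (suc N)) u v)
        (λ ¬u∼v → contradiction (trans (sym (indicator-no N u v ¬u∼v))
          (trans (sum-≡⇒≡ (indicator-decreasing N) eq (∈-cartesianProduct⁺ (∈-tuples u) (∈-tuples v)))
            (indicator-yes N u v u∼v))) λ ()))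
      where
      pairs : List (Tuple n (suc k) × Tuple n (suc k))
      pairs = cartesianProduct (tuples n (suc k)) (tuples n (suc k))
      indicator : ℕ → Tuple n (suc k) × Tuple n (suc k) → ℕ
      indicator N (u , v) = if does (Partition._∼?_ (iterate G N) u v) then 1 else 0
      related : ℕ → ℕ
      related N = sum (List.map (indicator N) pairs)
      indicator-yes : ∀ N u v → Partition._∼_ (iterate G N) u v → indicator N (u , v) ≡ 1
      indicator-yes N u v p rewrite dec-true (Partition._∼?_ (iterate G N) u v) p = refl
      indicator-no : ∀ N u v → ¬ Partition._∼_ (iterate G (suc N)) u v → indicator (suc N) (u , v) ≡ 0
      indicator-no N u v ¬p = cong (if_then 1 else 0) (dec-false (Partition._∼?_ (iterate G (suc N)) u v) ¬p)
      indicator-decreasing : ∀ N p → indicator (suc N) p ≤ indicator N p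
      indicator-decreasing N (u , v) = cases (Partition._∼?_ (iterate G (suc N)) u v)
        where
        cases : Dec (Partition._∼_ (iterate G (suc N)) u v) → indicator (suc N) (u , v) ≤ indicator N (u , v)
        cases (yes p) = subst (indicator (suc N) (u , v) ≤_) (sym (indicator-yes N u v (iterate-refines G N p)))
                          (if≤1 (does (Partition._∼?_ (iterate G (suc N)) u v)))
          where
          if≤1 : ∀ b → (if b then 1 else 0) ≤ 1
          if≤1 true  = ℕ.≤-refl
          if≤1 false = z≤n
        cases (no ¬p) = ℕ.≤-trans (ℕ.≤-reflexive (indicator-no N u v ¬p)) z≤n
      related-decreasing : ∀ N → related (suc N) ≤ related N
      related-decreasing N = sum-mono pairs (indicator-decreasing N)

  stable : ∀ G N → StabilisesAt G N → Stable σ₁ σ₂ (λ _ → G) (sided (iterate G N))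
  stable G N stab = record
    { permuted₁ = λ {_} {_} {u} {v} u∼v → proj₁ (proj₂ (refined u v u∼v))
    ; permuted₂ = λ {_} {_} {u} {v} u∼v → proj₁ (proj₂ (proj₂ (refined u v u∼v)))
    ; pattern≡  = λ {_} {_} {u} {v} u∼v → 𝒞≡⇒pattern≡ G G u v (proj₁ (proj₂ (proj₂ (proj₂ (refined u v u∼v)))))
    ; counts    = λ { {_} {_} {u} {v} u∼v true  i (_ , w) → proj₁
        (proj₂ (proj₂ (proj₂ (proj₂ (refined u v u∼v)))) i w)
                    ; {_} {_} {u} {v} u∼v false i (_ , w) → proj₂
                        (proj₂ (proj₂ (proj₂ (proj₂ (refined u v u∼v)))) i w) }
    ; balanced  = λ _ _ _ → refl
    }
    where
    refined : ∀ u v → Partition._∼_ (iterate G N) u v → RefinedEquiv G (iterate G N) u v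
    refined u v = Equivalence.from (stab u v)

  Pos⇒∼ : ∀ {G φ} (sys : System ℝ-orderedRing k G G φ) N {u v} →
          Forward.Pos ℝ-orderedRing sys u v → Partition._∼_ (iterate G N) u v
  Pos⇒∼ sys zero    pos = _
  Pos⇒∼ {G} sys (suc N) {u} {v} pos =
    Pos⇒∼ sys N pos , Pos⇒∼ sys N (Pos-permute σ₁ {u} {v} pos) , Pos⇒∼ sys N (Pos-permute σ₂ {u} {v} pos) ,
    Pos⇒𝒞≡ {u} {v} pos , λ i w → counted true i w , counted false i w
    where
    open Forward ℝ-orderedRing sys
    open Partition (iterate G N)
    counted : ∀ β i w → countCell (neighbours G β i u) w ≡ countCell (neighbours G β i v) w
    counted β i w = count-neighbours (_∼? w) (_∼? w)
      (λ x y pos′ x∼w → ∼-trans (∼-sym (Pos⇒∼ sys N {x} {y} pos′)) x∼w)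
      (λ x y pos′ y∼w → ∼-trans (Pos⇒∼ sys N {x} {y} pos′) y∼w) β i {u} {v} pos

  module _ (gen : GeneratesSymmetricGroup σ₁ σ₂) (G : Graph n) where

    -- A constant pair of tuples describes the monomial of a single entry, so completeness kills the
    -- entries off the diagonal; the row sums put 1 on the diagonal.
    complete⇒≈identity : ∀ N → Complete (iterate G N) → ∀ X → 𝒯 (suc k) G G X → X ≈ᴹ identityMatrix
    complete⇒≈identity N complete X X∈𝒯 a b = ≋⁻ (≈-trans (X≈φ a b) (entries a b))
      where
      extracted = 𝒯⇒system {k = k} G G X X∈𝒯
      φ = proj₁ extracted
      sys = proj₁ (proj₂ extracted)
      X≈φ = proj₂ (proj₂ extracted)
      open System sys
      off-diagonal : ∀ a b → b ≢ a → φ (pair a b) ≈ 0#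
      off-diagonal a b b≢a = ≈0-stable (λ ≉0 → b≢a (sym (Vec.∷-injectiveˡ (complete _ _
        (Pos⇒∼ sys N {Vec.replicate (suc k) a} {Vec.replicate (suc k) b}
          (λ ≈0 → ≉0 (≈-trans (reflexive (cong φ (sym (img-replicate k a b)))) ≈0)))))))
      entries : ∀ a b → φ (pair a b) ≈ identityMatrix a b
      entries a b with a Fin.≟ b
      ... | no a≢b   = off-diagonal a b (a≢b ∘ sym)
      ... | yes refl = begin
        φ (pair a a)                                 ≈⟨ ∑-single (allFin⁺ n) (∈-allFin a) (off-diagonal a) ⟨
        ∑ₗ (allFin n) (λ w → φ (pair a w))            ≈⟨ ∑-cong (allFin n)
          (λ w → reflexive (cong φ (∪-identityˡ (pair a w)))) ⟨
        ∑ₗ (allFin n) (λ w → φ (⊥ ∪ pair a w))        ≈⟨ row ⊥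
          (ℕ.≤-trans (ℕ.≤-reflexive (∣⊥∣≡0 (n ℕ.* n))) z≤n) a ⟩
        φ ⊥                                          ≈⟨ φ⊥≈1 ⟩
        1#                                           ∎

    asymmetric : (∀ (X : Matrix n) → 𝒯 (suc k) G G X ⇔ (X ≈ᴹ identityMatrix)) ⇔ DeterminesAsymmetric G
    asymmetric = mk⇔ to from
      where
      module B N stab = Backward ℝ-orderedRing gen (stable G N stab)
      X₀ : ∀ N → StabilisesAt G N → Matrix n
      X₀ N stab a b = B.φ N stab (pair a b)
      point : ∀ N stab → 𝒯 (suc k) G G (X₀ N stab)
      point N stab = system⇒𝒯 {X = X₀ N stab} (B.system N stab) (B.sampled N stab) (λ _ _ → ≈-refl)
      to : (∀ X → 𝒯 (suc k) G G X ⇔ (X ≈ᴹ identityMatrix)) → DeterminesAsymmetric G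
      -- Equivalent tuples differing in slot `i` would give the constructed point a nonzero entry
      -- off the diagonal.
      to only-identity = let N , stab = stabilises G in N , stab , λ u v u∼v → lookup-ext (λ i →
        decidable-stable (lookup u i Fin.≟ lookup v i) (λ uᵢ≢vᵢ → B.∼⇒φ≉0 N stab {u} {v} u∼v i
          (≈-trans (≋⁺ {B.φ N stab (pair (lookup u i) (lookup v i))} {identityMatrix (lookup u i) (lookup v i)}
              (Equivalence.to (only-identity (X₀ N stab)) (point N stab) (lookup u i) (lookup v i)))
            (reflexive (cong (if_then 1ℝ else 0ℝ) (dec-false (lookup u i Fin.≟ lookup v i) uᵢ≢vᵢ))))))
      from : DeterminesAsymmetric G → ∀ X → 𝒯 (suc k) G G X ⇔ (X ≈ᴹ identityMatrix)
      -- The identity is not checked against the constraints: the point built from the stable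
      -- partition lies in the relaxation, hence equals the identity by the inclusion just proved.
      from (N , stab , complete) X = mk⇔ (complete⇒≈identity N complete X) (λ X≈I →
        system⇒𝒯 {X = X} (B.system N stab) (B.sampled N stab) (λ a b →
          ≈-trans (≋⁺ {X a b} {identityMatrix a b} (X≈I a b))
            (≈-sym (≋⁺ {B.φ N stab (pair a b)} {identityMatrix a b}
              (complete⇒≈identity N complete (X₀ N stab) (point N stab) a b)))))

-- Ordered refinement

count-cong : {P Q : A → Set} (P? : ∀ x → Dec (P x)) (Q? : ∀ x → Dec (Q x)) →
  (∀ x → P x → Q x) → (∀ x → Q x → P x) → ∀ xs → length (filter P? xs) ≡ length (filter Q? xs)
count-cong P? Q? f g [] = refl
count-cong P? Q? f g (x ∷ xs) with P? x | Q? x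
... | yes p | yes q = cong suc (count-cong P? Q? f g xs)
... | yes p | no ¬q = contradiction (f x p) ¬q
... | no ¬p | yes q = contradiction (g x q) ¬p
... | no ¬p | no ¬q = count-cong P? Q? f g xs

-- Pigeonhole for an injection given as a relation: the partner of the head is cut out of `ys`, and
-- an element of the tail with the same partner would equal the head.
length-≤ : (R : A → B → Set) {xs : List A} {ys : List B} → Unique xs →
  (∀ {x} → x ∈ xs → ∃[ y ] y ∈ ys × R x y) → (∀ {x x′ y} → R x y → R x′ y → x ≡ x′) → length xs ≤ length ys
length-≤ R {[]}     _ _ _ = z≤n
length-≤ R {x ∷ xs} {ys} (x∉ ∷ unique) related injective with related (here refl)
... | y , y∈ys , Rxy with as , bs , refl ← ∈-∃++ y∈ys =
  ℕ.≤-trans (s≤s (length-≤ R unique related′ injective)) (ℕ.≤-reflexive (trans (cong suc (List.length-++ as))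
    (trans (sym (ℕ.+-suc (length as) (length bs))) (sym (List.length-++ as)))))
  where
  related′ : ∀ {x′} → x′ ∈ xs → ∃[ y′ ] y′ ∈ as ++ bs × R x′ y′
  related′ x′∈ with y′ , y′∈ , Rx′y′ ← related (there x′∈) with ∈-++⁻ as y′∈
  ... | inj₁ ∈as = y′ , ∈-++⁺ˡ ∈as , Rx′y′
  ... | inj₂ (there ∈bs) = y′ , ∈-++⁺ʳ as ∈bs , Rx′y′
  ... | inj₂ (here refl) = contradiction (injective Rxy Rx′y′) (All.lookup x∉ x′∈)

<ˡᵉˣ-trans : ∀ {xs ys zs} → xs <ˡᵉˣ ys → ys <ˡᵉˣ zs → xs <ˡᵉˣ zs
<ˡᵉˣ-trans = Lex.<-transitive ≡.isEquivalence (subst (_ ℤ.<_) , subst (ℤ._< _)) ℤ.<-trans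

<ˡᵉˣ-compare : Trichotomous (Pointwise _≡_) _<ˡᵉˣ_
<ˡᵉˣ-compare = Lex.<-compare sym ℤ.<-cmp

_≟ˡ_ : (xs ys : List ℤ) → Dec (xs ≡ ys)
_≟ˡ_ = List.≡-dec ℤ._≟_

-- Definitionally the local list of values in `levelSets`, restated so that it can be reasoned
-- about.
distinct : (Tuple n k → List ℤ) → List (List ℤ)
distinct {n} {k} f = deduplicate _≟ˡ_ (List.map f (tuples n k))

distinct⁺ : (f : Tuple n k → List ℤ) (u : Tuple n k) → f u ∈ distinct f
distinct⁺ f u = ∈-deduplicate⁺ _≟ˡ_ (∈-map⁺ f (∈-tuples u))

distinct⁻ : (f : Tuple n k → List ℤ) → ∀ {x} → x ∈ distinct f → ∃[ u ] x ≡ f u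
distinct⁻ {n} {k} f x∈ with u , _ , eq ← ∈-map⁻ f (∈-deduplicate⁻ _≟ˡ_ (List.map f (tuples n k)) x∈) = u , eq

distinct-unique : (f : Tuple n k → List ℤ) → Unique (distinct f)
distinct-unique {n} {k} f = deduplicate-! _≟ˡ_ (List.map f (tuples n k))

size : OrderedPartition A → ℕ
size = OrderedPartition.size

position : (π : OrderedPartition A) → A → ℕ
position π u = toℕ (OrderedPartition.index π u)

position<size : (π : OrderedPartition A) (u : A) → position π u < size π
position<size π u = Fin.toℕ<n (OrderedPartition.index π u)

rank : (Tuple n k → List ℤ) → Tuple n k → ℕ
rank f u = length (filter (_<ˡᵉˣ? f u) (distinct f))

position≡rank : (f : Tuple n k → List ℤ) (u : Tuple n k) → position (levelSets f) u ≡ rank f u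
position≡rank f u = Fin.toℕ-fromℕ< _

-- By hypothesis `g ∘ h` determines `f`, so distinct values of `f` have distinct partners. The
-- partner depends on the tuple chosen to realise the value, hence the use of a relation.
size-≤ : (f g : Tuple n k → List ℤ) (h : Tuple n k → Tuple n k) → (∀ s t → g (h s) ≡ g (h t) → f s ≡ f t) →
         size (levelSets f) ≤ size (levelSets g)
size-≤ f g h inj = length-≤ (λ x y → ∃[ t ] x ≡ f t × y ≡ g (h t)) (distinct-unique f)
  (λ x∈ → let t , eq = distinct⁻ f x∈ in g (h t) , distinct⁺ g (h t) , t , eq , refl)
  (λ { (s , refl , eq) (t , refl , eq′) → inj s t (trans (sym eq) eq′) })

rank-≤ : (f g : Tuple n k → List ℤ) (h : Tuple n k → Tuple n k) → (∀ s t → g (h s) ≡ g (h t) → f s ≡ f t) →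
         ∀ {u v} → (∀ s → f s <ˡᵉˣ f u → g (h s) <ˡᵉˣ g v) → rank f u ≤ rank g v
rank-≤ f g h inj {u} {v} below = length-≤ (λ x y → ∃[ t ] x ≡ f t × y ≡ g (h t))
  (filter⁺ (_<ˡᵉˣ? f u) (distinct-unique f))
  (λ x∈ → let x∈′ , x<fu = ∈-filter⁻ (_<ˡᵉˣ? f u) {xs = distinct f} x∈ ; t , eq = distinct⁻ f x∈′ in
    g (h t) , ∈-filter⁺ (_<ˡᵉˣ? g v) (distinct⁺ g (h t)) (below t (subst (_<ˡᵉˣ f u) eq x<fu)) , t , eq , refl)
  (λ { (s , refl , eq) (t , refl , eq′) → inj s t (trans (sym eq) eq′) })

-- By transitivity all values below `f u` lie below `f v`, and `f u` itself is one more.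
rank-< : (f : Tuple n k → List ℤ) {u v : Tuple n k} → f u <ˡᵉˣ f v → rank f u < rank f v
rank-< f {u} {v} fu<fv = length-≤ _≡_
  (All.tabulate (λ x∈ eq → <ˡᵉˣ-irrefl (subst (_<ˡᵉˣ f u) (sym eq)
    (proj₂ (∈-filter⁻ (_<ˡᵉˣ? f u) {xs = distinct f} x∈))))
    ∷ filter⁺ (_<ˡᵉˣ? f u) (distinct-unique f))
  (λ { (here refl) → f u , ∈-filter⁺ (_<ˡᵉˣ? f v) {xs = distinct f} (distinct⁺ f u) fu<fv , refl
     ; {x} (there x∈) → let x∈′ , x<fu = ∈-filter⁻ (_<ˡᵉˣ? f u) {xs = distinct f} x∈ in
         x , ∈-filter⁺ (_<ˡᵉˣ? f v) {xs = distinct f} x∈′ (<ˡᵉˣ-trans x<fu fu<fv) , refl })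
  (λ p q → trans p (sym q))

rank-injective : (f : Tuple n k → List ℤ) {u v : Tuple n k} → rank f u ≡ rank f v → f u ≡ f v
rank-injective f {u} {v} eq with <ˡᵉˣ-compare (f u) (f v)
... | tri< lt _ _ = contradiction (rank-< f {u} {v} lt) (ℕ.<-irrefl eq)
... | tri≈ _ pw _ = Pointwise-≡⇒≡ pw
... | tri> _ _ gt = contradiction (rank-< f {v} {u} gt) (ℕ.<-irrefl (sym eq))

size-levelSets-≤ : (f : Tuple n k → List ℤ) → size (levelSets f) ≤ length (tuples n k)
size-levelSets-≤ {n} {k} f = length-≤ (λ x t → x ≡ f t) (distinct-unique f)
  (λ x∈ → let t , eq = distinct⁻ f x∈ in t , ∈-tuples t , eq) (λ p q → trans p (sym q))

levelSets-cong : {f g : Tuple n k → List ℤ} → f ≗ g → levelSets f ≐ᵒ levelSets g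
levelSets-cong {f = f} {g} f≗g =
  ℕ.≤-antisym (size-≤ f g id (λ s t → transfer s t)) (size-≤ g f id
    (λ s t eq → trans (sym (f≗g s)) (trans eq (f≗g t)))) ,
  λ u → trans (position≡rank f u) (trans (ℕ.≤-antisym
    (rank-≤ f g id transfer {u} {u} (λ s → subst₂ _<ˡᵉˣ_ (f≗g s) (f≗g u)))
    (rank-≤ g f id (λ s t eq → trans (sym (f≗g s)) (trans eq (f≗g t))) {u} {u}
      (λ s → subst₂ _<ˡᵉˣ_ (sym (f≗g s)) (sym (f≗g u)))))
    (sym (position≡rank g u)))
  where
  transfer : ∀ s t → g s ≡ g t → f s ≡ f t
  transfer s t eq = trans (f≗g s) (trans eq (sym (f≗g t)))

map-allFin-≡ : ∀ {s t} → s ≡ t → (f : Fin s → A) (g : Fin t → A) →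
  (∀ c d → toℕ c ≡ toℕ d → f c ≡ g d) → List.map f (allFin s) ≡ List.map g (allFin t)
map-allFin-≡ refl f g h = List.map-cong (λ c → h c c refl) (allFin _)

map-≡⇒≡ : {f g : A → B} {xs : List A} → List.map f xs ≡ List.map g xs → ∀ {x} → x ∈ xs → f x ≡ g x
map-≡⇒≡ {xs = x ∷ xs} eq (here refl) = List.∷-injectiveˡ eq
map-≡⇒≡ {xs = x ∷ xs} eq (there x∈)  = map-≡⇒≡ (List.∷-injectiveʳ eq) x∈

map-allFin-≡⇒≡ : ∀ {s t} → s ≡ t → (f : Fin s → A) (g : Fin t → A) →
  List.map f (allFin s) ≡ List.map g (allFin t) → ∀ c d → toℕ c ≡ toℕ d → f c ≡ g d
map-allFin-≡⇒≡ refl f g eq c d c≡d with refl ← Fin.toℕ-injective c≡d = map-≡⇒≡ eq (∈-allFin c)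

++-≡⇒≡ : {as bs cs ds : List A} → length as ≡ length bs → as ++ cs ≡ bs ++ ds → as ≡ bs × cs ≡ ds
++-≡⇒≡ {as = []}     {[]}     _   eq = refl , eq
++-≡⇒≡ {as = a ∷ as} {b ∷ bs} len eq with refl , eq′ ← List.∷-injective eq
  with refl , eq″ ← ++-≡⇒≡ {as = as} {bs} (ℕ.suc-injective len) eq′ = refl , eq″

concatMap-≡⇒≡ : {f g : A → List B} → (∀ x → length (f x) ≡ length (g x)) → {xs : List A} →
  concatMap f xs ≡ concatMap g xs → ∀ {x} → x ∈ xs → f x ≡ g x
concatMap-≡⇒≡ len {y ∷ xs} eq (here refl) = proj₁ (++-≡⇒≡ (len y) eq)
concatMap-≡⇒≡ len {y ∷ xs} eq (there x∈) = concatMap-≡⇒≡ len (proj₂ (++-≡⇒≡ (len y) eq)) x∈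

toList-≡⇒≡ : {u v : Vec A k} → Vec.toList u ≡ Vec.toList v → u ≡ v
toList-≡⇒≡ {u = []}    {[]}    _  = refl
toList-≡⇒≡ {u = x ∷ u} {y ∷ v} eq =
  cong₂ _∷_ (List.∷-injectiveˡ eq) (toList-≡⇒≡ (List.∷-injectiveʳ eq))

concat-≡⇒≡ : {M M′ : Vec (Vec A k) n} → Vec.concat M ≡ Vec.concat M′ → M ≡ M′
concat-≡⇒≡ {M = []}    {[]}      _  = refl
concat-≡⇒≡ {M = r ∷ M} {r′ ∷ M′} eq =
  cong₂ _∷_ (proj₁ (Vec.++-injective r r′ eq)) (concat-≡⇒≡ (proj₂ (Vec.++-injective r r′ eq)))

module OrderedRefinement {n k : ℕ} (σ₁ σ₂ : Permutation′ k) where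

  open OrderedCVC {n} {k} σ₁ σ₂
  open OrderedPartition using (countIndex)

  -- The components of `D`. Cells of different partitions have indices in different types and are
  -- compared by their numbers.
  record Agree (G H : Graph n) (π ρ : OrderedPartition (Tuple n k)) (u v : Tuple n k) : Set where
    field
      label  : position π u ≡ position ρ v
      label₁ : position π (permute σ₁ u) ≡ position ρ (permute σ₁ v)
      label₂ : position π (permute σ₂ u) ≡ position ρ (permute σ₂ v)
      matrix : 𝒞 G u ≡ 𝒞 H v
      counts : ∀ β i c d → toℕ c ≡ toℕ d →
               countIndex π (neighbours G β i u) c ≡ countIndex ρ (neighbours H β i v) d

  private
    block : Graph n → OrderedPartition (Tuple n k) → Bool → Tuple n k → Fin k → List ℤ
    block G π β u i = List.map (λ c → + countIndex π (neighbours G β i u) c) (allFin (size π))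

  Agree⇒D≡ : ∀ G H π ρ u v → size π ≡ size ρ → Agree G H π ρ u v → D G π u ≡ D H ρ v
  Agree⇒D≡ G H π ρ u v eq agree = cong₂ _∷_ (cong +_ label) (cong₂ _∷_ (cong +_ label₁)
    (cong₂ _∷_ (cong +_ label₂) (cong₂ _++_ (cong (Vec.toList ∘ Vec.concat) matrix)
      (List.concatMap-cong (λ i → cong₂ _++_ (blocks true i) (blocks false i)) (allFin k)))))
    where
    open Agree agree
    blocks : ∀ β i → block G π β u i ≡ block H ρ β v i
    blocks β i = map-allFin-≡ eq _ _ (λ c d c≡d → cong +_ (counts β i c d c≡d))

  -- Equally many cells mean equally long blocks of counts, so the two flattened lists split at the
  -- same places.
  D≡⇒Agree : ∀ G H π ρ u v → size π ≡ size ρ → D G π u ≡ D H ρ v → Agree G H π ρ u v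
  D≡⇒Agree G H π ρ u v size≡ eq = record
    { label  = ℤ.+-injective (List.∷-injectiveˡ eq)
    ; label₁ = ℤ.+-injective (List.∷-injectiveˡ (List.∷-injectiveʳ eq))
    ; label₂ = ℤ.+-injective (List.∷-injectiveˡ (List.∷-injectiveʳ (List.∷-injectiveʳ eq)))
    ; matrix = concat-≡⇒≡ (toList-≡⇒≡ (proj₁ tail≡))
    ; counts = λ { true i c d c≡d → ℤ.+-injective (map-allFin-≡⇒≡ size≡ _ _ (proj₁ (blocks i)) c d c≡d)
                 ; false i c d c≡d → ℤ.+-injective (map-allFin-≡⇒≡ size≡ _ _ (proj₂ (blocks i)) c d c≡d) }
    }
    where
    length-block : ∀ G π β u i → length (block G π β u i) ≡ size π
    length-block G π β u i = trans (List.length-map _ (allFin (size π))) (List.length-tabulate id)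
    length-block≡ : ∀ β i → length (block G π β u i) ≡ length (block H ρ β v i)
    length-block≡ β i = trans (length-block G π β u i) (trans size≡ (sym (length-block H ρ β v i)))
    matrixList : Graph n → Tuple n k → List ℤ
    matrixList Γ w = Vec.toList (Vec.concat (𝒞 Γ w))
    tail≡ : matrixList G u ≡ matrixList H v ×
            concatMap (λ i → block G π true u i ++ block G π false u i) (allFin k) ≡
            concatMap (λ i → block H ρ true v i ++ block H ρ false v i) (allFin k)
    tail≡ = ++-≡⇒≡ {as = matrixList G u} {matrixList H v}
      (trans (Vec.length-toList (Vec.concat (𝒞 G u))) (sym (Vec.length-toList (Vec.concat (𝒞 H v)))))
      (List.∷-injectiveʳ (List.∷-injectiveʳ (List.∷-injectiveʳ eq)))
    blocks : ∀ i → block G π true u i ≡ block H ρ true v i × block G π false u i ≡ block H ρ false v i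
    blocks i = ++-≡⇒≡ (length-block≡ true i) (concatMap-≡⇒≡
      {f = λ i → block G π true u i ++ block G π false u i} {λ i → block H ρ true v i ++ block H ρ false v i}
      (λ j → trans (List.length-++ (block G π true u j))
        (trans (cong₂ ℕ._+_ (length-block≡ true j) (length-block≡ false j))
        (sym (List.length-++ (block H ρ true v j))))) (proj₂ tail≡) (∈-allFin i))

  D-label : ∀ G H π ρ u v → D G π u ≡ D H ρ v → position π u ≡ position ρ v
  D-label G H π ρ u v eq = ℤ.+-injective (List.∷-injectiveˡ eq)

  -- The old label leads the list, so refinement preserves the order of the old cells. This is why
  -- the number of a cell can only grow from round to round.
  D-<ˡᵉˣ : ∀ G π u v → position π u < position π v → D G π u <ˡᵉˣ D G π v
  D-<ˡᵉˣ G π u v lt = this (ℤ.+<+ lt)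

  D-cong : ∀ G π ρ → π ≐ᵒ ρ → D G π ≗ D G ρ
  D-cong G π ρ (size≡ , position≡) u = Agree⇒D≡ G G π ρ u u size≡ record
    { label  = position≡ u
    ; label₁ = position≡ _
    ; label₂ = position≡ _
    ; matrix = refl
    ; counts = λ β i c d c≡d → count-cong _ _
        (λ x eq → Fin.toℕ-injective (trans (sym (position≡ x)) (trans (cong toℕ eq) c≡d)))
        (λ x eq → Fin.toℕ-injective (trans (position≡ x) (trans (cong toℕ eq) (sym c≡d))))
        (neighbours G β i u)
    }

  module _ (G : Graph n) where

    iterate-separates : ∀ m s t → D G (iterate G (suc m)) s ≡ D G (iterate G (suc m)) t →
                        D G (iterate G m) s ≡ D G (iterate G m) t
    iterate-separates m s t eq = rank-injective (D G (iterate G m)) (trans (sym (position≡rank _ s))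
      (trans (D-label G G (iterate G (suc m)) (iterate G (suc m)) s t eq) (position≡rank _ t)))

    position-increases : ∀ m u → position (iterate G m) u ≤ position (iterate G (suc m)) u
    position-increases zero    u = z≤n
    position-increases (suc m) u = subst₂ _≤_ (sym (position≡rank _ u)) (sym (position≡rank _ u))
      (rank-≤ (D G (iterate G m)) (D G (iterate G (suc m))) id (iterate-separates m) {u} {u}
        (λ s lt → D-<ˡᵉˣ G (iterate G (suc m)) s u (subst₂ _<_ (sym (position≡rank _ s))
          (sym (position≡rank _ u))
          (rank-< (D G (iterate G m)) {s} {u} lt))))

    -- It starts at the first refined partition: without tuples the initial partition has one empty
    -- cell and its refinement none.
    size-increases : ∀ m → size (iterate G (suc m)) ≤ size (iterate G (suc (suc m)))
    size-increases m = size-≤ (D G (iterate G m)) (D G (iterate G (suc m))) id (iterate-separates m)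

    opaque
      -- All positions and the number of cells grow and are bounded. A pause of their sum is a pause
      -- of each of them, which is equality of ordered partitions.
      stabilises : ∃[ m ] StabilisesAt G m
      stabilises =
        let m , eq = plateau (λ m → bound ℕ.∸ measure m) (λ m → ℕ.∸-monoʳ-≤ bound (measure-increases m))
            sums , sizes = +-≡⇒≡ (positions-increase m) (size-increases m)
              (sym (ℕ.∸-cancelˡ-≡ (measure-bounded (suc m)) (measure-bounded m) eq))
        in suc m , sym sizes , λ u → sym (sum-≡⇒≡ (position-increases (suc m)) sums (∈-tuples u))
        where
        ts : List (Tuple n k)
        ts = tuples n k
        positions : ℕ → ℕ
        positions m = sum (List.map (position (iterate G (suc m))) ts)
        positions-increase : ∀ m → positions m ≤ positions (suc m)
        positions-increase m = sum-mono ts (position-increases (suc m))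
        measure : ℕ → ℕ
        measure m = positions m ℕ.+ size (iterate G (suc m))
        measure-increases : ∀ m → measure m ≤ measure (suc m)
        measure-increases m = ℕ.+-mono-≤ (positions-increase m) (size-increases m)
        -- Positions stay below the number of cells, and there are at most as many cells as tuples.
        bound : ℕ
        bound = sum (List.map (λ _ → length ts) ts) ℕ.+ length ts
        size-bounded : ∀ m → size (iterate G (suc m)) ≤ length ts
        size-bounded m = size-levelSets-≤ (D G (iterate G m))
        measure-bounded : ∀ m → measure m ≤ bound
        measure-bounded m = ℕ.+-mono-≤
          (sum-mono ts (λ u → ℕ.≤-trans (ℕ.<⇒≤ (position<size (iterate G (suc m)) u)) (size-bounded m)))
          (size-bounded m)

    -- The stable rounds of two graphs may differ; this allows both to be moved to a common later
    -- round.
    D-stable : ∀ {m} → StabilisesAt G m → ∀ d → D G (iterate G (d ℕ.+ m)) ≗ D G (iterate G m)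
    D-stable stab zero    u = refl
    D-stable {m} stab (suc d) u = trans
      (D-cong G (iterate G (suc d ℕ.+ m)) (iterate G (suc m)) (levelSets-cong (D-stable stab d)) u)
      (D-cong G (iterate G (suc m)) (iterate G m) stab u)

    -- In a stable round the position is also the rank of the value of `D`, and the rank determines
    -- the value.
    position≡⇒D≡ : ∀ {m} → StabilisesAt G m → ∀ u v →
                   position (iterate G m) u ≡ position (iterate G m) v → D G (iterate G m) u ≡ D G
                     (iterate G m) v
    position≡⇒D≡ {m} (_ , position≡) u v eq = rank-injective (D G (iterate G m))
      (trans (sym (position≡rank _ u)) (trans (position≡ u) (trans eq
        (trans (sym (position≡ v)) (position≡rank _ v)))))

-- Equidistributed functions and bijections

lookup-injective : {xs : List A} → Unique xs → ∀ i j → List.lookup xs i ≡ List.lookup xs j → i ≡ j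
lookup-injective (_ ∷ _)  zero    zero    _  = refl
lookup-injective (x∉ ∷ _) zero    (suc j) eq = contradiction eq (All.lookup x∉ (∈-lookup j))
lookup-injective (x∉ ∷ _) (suc i) zero    eq = contradiction (sym eq) (All.lookup x∉ (∈-lookup i))
lookup-injective (_ ∷ u)  (suc i) (suc j) eq = cong suc (lookup-injective u i j eq)

module _ (_≟_ : (x y : A) → Dec (x ≡ y)) where

  private
    one-if : {x y : A} → Dec (x ≡ y) → ℕ
    one-if d = if does d then 1 else 0

  occurrences : ∀ {N} → (Fin N → A) → A → ℕ
  occurrences {zero}  f d = 0
  occurrences {suc N} f d = one-if (f zero ≟ d) ℕ.+ occurrences (f ∘ suc) d

  occurrences-punchIn : ∀ {N} (f : Fin (suc N) → A) j d →
    occurrences f d ≡ one-if (f j ≟ d) ℕ.+ occurrences (f ∘ punchIn j) d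
  occurrences-punchIn         f zero    d = refl
  occurrences-punchIn {suc N} f (suc j) d = begin
    a ℕ.+ occurrences (f ∘ suc) d       ≡⟨ cong (a ℕ.+_) (occurrences-punchIn (f ∘ suc) j d) ⟩
    a ℕ.+ (b ℕ.+ c)                     ≡⟨ sym (ℕ.+-assoc a b c) ⟩
    a ℕ.+ b ℕ.+ c                       ≡⟨ cong (ℕ._+ c) (ℕ.+-comm a b) ⟩
    b ℕ.+ a ℕ.+ c                       ≡⟨ ℕ.+-assoc b a c ⟩
    b ℕ.+ (a ℕ.+ c)                     ∎
    where
    open ≡.≡-Reasoning
    a = one-if (f zero ≟ d)
    b = one-if (f (suc j) ≟ d)
    c = occurrences (f ∘ suc ∘ punchIn j) d

  occurs : ∀ {N} (f : Fin N → A) d {m} → occurrences f d ≡ suc m → ∃[ j ] f j ≡ d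
  occurs {suc N} f d eq with f zero ≟ d
  ... | yes f0≡d = zero , f0≡d
  ... | no _ with j , fj≡d ← occurs (f ∘ suc) d eq = suc j , fj≡d

  occurrences-here : ∀ {N} (f : Fin (suc N) → A) → occurrences f (f zero) ≡ suc (occurrences (f ∘ suc) (f zero))
  occurrences-here f with f zero ≟ f zero
  ... | yes _ = refl
  ... | no ≢  = contradiction refl ≢

  -- The value `f zero` is matched with an occurrence of it in `g`. Deleting both keeps the counts
  -- equal, and `insert` puts the match back.
  equidistributed⇒permutation : ∀ {N} (f g : Fin N → A) → (∀ d → occurrences f d ≡ occurrences g d) →
    Σ (Permutation′ N) λ τ → ∀ i → f i ≡ g (τ ⟨$⟩ʳ i)
  equidistributed⇒permutation {zero}  f g h = Perm.id , λ ()
  equidistributed⇒permutation {suc N} f g h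
    with j , gj≡f0 ← occurs g (f zero) (trans (sym (h (f zero))) (occurrences-here f))
    with τ , f≡gτ ← equidistributed⇒permutation (f ∘ suc) (g ∘ punchIn j)
      (λ d → ℕ.+-cancelˡ-≡ (one-if (f zero ≟ d)) _ _
           (trans (h d) (trans (occurrences-punchIn g j d)
             (cong (λ x → one-if (x ≟ d) ℕ.+ occurrences (g ∘ punchIn j) d) gj≡f0)))) =
    insert zero j τ , λ
      { zero    → sym gj≡f0
      ; (suc i) → trans (f≡gτ i) (cong g (sym (Perm.insert-punchIn zero j τ i))) }

  private
    occurrences-lookup : (f : B → A) (xs : List B) (d : A) →
      occurrences (f ∘ List.lookup xs) d ≡ length (filter (λ x → f x ≟ d) xs)
    occurrences-lookup f []       d = refl
    occurrences-lookup f (x ∷ xs) d with f x ≟ d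
    ... | yes _ = cong suc (occurrences-lookup f xs d)
    ... | no _  = occurrences-lookup f xs d

  equidistributed⇒bijection : (f g : Tuple n k → A) →
    (∀ d → length (filter (λ u → f u ≟ d) (tuples n k)) ≡ length (filter (λ u → g u ≟ d) (tuples n k))) →
    Σ (Tuple n k ⤖ Tuple n k) λ γ → ∀ u → f u ≡ g (Bijection.to γ u)
  equidistributed⇒bijection {n} {k} f g h = ↔⇒⤖ (mk↔ₛ′ to from to-from from-to) , λ u →
    trans (cong f (sym (at-number u))) (f≡gτ (number u))
    where
    ts = tuples n k
    number : Tuple n k → Fin (length ts)
    number u = Any.index (∈-tuples u)
    at-number : ∀ u → List.lookup ts (number u) ≡ u
    at-number u = sym (Any.lookup-index (∈-tuples u))
    number-at : ∀ i → number (List.lookup ts i) ≡ i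
    number-at i = lookup-injective (tuples-unique n k) _ i (at-number (List.lookup ts i))
    matching = equidistributed⇒permutation (f ∘ List.lookup ts) (g ∘ List.lookup ts)
      (λ d → trans (occurrences-lookup f ts d) (trans (h d) (sym (occurrences-lookup g ts d))))
    τ = proj₁ matching
    f≡gτ = proj₂ matching
    to from : Tuple n k → Tuple n k
    to u = List.lookup ts (τ ⟨$⟩ʳ number u)
    from u = List.lookup ts (τ ⟨$⟩ˡ number u)
    to-from : ∀ u → to (from u) ≡ u
    to-from u = trans (cong (λ i → List.lookup ts (τ ⟨$⟩ʳ i)) (number-at _))
      (trans (cong (List.lookup ts) (Perm.inverseʳ τ)) (at-number u))
    from-to : ∀ u → from (to u) ≡ u
    from-to u = trans (cong (λ i → List.lookup ts (τ ⟨$⟩ˡ i)) (number-at _))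
      (trans (cong (List.lookup ts) (Perm.inverseˡ τ)) (at-number u))

-- Non-isomorphism

-- A bijection carrying `f` to `g` shows that they have the same set of values. Sizes and ranks
-- depend on that set alone, so equal values receive equal cell numbers in the two ordered
-- partitions.
module Matched {n k : ℕ} (f g : Tuple n k → List ℤ) (γ : Tuple n k ⤖ Tuple n k)
  (f≡gγ : ∀ u → f u ≡ g (Bijection.to γ u)) where

  to from : Tuple n k → Tuple n k
  to = Bijection.to γ
  from v = proj₁ (Bijection.strictlySurjective γ v)

  to-from : ∀ v → to (from v) ≡ v
  to-from v = proj₂ (Bijection.strictlySurjective γ v)

  g≡f-from : ∀ v → g v ≡ f (from v)
  g≡f-from v = trans (cong g (sym (to-from v))) (sym (f≡gγ (from v)))

  separates : ∀ s t → g (to s) ≡ g (to t) → f s ≡ f t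
  separates s t eq = trans (f≡gγ s) (trans eq (sym (f≡gγ t)))

  separates′ : ∀ s t → f (from s) ≡ f (from t) → g s ≡ g t
  separates′ s t eq = trans (g≡f-from s) (trans eq (sym (g≡f-from t)))

  size≡ : size (levelSets f) ≡ size (levelSets g)
  size≡ = ℕ.≤-antisym (size-≤ f g to separates) (size-≤ g f from separates′)

  position≡ : ∀ {u v} → f u ≡ g v → position (levelSets f) u ≡ position (levelSets g) v
  position≡ {u} {v} eq = trans (position≡rank f u) (trans (ℕ.≤-antisym
    (rank-≤ f g to separates {u} {v} (λ s → subst₂ _<ˡᵉˣ_ (f≡gγ s) eq))
    (rank-≤ g f from separates′ {v} {u} (λ s → subst₂ _<ˡᵉˣ_ (g≡f-from s) (sym eq))))
    (sym (position≡rank g v)))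

  count≡ : {P Q : Tuple n k → Set} (P? : ∀ u → Dec (P u)) (Q? : ∀ v → Dec (Q v)) →
           (∀ u → P u → Q (to u)) → (∀ v → Q v → P (from v)) →
           length (filter P? (tuples n k)) ≡ length (filter Q? (tuples n k))
  count≡ P? Q? P⇒Q Q⇒P = ℕ.≤-antisym
    (length-≤ (λ u v → v ≡ to u) (filter⁺ P? (tuples-unique n k))
      (λ {u} u∈ → to u , ∈-filter⁺ Q? (∈-tuples (to u))
        (P⇒Q u (proj₂ (∈-filter⁻ P? {xs = tuples n k} u∈))) , refl)
      (λ eq eq′ → Bijection.injective γ (trans (sym eq) eq′)))
    (length-≤ (λ v u → v ≡ to u) (filter⁺ Q? (tuples-unique n k))
      (λ {v} v∈ → from v , ∈-filter⁺ P? (∈-tuples (from v))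
        (Q⇒P v (proj₂ (∈-filter⁻ Q? {xs = tuples n k} v∈))) , sym (to-from v))
      (λ eq eq′ → trans eq (sym eq′)))

module NonIsomorphism {n k : ℕ} (σ₁ σ₂ : Permutation′ (suc k)) (G H : Graph n) where

  open OrderedCVC {n} {suc k} σ₁ σ₂
  open OrderedRefinement {n} {suc k} σ₁ σ₂

  module _ {φ : Subset (n ℕ.* n) → ℝ} (sys : System ℝ-orderedRing k G H φ) where

    open Forward ℝ-orderedRing sys

    -- Equal sizes belong to the invariant because the blocks of counts inside `D` line up only for
    -- equally many cells.
    Matches : ℕ → Set
    Matches m = size (iterate G m) ≡ size (iterate H m) ×
                (∀ u v → Pos u v → position (iterate G m) u ≡ position (iterate H m) v)

    Pos⇒D≡ : ∀ m → Matches m → ∀ u v → Pos u v → D G (iterate G m) u ≡ D H (iterate H m) v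
    Pos⇒D≡ m (size≡ , position≡) u v pos = Agree⇒D≡ G H (iterate G m) (iterate H m) u v size≡ record
      { label  = position≡ u v pos
      ; label₁ = position≡ (permute σ₁ u) (permute σ₁ v) (Pos-permute σ₁ {u} {v} pos)
      ; label₂ = position≡ (permute σ₂ u) (permute σ₂ v) (Pos-permute σ₂ {u} {v} pos)
      ; matrix = Pos⇒𝒞≡ {u} {v} pos
      ; counts = λ β i c d c≡d → count-neighbours (λ x → index (iterate G m) x Fin.≟ c)
          (λ x → index (iterate H m) x Fin.≟ d)
          (λ x y pos′ eq → Fin.toℕ-injective (trans (sym (position≡ x y pos′)) (trans (cong toℕ eq) c≡d)))
          (λ x y pos′ eq → Fin.toℕ-injective (trans (position≡ x y pos′) (trans (cong toℕ eq) (sym c≡d))))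
          β i {u} {v} pos
      }
      where open OrderedPartition using (index)

    bijection : ∀ m → Matches m → Σ (Tuple n (suc k) ⤖ Tuple n (suc k)) λ γ →
                ∀ u → D G (iterate G m) u ≡ D H (iterate H m) (Bijection.to γ u)
    bijection m match = equidistributed⇒bijection _≟ˡ_ (D G (iterate G m)) (D H (iterate H m)) (λ d →
      count-tuples (λ u → D G (iterate G m) u ≟ˡ d) (λ v → D H (iterate H m) v ≟ˡ d)
        (λ u v pos eq → trans (sym (Pos⇒D≡ m match u v pos)) eq)
        (λ u v pos eq → trans (Pos⇒D≡ m match u v pos) eq))

    -- Equal values of `D` do not by themselves give equal cell numbers, since a number counts the
    -- smaller values in the whole graph. The bijection of the current round shows that `G` and `H`
    -- have the same values, which makes the next numbering common.
    matches : ∀ m → Matches m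
    matches zero    = refl , λ _ _ _ → refl
    matches (suc m) = size≡ , λ u v pos → position≡ {u} {v} (Pos⇒D≡ m (matches m) u v pos)
      where open Matched (D G (iterate G m)) (D H (iterate H m)) (proj₁ (bijection m (matches m))) (proj₂ (bijection m (matches m)))

  module _ {M N : ℕ} (stabG : StabilisesAt G M) (stabH : StabilisesAt H N)
    (γ : Tuple n (suc k) ⤖ Tuple n (suc k))
    (D≡Dγ : ∀ u → D G (iterate G M) u ≡ D H (iterate H N) (Bijection.to γ u)) where

    open Matched (D G (iterate G M)) (D H (iterate H N)) γ D≡Dγ

    Γ : Bool → Graph n
    Γ true  = G
    Γ false = H

    Π : Bool → OrderedPartition (Tuple n (suc k))
    Π true  = iterate G M
    Π false = iterate H N

    colour : Bool × Tuple n (suc k) → ℕ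
    colour (s , u) = position (Π s) u

    sameColour : Partition (Bool × Tuple n (suc k))
    sameColour = record
      { _∼_ = λ x y → colour x ≡ colour y
      ; isDecEquivalence = record
        { isEquivalence = record { refl = refl ; sym = sym ; trans = trans }
        ; _≟_ = λ x y → colour x ℕ.≟ colour y } }

    Π-size≡ : ∀ s t → size (Π s) ≡ size (Π t)
    Π-size≡ true  true  = refl
    Π-size≡ false false = refl
    -- `size≡` compares the next rounds; stability on either side brings the sizes back to the
    -- current ones.
    Π-size≡ true  false = trans (sym (proj₁ stabG)) (trans size≡ (proj₁ stabH))
    Π-size≡ false true  = sym (Π-size≡ true false)

    colour≡⇒D≡ : ∀ s t u v → colour (s , u) ≡ colour (t , v) → D (Γ s) (Π s) u ≡ D (Γ t) (Π t) v
    colour≡⇒D≡ true  true  u v eq = position≡⇒D≡ G {M} stabG u v eq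
    colour≡⇒D≡ false false u v eq = position≡⇒D≡ H {N} stabH u v eq
    -- The tuple `u` is replaced by its partner `to u`, which has the same label because the label
    -- is part of `D`; stability of `H` does the rest.
    colour≡⇒D≡ true  false u v eq = trans (D≡Dγ u) (position≡⇒D≡ H {N} stabH (to u) v
      (trans (sym (D-label G H (iterate G M) (iterate H N) u (to u) (D≡Dγ u))) eq))
    colour≡⇒D≡ false true  u v eq = sym (colour≡⇒D≡ true false v u (sym eq))

    sameColour-stable : Stable σ₁ σ₂ Γ sameColour
    sameColour-stable = record
      { permuted₁ = λ {s} {t} {u} {v} eq → Agree.label₁ (agree s t u v eq)
      ; permuted₂ = λ {s} {t} {u} {v} eq → Agree.label₂ (agree s t u v eq)
      ; pattern≡  = λ {s} {t} {u} {v} eq → 𝒞≡⇒pattern≡ (Γ s) (Γ t) u v (Agree.matrix (agree s t u v eq))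
      ; counts    = λ {s} {t} {u} {v} eq β i z → trans (counted s (neighbours (Γ s) β i u) z)
          (trans (Agree.counts (agree s t u v eq) β i (cell s z) (cell t z)
            (trans (toℕ-cell s z) (sym (toℕ-cell t z))))
            (sym (counted t (neighbours (Γ t) β i v) z)))
      ; balanced  = balanced
      }
      where
      agree : ∀ s t u v → colour (s , u) ≡ colour (t , v) → Agree (Γ s) (Γ t) (Π s) (Π t) u v
      agree s t u v eq = D≡⇒Agree (Γ s) (Γ t) (Π s) (Π t) u v (Π-size≡ s t) (colour≡⇒D≡ s t u v eq)
      cell : ∀ s → Bool × Tuple n (suc k) → Fin (size (Π s))
      cell s (r , w) = fromℕ< (subst (position (Π r) w <_) (Π-size≡ r s) (position<size (Π r) w))
      toℕ-cell : ∀ s z → toℕ (cell s z) ≡ colour z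
      toℕ-cell s (r , w) = Fin.toℕ-fromℕ< _
      counted : ∀ s us z → length (filter (λ x → colour (s , x) ℕ.≟ colour z) us) ≡
                           OrderedPartition.countIndex (Π s) us (cell s z)
      counted s us z = count-cong _ _
        (λ x eq → Fin.toℕ-injective (trans eq (sym (toℕ-cell s z))))
        (λ x eq → trans (cong toℕ eq) (toℕ-cell s z)) us
      label≡ : ∀ u → colour (true , u) ≡ colour (false , to u)
      label≡ u = D-label G H (iterate G M) (iterate H N) u (to u) (D≡Dγ u)
      number : Bool → Bool × Tuple n (suc k) → ℕ
      number s z = length (filter (λ x → colour (s , x) ℕ.≟ colour z) (tuples n (suc k)))
      G≡H : ∀ z → number true z ≡ number false z
      G≡H z = count≡ _ _ (λ u eq → trans (sym (label≡ u)) eq)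
        (λ v eq → trans (label≡ (from v)) (trans (cong (λ x → colour (false , x)) (to-from v)) eq))
      balanced : ∀ z s t → number s z ≡ number t z
      balanced z true  true  = refl
      balanced z false false = refl
      balanced z true  false = G≡H z
      balanced z false true  = sym (G≡H z)

  nonIsomorphic : GeneratesSymmetricGroup σ₁ σ₂ →
                  (∀ (X : Matrix n) → ¬ 𝒯 (suc k) G H X) ⇔ DeterminesNonIsomorphic G H
  nonIsomorphic gen = mk⇔ to from
    where
    to : (∀ (X : Matrix n) → ¬ 𝒯 (suc k) G H X) → DeterminesNonIsomorphic G H
    to empty = proj₁ (stabilises G) , proj₁ (stabilises H) , proj₂ (stabilises G) , proj₂ (stabilises H) ,
      λ (γ , D≡Dγ) → refute (proj₁ (stabilises G)) (proj₁ (stabilises H)) (proj₂ (stabilises G))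
        (proj₂ (stabilises H)) γ D≡Dγ
      where
      refute : ∀ M N → StabilisesAt G M → StabilisesAt H N → (γ : Tuple n (suc k) ⤖ Tuple n (suc k)) →
               ¬ (∀ u → D G (iterate G M) u ≡ D H (iterate H N) (Bijection.to γ u))
      refute M N stabG stabH γ D≡Dγ =
        empty X₀ (system⇒𝒯 {X = X₀} B.system B.sampled (λ a b → Sums.≈-refl ℝ-orderedRing))
        where
        module B = Backward ℝ-orderedRing gen (sameColour-stable {M} {N} stabG stabH γ D≡Dγ)
        X₀ : Matrix n
        X₀ a b = B.φ (pair a b)
    from : DeterminesNonIsomorphic G H → ∀ (X : Matrix n) → ¬ 𝒯 (suc k) G H X
    from (M , N , stabG , stabH , ¬γ) X X∈𝒯 =
      let φ , sys , _ = 𝒯⇒system G H X X∈𝒯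
          -- Round `N + M` is past both stable rounds, and at a common round the colours of `G` and
          -- `H` are comparable.
          γ , D≡Dγ = bijection sys (N ℕ.+ M) (matches sys (N ℕ.+ M))
      in ¬γ (γ , λ u → trans (sym (D-stable G {M} stabG N u)) (trans (D≡Dγ u)
           (trans (cong (λ m → D H (iterate H m) (Bijection.to γ u)) (ℕ.+-comm N M))
             (D-stable H {N} stabH M (Bijection.to γ u)))))

theorem1p1 : (k : ℕ) → 1 ≤ k → (σ₁ σ₂ : Permutation′ k) →
    GeneratesSymmetricGroup σ₁ σ₂ →
    (n : ℕ) (G H : Graph n) →
    ((∀ (X : Matrix n) → 𝒯 k G G X ⇔ (X ≈ᴹ identityMatrix)) ⇔
    CVC.DeterminesAsymmetric σ₁ σ₂ G) ×
    ((∀ (X : Matrix n) → ¬ 𝒯 k G H X) ⇔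
    OrderedCVC.DeterminesNonIsomorphic σ₁ σ₂ G H)
theorem1p1 (suc k) _ σ₁ σ₂ gen n G H =
  Asymmetry.asymmetric σ₁ σ₂ gen G , NonIsomorphism.nonIsomorphic σ₁ σ₂ G H gen
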